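{- Let $C\subseteq\mathbb{F}_2^n$ be a binary linear $[n,k,d]$ code with $\mathbf{1}_n\in C$, whose dual $C^\perp$ has minimum distance $d^\perp$, and let $t$ be a positive integer such that $$d^\perp-t=\#\{u \mid C_u\neq\emptyset,\ 0<u\le n-t\}.$$ (1) If $d^\perp-t=1$, then $(d^\perp,t)=(2,1)$ or $(4,3)$. Moreover, $\delta(C)=s(C)=\delta(C^\perp)=s(C^\perp)$ and this common value is $1$ or $3$. (2) If $d^\perp-t=2$, then $(d^\perp,t)=(4,2)$. (3) If $d^\perp-t=3$, then $(d^\perp,t)\in\{(4,1),(6,3),(8,5)\}$.
   Context: $\mathbf{1}_n$ is the all-ones vector. $C^\perp=\{y\in\mathbb{F}_2^n : \sum_i x_iy_i=0 \text{ for all } x\in C\}$, and $d^\perp$ is the minimum weight of a nonzero vector of $C^\perp$ (assumed $C^\perp\neq 0$). For $u$, $C_u=\{c\in C : \mathrm{wt}(c)=u\}$, where $\mathrm{wt}$ is the Hamming weight. A $t$-$(v,k,\lambda)$ design is a pair $(X,\mathcal{B})$ with $|X|=v$ and $\mathcal{B}$ a collection of $k$-subsets of $X$ (blocks) such that every $t$-subset of $X$ is contained in exactly $\lambda$ blocks. The support of $x\in\mathbb{F}_2^n$ is $\mathrm{supp}(x)=\{i : x_i\neq 0\}$. The support design $D_w$ of $C$ for weight $w$ has point set $\{1,\dots,n\}$ and blocks the supports of the codewords of $C$ of weight $w$; similarly for $C^\perp$. $\delta(C)=\max\{t\in\mathbb{N} \mid D_w \text{ is a } t\text{ -design for every } w\}$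 and $s(C)=\max\{t\in\mathbb{N}\mid D_w \text{ is a } t\text{ -design for some } w\}$, where $w$ ranges over the weights with $0<w<n$ occurring in $C$; $\delta(C^\perp), s(C^\perp)$ are defined in the same way for $C^\perp$. -}

module Defs where

open import Data.Bool.Base using (Bool; true; false; _∧_; _xor_)
open import Data.Bool.Properties
  using (_≟_; xor-∧-commutativeRing; ∧-zeroʳ; ∧-distribˡ-xor)
open import Data.Fin.Subset using (Subset; inside; outside; _⊆_; ∣_∣)
open import Data.Fin.Subset.Properties using (_⊆?_; anySubset?)
open import Data.List.Base as List using (List; _++_; length; filter; upTo)
open import Data.Nat.Base using (ℕ; zero; suc; _∸_; _≤_; _<_)
import Data.Nat.Properties as ℕ
open import Data.Product.Base using (Σ; ∃; _×_; _,_)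
open import Data.Vec.Base as Vec using (Vec; []; _∷_; replicate; zipWith; foldr′)
open import Data.Vec.Properties using (≡-dec)
open import Data.Vec.Relation.Unary.All using (All)
open import Level using (0ℓ)
open import Relation.Binary.PropositionalEquality
  using (_≡_; _≢_; refl; trans; cong₂)
open import Relation.Nullary using (Dec; yes; no; ¬?)
open import Relation.Nullary.Decidable using (_×-dec_; decidable-stable)
open import Relation.Unary using (Pred; Decidable)

import Algebra.Properties.CommutativeSemigroup as CommutativeSemigroupProperties
open import Algebra.Bundles using (CommutativeRing)

-- 𝔽₂ is the ring xor-∧-commutativeRing on Bool: false is 0, true is 1,
-- _xor_ is addition and _∧_ is multiplication.

𝔽₂ : Set
𝔽₂ = Bool

Word : ℕ → Set
Word n = Vec 𝔽₂ n

𝟎 𝟏 : ∀ {n} → Word n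
𝟎 = replicate _ false
𝟏 = replicate _ true

infixl 6 _⊕_
infixl 7 _·_

_⊕_ : ∀ {n} → Word n → Word n → Word n
_⊕_ = zipWith _xor_

_·_ : ∀ {n} → 𝔽₂ → Word n → Word n
a · x = Vec.map (a ∧_) x

⟨_,_⟩ : ∀ {n} → Word n → Word n → 𝔽₂
⟨ x , y ⟩ = foldr′ _xor_ false (zipWith _∧_ x y)

-- Subset n is Vec Bool n with inside = true, so {i ∣ xᵢ ≠ 0} is x itself.

supp : ∀ {n} → Word n → Subset n
supp x = x

wt : ∀ {n} → Word n → ℕ
wt x = ∣ supp x ∣

-- Over 𝔽₂, closure under scalar multiplication follows from 0∈ and ⊕-closed.
-- Every subset of a finite set is classically decidable, so ∈? excludes no
-- code; it makes the counts below computable.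

record LinearCode (n : ℕ) : Set₁ where
  field
    Codeword : Pred (Word n) 0ℓ
    ∈?       : Decidable Codeword
    0∈       : Codeword 𝟎
    ⊕-closed : ∀ {x y} → Codeword x → Codeword y → Codeword (x ⊕ y)

open LinearCode public using (Codeword)

lincomb : ∀ {n k} → Vec 𝔽₂ k → Vec (Word n) k → Word n
lincomb a b = foldr′ _⊕_ 𝟎 (zipWith _·_ a b)

record IsBasis {n k} (C : LinearCode n) (b : Vec (Word n) k) : Set where
  field
    inCode      : All (Codeword C) b
    independent : ∀ a → lincomb a b ≡ 𝟎 → a ≡ 𝟎
    spanning    : ∀ {c} → Codeword C c → ∃ λ a → lincomb a b ≡ c

HasDimension : ∀ {n} → LinearCode n → ℕ → Set
HasDimension {n} C k = Σ (Vec (Word n) k) (IsBasis C)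

-- The minimum weight of a nonzero codeword; one exists, so C ≠ 0.

HasMinDistance : ∀ {n} → LinearCode n → ℕ → Set
HasMinDistance C d =
  (∃ λ c → Codeword C c × c ≢ 𝟎 × wt c ≡ d) ×
  (∀ c → Codeword C c → c ≢ 𝟎 → d ≤ wt c)

private
  ⟨,⟩-zeroʳ : ∀ {n} (x : Word n) → ⟨ x , 𝟎 ⟩ ≡ false
  ⟨,⟩-zeroʳ []      = refl
  ⟨,⟩-zeroʳ (a ∷ x) = cong₂ _xor_ (∧-zeroʳ a) (⟨,⟩-zeroʳ x)

  ⟨,⟩-distribˡ-⊕ : ∀ {n} (x y z : Word n) →
                   ⟨ x , y ⊕ z ⟩ ≡ ⟨ x , y ⟩ xor ⟨ x , z ⟩
  ⟨,⟩-distribˡ-⊕ []      []      []      = refl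
  ⟨,⟩-distribˡ-⊕ (a ∷ x) (b ∷ y) (c ∷ z) =
    trans (cong₂ _xor_ (∧-distribˡ-xor a b c) (⟨,⟩-distribˡ-⊕ x y z))
          (interchange (a ∧ b) (a ∧ c) ⟨ x , y ⟩ ⟨ x , z ⟩)
    where
    open CommutativeSemigroupProperties
      (CommutativeRing.+-commutativeSemigroup xor-∧-commutativeRing)
      using (interchange)

_^⊥ : ∀ {n} → LinearCode n → LinearCode n
_^⊥ {n} C = record
  { Codeword = Orthogonal
  ; ∈?       = orthogonal?
  ; 0∈       = λ x _ → ⟨,⟩-zeroʳ x
  ; ⊕-closed = λ {y} {z} y∈ z∈ x x∈ →
      trans (⟨,⟩-distribˡ-⊕ x y z) (cong₂ _xor_ (y∈ x x∈) (z∈ x x∈))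
  }
  where
  Orthogonal : Pred (Word n) 0ℓ
  Orthogonal y = ∀ x → Codeword C x → ⟨ x , y ⟩ ≡ false

  orthogonal? : Decidable Orthogonal
  orthogonal? y
    with anySubset? (λ x → LinearCode.∈? C x ×-dec ¬? (⟨ x , y ⟩ ≟ false))
  ... | yes (x , x∈ , ≢0) = no λ y∈ → ≢0 (y∈ x x∈)
  ... | no none = yes λ x x∈ →
    decidable-stable (⟨ x , y ⟩ ≟ false) λ ≢0 → none (x , x∈ , ≢0)

Occurs : ∀ {n} → LinearCode n → Pred ℕ 0ℓ
Occurs C u = ∃ λ c → Codeword C c × wt c ≡ u

occurs? : ∀ {n} (C : LinearCode n) → Decidable (Occurs C)
occurs? C u = anySubset? λ c → LinearCode.∈? C c ×-dec (wt c ℕ.≟ u)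

-- #{u ∣ C_u ≠ ∅, 0 < u ≤ n - t}.  The truncation in n ∸ t is harmless: for
-- t ≥ n both readings of the range are empty.

#weights : ∀ {n} → LinearCode n → ℕ → ℕ
#weights {n} C t =
  length (filter (λ u → occurs? C u ×-dec (0 ℕ.<? u ×-dec u ℕ.≤? n ∸ t))
                 (upTo (suc n)))

allSubsets : ∀ n → List (Subset n)
allSubsets zero    = List.[ [] ]
allSubsets (suc n) =
  List.map (outside ∷_) (allSubsets n) ++ List.map (inside ∷_) (allSubsets n)

#subsets : ∀ {n} {P : Pred (Subset n) 0ℓ} → Decidable P → ℕ
#subsets {n} P? = length (filter P? (allSubsets n))

-- t-(v,k,lam) designs on the point set Fin v.  The usual convention t ≤ k is
-- part of the definition: without it every block set of size-k blocks would
-- be a t-design with lam = 0 for all t > k, and the maxima defining δ and s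
-- would not exist.

record IsDesign (t v k lam : ℕ) {Block : Pred (Subset v) 0ℓ}
                (block? : Decidable Block) : Set where
  field
    t≤k      : t ≤ k
    uniform  : ∀ B → Block B → ∣ B ∣ ≡ k
    balanced : ∀ (T : Subset v) → ∣ T ∣ ≡ t →
               #subsets (λ B → block? B ×-dec T ⊆? B) ≡ lam

SupportBlock : ∀ {n} → LinearCode n → ℕ → Pred (Subset n) 0ℓ
SupportBlock C w B = ∃ λ c → (Codeword C c × wt c ≡ w) × supp c ≡ B

supportBlock? : ∀ {n} (C : LinearCode n) w → Decidable (SupportBlock C w)
supportBlock? C w B = anySubset? λ c →
  (LinearCode.∈? C c ×-dec (wt c ℕ.≟ w)) ×-dec ≡-dec _≟_ (supp c) B

SupportDesign : ∀ {n} → LinearCode n → (w t : ℕ) → Set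
SupportDesign {n} C w t = ∃ λ lam → IsDesign t n w lam (supportBlock? C w)

IsMaximum : Pred ℕ 0ℓ → ℕ → Set
IsMaximum P m = P m × (∀ t → P t → t ≤ m)

-- δ C ≐ m and s C ≐ m say that the respective maximum exists and equals m.

δ_≐_ : ∀ {n} → LinearCode n → ℕ → Set
δ_≐_ {n} C = IsMaximum λ t →
  ∀ w → 0 < w → w < n → Occurs C w → SupportDesign C w t

s_≐_ : ∀ {n} → LinearCode n → ℕ → Set
s_≐_ {n} C = IsMaximum λ t →
  ∃ λ w → 0 < w × w < n × Occurs C w × SupportDesign C w t

{-# OPTIONS --safe #-}
module Submission where

-- All counts are sums over 𝔽₂ⁿ with integer values.  By orthogonality of the
-- characters (-1)^⟨x , c⟩, the sum over C of (-1)^⟨x , c⟩ times a polynomial in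
-- y(c) = n - 2 wt c depends only on wt x, as long as wt x plus the degree is less
-- than d⊥.  Such invariance passes between the functions (-1)^⟨T , v⟩, [T ⊆ v] and
-- [T ∩ v = ∅], because (κ₁ - κ₀) ψ(b) = (κ₁ ψ(0) - κ₀ ψ(1)) + κ(b) (ψ(1) - ψ(0)) for
-- every bit b.  Killing all counted weights but one by the polynomial, the codewords
-- of each complementary weight n - w form a t-design.  If w < t, this puts every
-- word of weight w into C, which is absurd; so all weights 0 < u < n of C satisfy
-- t ≤ u ≤ n - t.
--
-- If s is the number of these weights, (y² - n²) ∏ (y - yᵢ)² vanishes on C; were its
-- degree 2s + 2 less than d⊥, it would vanish on 𝔽₂ⁿ.  Hence t ≤ s + 2, and d⊥ is
-- even since 𝟏 ∈ C.  What is left to exclude is s = 2, t = 4: there y₁² = n - 2 and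
-- ∣C∣ = n² - n + 2, which is not a power of two.
--
-- If s = 1, the only inner weight is w = n / 2, and by Poisson summation the words of
-- weight w' in the dual code are governed by Krawtchouk polynomials.  Their d⊥-th
-- difference is a nonzero coefficient of (4z)^d⊥ (1 - z²)^(w - d⊥), so a
-- (t + 1)-design in the dual code would give one in C.

open import Defs
open import Data.Bool.Base using (Bool; true; false; _xor_; not; if_then_else_)
import Data.Bool.Properties as Bool
open import Data.Empty using (⊥; ⊥-elim)
open import Data.Fin.Base as Fin using (Fin)
import Data.Fin.Properties as Fin
import Data.Fin.Subset.Properties as Subset
open import Data.Integer.Base as ℤ
  using (ℤ; +_; -[1+_]; _+_; _-_; _*_; -_; _^_; 0ℤ; 1ℤ; -1ℤ)
import Data.Integer.Properties as ℤ
open import Data.Integer.Solver using (module +-*-Solver)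
open import Data.Integer.Tactic.RingSolver using (solve-∀)
open import Data.List.Base as List using (List; []; _∷_; length; filter)
open import Data.List.Membership.Propositional using (_∈_)
open import Data.List.Membership.Propositional.Properties
  using (∈-filter⁺; ∈-filter⁻; ∈-map⁺; ∈-map⁻; ∈-lookup; ∈-++⁺ˡ; ∈-upTo⁺)
import Data.List.Properties as List
import Data.List.Relation.Unary.All as All
open import Data.List.Relation.Unary.AllPairs using ([]; _∷_)
open import Data.List.Relation.Unary.Any as Any using (here; there)
open import Data.List.Relation.Unary.Unique.Propositional using (Unique)
import Data.List.Relation.Unary.Unique.Propositional.Properties as Unique
open import Data.Nat.Base as ℕ using (ℕ; zero; suc; _<_; _≤_; z≤n; s≤s)
open import Data.Nat.Divisibility as ℕ using (_∣_; divides)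
open import Data.Nat.Primality using (prime[2]; euclidsLemma)
import Data.Nat.Properties as ℕ
import Data.Nat.Solver
open import Data.Product.Base using (_×_; _,_; ∃; proj₁; proj₂)
open import Data.Sum.Base using (_⊎_; inj₁; inj₂; [_,_]′)
open import Data.Vec.Base as Vec using ([]; _∷_)
open import Function.Base using (_∘_; id)
open import Level using (0ℓ)
open import Relation.Binary.PropositionalEquality
open import Relation.Nullary using (Dec; yes; no; does; ¬_; ¬?)
open import Relation.Nullary.Decidable using (_×-dec_)
open import Relation.Unary using (Pred; Decidable)

-- The count stops at n - t because of the codewords that contain a given t-set: such a codeword has
-- weight at least t, so its complement, again in C, has weight at most n - t. Hence the designs
-- appear first at the complementary weights n - w, and the bounds t ≤ u ≤ n - t have to be won back
-- from them. The degrees fit exactly: one root for each other counted weight gives degree s - 1,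
-- and t + (s - 1) < t + s = d⊥. With d⊥ even, t ≤ s + 2 leaves t in {1, 3}, {2, 4}, {1, 3, 5} for s
-- = 1, 2, 3. The change of kernel is stated without division, multiplied by a power of κ₁ - κ₀, and
-- with the coefficient of its top term explicit. Below level d⊥ the top term is constant as well.
-- To carry the failure of constancy at level d⊥ from C to the dual code, that coefficient must be
-- computed and shown to be nonzero; this is where the Krawtchouk polynomials enter.

private variable
  n : ℕ

-- Sums over the cube of all words

∑ : (Word n → ℤ) → ℤ
∑ {zero}  f = f []
∑ {suc n} f = ∑ (f ∘ (false ∷_)) + ∑ (f ∘ (true ∷_))

∑-cong : {f g : Word n → ℤ} → (∀ v → f v ≡ g v) → ∑ f ≡ ∑ g
∑-cong {zero}  f≗g = f≗g []
∑-cong {suc n} f≗g =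
  cong₂ _+_ (∑-cong (f≗g ∘ (false ∷_))) (∑-cong (f≗g ∘ (true ∷_)))

interchange : ∀ a b c d → (a + b) + (c + d) ≡ (a + c) + (b + d)
interchange = solve-∀

∑-+ : (f g : Word n → ℤ) → ∑ (λ v → f v + g v) ≡ ∑ f + ∑ g
∑-+ {zero}  f g = refl
∑-+ {suc n} f g = trans
  (cong₂ _+_ (∑-+ (f ∘ (false ∷_)) (g ∘ (false ∷_)))
             (∑-+ (f ∘ (true ∷_)) (g ∘ (true ∷_))))
  (interchange (∑ (f ∘ (false ∷_))) _ _ _)

∑-*ˡ : ∀ a (f : Word n → ℤ) → ∑ (λ v → a * f v) ≡ a * ∑ f
∑-*ˡ {zero}  a f = refl
∑-*ˡ {suc n} a f = trans
  (cong₂ _+_ (∑-*ˡ a (f ∘ (false ∷_))) (∑-*ˡ a (f ∘ (true ∷_))))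
  (sym (ℤ.*-distribˡ-+ a _ _))

∑-swap : ∀ {m} (f : Word m → Word n → ℤ) →
         ∑ (λ u → ∑ (f u)) ≡ ∑ (λ v → ∑ (λ u → f u v))
∑-swap {m = zero}  f = refl
∑-swap {m = suc m} f = trans
  (cong₂ _+_ (∑-swap (f ∘ (false ∷_))) (∑-swap (f ∘ (true ∷_))))
  (sym (∑-+ (λ v → ∑ (λ u → f (false ∷ u) v)) _))

∑-translate : (c : Word n) (f : Word n → ℤ) → ∑ (λ v → f (v ⊕ c)) ≡ ∑ f
∑-translate []          f = refl
∑-translate (false ∷ c) f =
  cong₂ _+_ (∑-translate c (f ∘ (false ∷_))) (∑-translate c (f ∘ (true ∷_)))
∑-translate (true ∷ c)  f = trans
  (cong₂ _+_ (∑-translate c (f ∘ (true ∷_))) (∑-translate c (f ∘ (false ∷_))))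
  (ℤ.+-comm (∑ (f ∘ (true ∷_))) _)

∑-nonneg : {f : Word n → ℤ} → (∀ v → 0ℤ ℤ.≤ f v) → 0ℤ ℤ.≤ ∑ f
∑-nonneg {zero}  0≤f = 0≤f []
∑-nonneg {suc n} 0≤f =
  ℤ.+-mono-≤ (∑-nonneg (0≤f ∘ (false ∷_))) (∑-nonneg (0≤f ∘ (true ∷_)))

term≤∑ : {f : Word n → ℤ} → (∀ v → 0ℤ ℤ.≤ f v) → ∀ v → f v ℤ.≤ ∑ f
term≤∑ 0≤f [] = ℤ.≤-refl
term≤∑ {f = f} 0≤f (false ∷ v) = subst (ℤ._≤ _) (ℤ.+-identityʳ (f (false ∷ v)))
  (ℤ.+-mono-≤ (term≤∑ (0≤f ∘ (false ∷_)) v) (∑-nonneg (0≤f ∘ (true ∷_))))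
term≤∑ {f = f} 0≤f (true ∷ v) = subst (ℤ._≤ _) (ℤ.+-identityˡ (f (true ∷ v)))
  (ℤ.+-mono-≤ (∑-nonneg (0≤f ∘ (false ∷_))) (term≤∑ (0≤f ∘ (true ∷_)) v))

∑≡0⇒0 : {f : Word n → ℤ} → (∀ v → 0ℤ ℤ.≤ f v) → ∑ f ≡ 0ℤ → ∀ v → f v ≡ 0ℤ
∑≡0⇒0 0≤f ∑≡0 v = ℤ.≤-antisym (subst (_ ℤ.≤_) ∑≡0 (term≤∑ 0≤f v)) (0≤f v)

-- Change of kernel

-- The product of κ vᵢ over i ∈ T: (-1)^⟨T , v⟩ for κ = sgn and [T ⊆ v] for κ = incl.

ker : (Bool → ℤ) → Word n → Word n → ℤ
ker κ []          []      = 1ℤ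
ker κ (false ∷ T) (_ ∷ v) = ker κ T v
ker κ (true ∷ T)  (b ∷ v) = κ b * ker κ T v

sgn incl : Bool → ℤ
sgn false = 1ℤ
sgn true  = -1ℤ
incl false = 0ℤ
incl true  = 1ℤ

transform : (Bool → ℤ) → (Word n → ℤ) → Word n → ℤ
transform κ g T = ∑ λ v → g v * ker κ T v

-- prof ψ T v is ψ ∣T∖v∣ ∣T∩v∣.

prof : (ℕ → ℕ → ℤ) → Word n → Word n → ℤ
prof ψ []          []          = ψ 0 0
prof ψ (false ∷ T) (_ ∷ v)     = prof ψ T v
prof ψ (true ∷ T)  (false ∷ v) = prof (λ i k → ψ (suc i) k) T v
prof ψ (true ∷ T)  (true ∷ v)  = prof (λ i k → ψ i (suc k)) T v

Δ : (ℕ → ℕ → ℤ) → ℕ → ℕ → ℤ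
Δ ψ i k = ψ i (suc k) - ψ (suc i) k

-- The d-th difference along the line i + k = d: the alternating binomial sum of the values ψ (d -
-- k) k, with sign + at k = d.
Δ^_at0 : ℕ → (ℕ → ℕ → ℤ) → ℤ
Δ^ zero at0  ψ = ψ 0 0
Δ^ suc d at0 ψ = Δ^ d at0 (Δ ψ)

module Transfer (κ : Bool → ℤ) where

  residue : (ℕ → ℕ → ℤ) → ℕ → ℕ → ℤ
  residue ψ i k = κ true * ψ (suc i) k - κ false * ψ i (suc k)

  -- Collects the terms of `transfer` with kernels of weight below d, where m j is the common value
  -- at weight j. The last summand shifts m because there the first point of T stays in the kernel.
  lower : ℕ → (ℕ → ℕ → ℤ) → (ℕ → ℤ) → ℤ
  lower zero    ψ m = 0ℤ
  lower (suc d) ψ m = lower d (residue ψ) m + Δ^ d at0 (residue ψ) * m d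
                    + lower d (Δ ψ) (m ∘ suc)

  prof-linear : ∀ a b ψ₁ ψ₂ (T v : Word n) →
    prof (λ i k → a * ψ₁ i k - b * ψ₂ i k) T v ≡
    a * prof ψ₁ T v - b * prof ψ₂ T v
  prof-linear a b ψ₁ ψ₂ []          []          = refl
  prof-linear a b ψ₁ ψ₂ (false ∷ T) (_ ∷ v)     = prof-linear a b ψ₁ ψ₂ T v
  prof-linear a b ψ₁ ψ₂ (true ∷ T)  (false ∷ v) = prof-linear a b _ _ T v
  prof-linear a b ψ₁ ψ₂ (true ∷ T)  (true ∷ v)  = prof-linear a b _ _ T v

  prof-Δ : ∀ ψ₁ ψ₂ (T v : Word n) →
    prof (λ i k → ψ₁ i k - ψ₂ i k) T v ≡ prof ψ₁ T v - prof ψ₂ T v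
  prof-Δ ψ₁ ψ₂ []          []          = refl
  prof-Δ ψ₁ ψ₂ (false ∷ T) (_ ∷ v)     = prof-Δ ψ₁ ψ₂ T v
  prof-Δ ψ₁ ψ₂ (true ∷ T)  (false ∷ v) = prof-Δ _ _ T v
  prof-Δ ψ₁ ψ₂ (true ∷ T)  (true ∷ v)  = prof-Δ _ _ T v

  merge₁ : (Word (suc n) → ℤ) → Word n → ℤ
  merge₁ g v = g (false ∷ v) + g (true ∷ v)

  mergeκ : (Word (suc n) → ℤ) → Word n → ℤ
  mergeκ g v = κ false * g (false ∷ v) + κ true * g (true ∷ v)

  merge₁-∑ : (g : Word (suc n) → ℤ) (h : Word n → ℤ) →
    ∑ (λ v → merge₁ g v * h v) ≡
    ∑ (λ v → g (false ∷ v) * h v) + ∑ (λ v → g (true ∷ v) * h v)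
  merge₁-∑ g h = trans
    (∑-cong λ v → ℤ.*-distribʳ-+ (h v) (g (false ∷ v)) (g (true ∷ v)))
    (∑-+ (λ v → g (false ∷ v) * h v) (λ v → g (true ∷ v) * h v))

  mergeκ-∑ : (g : Word (suc n) → ℤ) (T : Word n) →
    transform κ (mergeκ g) T ≡ transform κ g (true ∷ T)
  mergeκ-∑ g T = trans
    (∑-cong λ v → lemma (κ false) (κ true) (g (false ∷ v)) (g (true ∷ v)) (ker κ T v))
    (∑-+ (λ v → g (false ∷ v) * ker κ (true ∷ T) (false ∷ v))
         (λ v → g (true ∷ v) * ker κ (true ∷ T) (true ∷ v)))
    where
    lemma : ∀ a b x y z → (a * x + b * y) * z ≡ x * (a * z) + y * (b * z)
    lemma = solve-∀

  -- Induction over the coordinates. Outside T a coordinate is summed out by `merge₁`. Inside T the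
  -- two-point identity splits ψ into `residue ψ`, which no longer sees the bit, and κ times `Δ ψ`,
  -- whose factor κ is absorbed by `mergeκ`.
  transfer : (g : Word n → ℤ) (ψ : ℕ → ℕ → ℤ) (m : ℕ → ℤ) (T : Word n) →
    (∀ S → wt S < wt T → transform κ g S ≡ m (wt S)) →
    (κ true - κ false) ^ wt T * ∑ (λ v → g v * prof ψ T v) ≡
    lower (wt T) ψ m + Δ^ wt T at0 ψ * transform κ g T
  transfer g ψ m [] _ = lemma (g []) (ψ 0 0)
    where
    lemma : ∀ x y → 1ℤ * (x * y) ≡ 0ℤ + y * (x * 1ℤ)
    lemma = solve-∀
  transfer g ψ m (false ∷ T) const = begin
    (κ true - κ false) ^ wt T * ∑ (λ v → g v * prof ψ (false ∷ T) v)
      ≡⟨ cong ((κ true - κ false) ^ wt T *_) (sym (merge₁-∑ g (prof ψ T))) ⟩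
    (κ true - κ false) ^ wt T * ∑ (λ v → merge₁ g v * prof ψ T v)
      ≡⟨ transfer (merge₁ g) ψ m T
           (λ S S<T → trans (merge₁-∑ g (ker κ S)) (const (false ∷ S) S<T)) ⟩
    lower (wt T) ψ m + Δ^ wt T at0 ψ * transform κ (merge₁ g) T
      ≡⟨ cong (λ z → lower (wt T) ψ m + Δ^ wt T at0 ψ * z) (merge₁-∑ g (ker κ T)) ⟩
    lower (wt T) ψ m + Δ^ wt T at0 ψ * transform κ g (false ∷ T) ∎
    where open ≡-Reasoning
  transfer g ψ m (true ∷ T) const = begin
    (κ true - κ false) * c * (∑ (λ v → g (false ∷ v) * prof ψ₀ T v) +
                              ∑ (λ v → g (true ∷ v) * prof ψ₁ T v))
      ≡⟨ split (κ true - κ false) c (∑ g₀) (∑ g₁) ⟩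
    c * ((κ true - κ false) * (∑ (λ v → g (false ∷ v) * prof ψ₀ T v) +
                               ∑ (λ v → g (true ∷ v) * prof ψ₁ T v)))
      ≡⟨ cong (c *_) regroup ⟩
    c * (∑ (λ v → merge₁ g v * prof (residue ψ) T v) +
         ∑ (λ v → mergeκ g v * prof (Δ ψ) T v))
      ≡⟨ ℤ.*-distribˡ-+ c (∑ g₊) (∑ gκ) ⟩
    c * ∑ (λ v → merge₁ g v * prof (residue ψ) T v) +
    c * ∑ (λ v → mergeκ g v * prof (Δ ψ) T v)
      ≡⟨ cong₂ _+_
           (transfer (merge₁ g) (residue ψ) m T λ S S<T → const₁ S (ℕ.m<n⇒m<1+n S<T))
           (transfer (mergeκ g) (Δ ψ) (m ∘ suc) T λ S S<T →
             trans (mergeκ-∑ g S) (const (true ∷ S) (s≤s S<T))) ⟩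
    (lower (wt T) (residue ψ) m + Δ^ wt T at0 (residue ψ) * transform κ (merge₁ g) T) +
    (lower (wt T) (Δ ψ) (m ∘ suc) + Δ^ wt T at0 (Δ ψ) * transform κ (mergeκ g) T)
      ≡⟨ cong₂ (λ y z → (lower (wt T) (residue ψ) m + Δ^ wt T at0 (residue ψ) * y) +
                        (lower (wt T) (Δ ψ) (m ∘ suc) + Δ^ wt T at0 (Δ ψ) * z))
           (const₁ T ℕ.≤-refl) (mergeκ-∑ g T) ⟩
    (lower (wt T) (residue ψ) m + Δ^ wt T at0 (residue ψ) * m (wt T)) +
    (lower (wt T) (Δ ψ) (m ∘ suc) + Δ^ wt T at0 (Δ ψ) * transform κ g (true ∷ T))
      ≡⟨ sym (ℤ.+-assoc (lower (wt T) (residue ψ) m + Δ^ wt T at0 (residue ψ) * m (wt T))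
                        (lower (wt T) (Δ ψ) (m ∘ suc)) _) ⟩
    lower (suc (wt T)) ψ m + Δ^ wt T at0 (Δ ψ) * transform κ g (true ∷ T) ∎
    where
    open ≡-Reasoning
    c = (κ true - κ false) ^ wt T
    ψ₀ ψ₁ : ℕ → ℕ → ℤ
    ψ₀ i k = ψ (suc i) k
    ψ₁ i k = ψ i (suc k)
    g₀ g₁ g₊ gκ : Word _ → ℤ
    g₀ v = g (false ∷ v) * prof ψ₀ T v
    g₁ v = g (true ∷ v) * prof ψ₁ T v
    g₊ v = merge₁ g v * prof (residue ψ) T v
    gκ v = mergeκ g v * prof (Δ ψ) T v

    -- In the `merge₁` part even the tail T lies below the weight of the whole word, so its top term
    -- is known too and moves into `lower`.
    const₁ : ∀ S → wt S < suc (wt T) → transform κ (merge₁ g) S ≡ m (wt S)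
    const₁ S S<T = trans (merge₁-∑ g (ker κ S)) (const (false ∷ S) S<T)

    split : ∀ x y a b → x * y * (a + b) ≡ y * (x * (a + b))
    split = solve-∀

    pointwise : ∀ a b x y p q →
      (b - a) * (x * p + y * q) ≡
      (x + y) * (b * p - a * q) + (a * x + b * y) * (q - p)
    pointwise = solve-∀

    regroup : (κ true - κ false) * (∑ g₀ + ∑ g₁) ≡ ∑ g₊ + ∑ gκ
    regroup = begin
      (κ true - κ false) * (∑ g₀ + ∑ g₁)
        ≡⟨ cong ((κ true - κ false) *_) (sym (∑-+ g₀ g₁)) ⟩
      (κ true - κ false) * ∑ (λ v → g₀ v + g₁ v)
        ≡⟨ sym (∑-*ˡ (κ true - κ false) (λ v → g₀ v + g₁ v)) ⟩
      ∑ (λ v → (κ true - κ false) * (g₀ v + g₁ v))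
        ≡⟨ ∑-cong (λ v → trans
             (pointwise (κ false) (κ true) (g (false ∷ v)) (g (true ∷ v))
                        (prof ψ₀ T v) (prof ψ₁ T v))
             (cong₂ (λ y z → merge₁ g v * y + mergeκ g v * z)
               (sym (prof-linear (κ true) (κ false) ψ₀ ψ₁ T v))
               (sym (prof-Δ ψ₁ ψ₀ T v)))) ⟩
      ∑ (λ v → g₊ v + gκ v)
        ≡⟨ ∑-+ g₊ gκ ⟩
      ∑ g₊ + ∑ gκ ∎

-- Cancellation in ℤ

*-cancelˡ : ∀ {a x y} → a ≢ 0ℤ → a * x ≡ a * y → x ≡ y
*-cancelˡ {a} {x} {y} a≢0 = ℤ.*-cancelˡ-≡ a x y {{ℤ.≢-nonZero a≢0}}

*-≢0 : ∀ {a b} → a ≢ 0ℤ → b ≢ 0ℤ → a * b ≢ 0ℤ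
*-≢0 {a} a≢0 b≢0 ab≡0 = [ a≢0 , b≢0 ]′ (ℤ.i*j≡0⇒i≡0∨j≡0 a ab≡0)

^-≢0 : ∀ {a} → a ≢ 0ℤ → ∀ k → a ^ k ≢ 0ℤ
^-≢0 a≢0 zero    = λ ()
^-≢0 a≢0 (suc k) = *-≢0 a≢0 (^-≢0 a≢0 k)

x-y≡0⇒x≡y : ∀ {x y} → x - y ≡ 0ℤ → x ≡ y
x-y≡0⇒x≡y {x} {y} = ℤ.i-j≡0⇒i≡j x y

+-cancelʳ : ∀ a {x y} → x + a ≡ y + a → x ≡ y
+-cancelʳ a {x} {y} eq = trans (lemma x a) (trans (cong (_- a) eq) (sym (lemma y a)))
  where
  lemma : ∀ x a → x ≡ (x + a) - a
  lemma = solve-∀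

-- Functions that depend only on the weight

Invariant : ℕ → (Word n → ℤ) → Set
Invariant d f = ∀ S T → wt S ≡ wt T → wt S < d → f S ≡ f T

wt≤n : (v : Word n) → wt v ≤ n
wt≤n = Subset.∣p∣≤n

-- A representative of each weight j ≤ n; larger j give the full word.
canon : ∀ n → ℕ → Word n
canon zero    _       = []
canon (suc n) zero    = false ∷ canon n zero
canon (suc n) (suc j) = true ∷ canon n j

wt-canon : ∀ n j → j ≤ n → wt (canon n j) ≡ j
wt-canon zero    zero    _         = refl
wt-canon (suc n) zero    _         = wt-canon n zero z≤n
wt-canon (suc n) (suc j) (s≤s j≤n) = cong suc (wt-canon n j j≤n)

wt-canon-wt : (v : Word n) → wt (canon n (wt v)) ≡ wt v
wt-canon-wt {n} v = wt-canon n (wt v) (wt≤n v)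

module _ (κ : Bool → ℤ) (g : Word n → ℤ) where
  open Transfer κ

  -- `lower` sees a word only through its weight, so it cancels between S and T and the top term
  -- alone survives.
  transfer-difference : (ψ : ℕ → ℕ → ℤ) (S T : Word n) → wt S ≡ wt T →
    Invariant (wt S) (transform κ g) →
    (κ true - κ false) ^ wt S *
      (∑ (λ v → g v * prof ψ S v) - ∑ (λ v → g v * prof ψ T v)) ≡
    Δ^ wt S at0 ψ * (transform κ g S - transform κ g T)
  transfer-difference ψ S T S≈T inv = begin
    c * (ΣS - ΣT)
      ≡⟨ distrib c ΣS ΣT ⟩
    c * ΣS - c * ΣT
      ≡⟨ cong₂ _-_ (transfer g ψ m S below)
           (subst (λ d → (κ true - κ false) ^ d * ΣT ≡
                         lower d ψ m + Δ^ d at0 ψ * transform κ g T)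
                  (sym S≈T)
                  (transfer g ψ m T λ U U<T → below U (subst (wt U <_) (sym S≈T) U<T))) ⟩
    (l + D * transform κ g S) - (l + D * transform κ g T)
      ≡⟨ collect l D (transform κ g S) (transform κ g T) ⟩
    D * (transform κ g S - transform κ g T) ∎
    where
    open ≡-Reasoning
    m : ℕ → ℤ
    m j = transform κ g (canon n j)
    c ΣS ΣT l D : ℤ
    c  = (κ true - κ false) ^ wt S
    ΣS = ∑ (λ v → g v * prof ψ S v)
    ΣT = ∑ (λ v → g v * prof ψ T v)
    l  = lower (wt S) ψ m
    D  = Δ^ wt S at0 ψ

    below : ∀ U → wt U < wt S → transform κ g U ≡ m (wt U)
    below U = inv U (canon n (wt U)) (sym (wt-canon-wt U))

    distrib : ∀ x y z → x * (y - z) ≡ x * y - x * z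
    distrib = solve-∀
    collect : ∀ l d x y → (l + d * x) - (l + d * y) ≡ d * (x - y)
    collect = solve-∀

  prof-invariant : κ true - κ false ≢ 0ℤ → ∀ {d} → Invariant d (transform κ g) →
    ∀ ψ → Invariant d (λ T → ∑ (λ v → g v * prof ψ T v))
  prof-invariant κ≢ inv ψ S T S≈T S<d = x-y≡0⇒x≡y
    (*-cancelˡ (^-≢0 κ≢ (wt S)) (begin
      (κ true - κ false) ^ wt S * _
        ≡⟨ transfer-difference ψ S T S≈T (λ U V U≈V U<S →
             inv U V U≈V (ℕ.<-trans U<S S<d)) ⟩
      Δ^ wt S at0 ψ * (transform κ g S - transform κ g T)
        ≡⟨ cong (Δ^ wt S at0 ψ *_) (ℤ.i≡j⇒i-j≡0 (inv S T S≈T S<d)) ⟩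
      Δ^ wt S at0 ψ * 0ℤ
        ≡⟨ ℤ.*-zeroʳ (Δ^ wt S at0 ψ) ⟩
      0ℤ
        ≡⟨ sym (ℤ.*-zeroʳ ((κ true - κ false) ^ wt S)) ⟩
      (κ true - κ false) ^ wt S * 0ℤ ∎))
    where open ≡-Reasoning

prof-*ˡ : ∀ a ψ (T v : Word n) → prof (λ i k → a * ψ i k) T v ≡ a * prof ψ T v
prof-*ˡ a ψ []          []          = refl
prof-*ˡ a ψ (false ∷ T) (_ ∷ v)     = prof-*ˡ a ψ T v
prof-*ˡ a ψ (true ∷ T)  (false ∷ v) = prof-*ˡ a _ T v
prof-*ˡ a ψ (true ∷ T)  (true ∷ v)  = prof-*ˡ a _ T v

prof-cong : ∀ {ψ₁ ψ₂} → (∀ i k → ψ₁ i k ≡ ψ₂ i k) →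
            ∀ (T v : Word n) → prof ψ₁ T v ≡ prof ψ₂ T v
prof-cong eq []          []          = eq 0 0
prof-cong eq (false ∷ T) (_ ∷ v)     = prof-cong eq T v
prof-cong eq (true ∷ T)  (false ∷ v) = prof-cong (λ i k → eq (suc i) k) T v
prof-cong eq (true ∷ T)  (true ∷ v)  = prof-cong (λ i k → eq i (suc k)) T v

ker-prof : ∀ κ (T v : Word n) →
           ker κ T v ≡ prof (λ i k → κ false ^ i * κ true ^ k) T v
ker-prof κ []          []          = refl
ker-prof κ (false ∷ T) (_ ∷ v)     = ker-prof κ T v
ker-prof κ (true ∷ T)  (false ∷ v) = begin
  κ false * ker κ T v
    ≡⟨ cong (κ false *_) (ker-prof κ T v) ⟩
  κ false * prof (λ i k → κ false ^ i * κ true ^ k) T v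
    ≡⟨ sym (prof-*ˡ (κ false) _ T v) ⟩
  prof (λ i k → κ false * (κ false ^ i * κ true ^ k)) T v
    ≡⟨ prof-cong (λ i k → sym (ℤ.*-assoc (κ false) (κ false ^ i) (κ true ^ k))) T v ⟩
  prof (λ i k → κ false ^ suc i * κ true ^ k) T v ∎
  where open ≡-Reasoning
ker-prof κ (true ∷ T)  (true ∷ v)  = begin
  κ true * ker κ T v
    ≡⟨ cong (κ true *_) (ker-prof κ T v) ⟩
  κ true * prof (λ i k → κ false ^ i * κ true ^ k) T v
    ≡⟨ sym (prof-*ˡ (κ true) _ T v) ⟩
  prof (λ i k → κ true * (κ false ^ i * κ true ^ k)) T v
    ≡⟨ prof-cong (λ i k → exch (κ true) (κ false ^ i) (κ true ^ k)) T v ⟩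
  prof (λ i k → κ false ^ i * κ true ^ suc k) T v ∎
  where
  open ≡-Reasoning
  exch : ∀ a b c → a * (b * c) ≡ b * (a * c)
  exch = solve-∀

-- The kernel of κ′ is itself a profile, κ′(0)^i κ′(1)^k, so `prof-invariant` for κ applies to it.
transform-invariant : ∀ κ κ′ (g : Word n → ℤ) → κ true - κ false ≢ 0ℤ →
  ∀ {d} → Invariant d (transform κ g) → Invariant d (transform κ′ g)
transform-invariant κ κ′ g κ≢ inv S T S≈T S<d = begin
  transform κ′ g S
    ≡⟨ ∑-cong (λ v → cong (g v *_) (ker-prof κ′ S v)) ⟩
  ∑ (λ v → g v * prof _ S v)
    ≡⟨ prof-invariant κ g κ≢ inv (λ i k → κ′ false ^ i * κ′ true ^ k) S T S≈T S<d ⟩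
  ∑ (λ v → g v * prof _ T v)
    ≡⟨ ∑-cong (λ v → cong (g v *_) (sym (ker-prof κ′ T v))) ⟩
  transform κ′ g T ∎
  where open ≡-Reasoning

incl≢ : incl true - incl false ≢ 0ℤ
incl≢ ()

sgn≢ : sgn true - sgn false ≢ 0ℤ
sgn≢ ()

-- Indicators

ind : {P : Set} → Dec P → ℤ
ind P? = if does P? then 1ℤ else 0ℤ

ind-yes : {P : Set} (P? : Dec P) → P → ind P? ≡ 1ℤ
ind-yes (yes _) _ = refl
ind-yes (no ¬p) p = ⊥-elim (¬p p)

ind-no : {P : Set} (P? : Dec P) → ¬ P → ind P? ≡ 0ℤ
ind-no (yes p) ¬p = ⊥-elim (¬p p)
ind-no (no _)  _  = refl

0≤ind : {P : Set} (P? : Dec P) → 0ℤ ℤ.≤ ind P?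
0≤ind (yes _) = ℤ.+≤+ z≤n
0≤ind (no _)  = ℤ.≤-refl

-- Sums over the covers of a word under inclusion, and designs of smaller strength

ups : (Word n → ℤ) → Word n → ℤ
ups f []          = 0ℤ
ups f (false ∷ x) = f (true ∷ x) + ups (f ∘ (false ∷_)) x
ups f (true ∷ x)  = ups (f ∘ (true ∷_)) x

ups-*ˡ : ∀ a (f : Word n → ℤ) x → ups (λ y → a * f y) x ≡ a * ups f x
ups-*ˡ a f []          = sym (ℤ.*-zeroʳ a)
ups-*ˡ a f (false ∷ x) = trans
  (cong (λ z → a * f (true ∷ x) + z) (ups-*ˡ a (f ∘ (false ∷_)) x))
  (sym (ℤ.*-distribˡ-+ a (f (true ∷ x)) (ups (f ∘ (false ∷_)) x)))
ups-*ˡ a f (true ∷ x)  = ups-*ˡ a (f ∘ (true ∷_)) x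

∑-0 : ∀ n → ∑ {n} (λ _ → 0ℤ) ≡ 0ℤ
∑-0 zero    = refl
∑-0 (suc n) = cong₂ _+_ (∑-0 n) (∑-0 n)

ups-∑ : ∀ {m} (F : Word n → Word m → ℤ) x →
        ups (λ y → ∑ (F y)) x ≡ ∑ (λ v → ups (λ y → F y v) x)
ups-∑ {m = m} F []  = sym (∑-0 m)
ups-∑ F (false ∷ x) = trans
  (cong (λ z → ∑ (F (true ∷ x)) + z) (ups-∑ (F ∘ (false ∷_)) x))
  (sym (∑-+ (F (true ∷ x)) (λ v → ups (λ y → F (false ∷ y) v) x)))
ups-∑ F (true ∷ x)  = ups-∑ (F ∘ (true ∷_)) x

ups-const : (f : Word n → ℤ) (c : ℤ) (x : Word n) →
  (∀ y → wt y ≡ suc (wt x) → f y ≡ c) → ups f x ≡ (+ n - + wt x) * c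
ups-const f c []          const = refl
ups-const {suc n} f c (false ∷ x) const = begin
  f (true ∷ x) + ups (f ∘ (false ∷_)) x
    ≡⟨ cong₂ _+_ (const (true ∷ x) refl)
         (ups-const (f ∘ (false ∷_)) c x (const ∘ (false ∷_))) ⟩
  c + (+ n - + wt x) * c
    ≡⟨ lemma c (+ n) (+ wt x) ⟩
  (1ℤ + + n - + wt x) * c ∎
  where
  open ≡-Reasoning
  lemma : ∀ c m w → c + (m - w) * c ≡ (1ℤ + m - w) * c
  lemma = solve-∀
ups-const {suc n} f c (true ∷ x)  const = trans
  (ups-const (f ∘ (true ∷_)) c x λ y eq → const (true ∷ y) (cong suc eq))
  (lemma c (+ n) (+ wt x))
  where
  lemma : ∀ c m w → (m - w) * c ≡ ((1ℤ + m) - (1ℤ + w)) * c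
  lemma = solve-∀

-- If T lies in v, a cover of T inside v adds one of the wt v - wt T points of v outside T;
-- otherwise no cover of T lies in v.
ups-incl : (T v : Word n) →
  ups (λ S → ker incl S v) T ≡ (+ wt v - + wt T) * ker incl T v
ups-incl []          []          = refl
ups-incl (false ∷ T) (false ∷ v) = trans (cong (λ z → 0ℤ * ker incl T v + z) (ups-incl T v))
  (lemma (ker incl T v) _)
  where
  lemma : ∀ k x → 0ℤ * k + x ≡ x
  lemma = solve-∀
ups-incl (false ∷ T) (true ∷ v)  = trans (cong (λ z → 1ℤ * ker incl T v + z) (ups-incl T v))
  (lemma (ker incl T v) (+ wt v) (+ wt T))
  where
  lemma : ∀ k v t → 1ℤ * k + (v - t) * k ≡ (1ℤ + v - t) * k
  lemma = solve-∀
ups-incl (true ∷ T)  (false ∷ v) =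
  trans (ups-*ˡ 0ℤ (λ S → ker incl S v) T)
    (lemma (+ wt v) (+ wt T) (ker incl T v) (ups (λ S → ker incl S v) T))
  where
  lemma : ∀ v t k u → 0ℤ * u ≡ (v - (1ℤ + t)) * (0ℤ * k)
  lemma = solve-∀
ups-incl (true ∷ T)  (true ∷ v)  = trans (ups-*ˡ 1ℤ (λ S → ker incl S v) T)
  (trans (cong (1ℤ *_) (ups-incl T v)) (lemma (ker incl T v) (+ wt v) (+ wt T)))
  where
  lemma : ∀ k v t → 1ℤ * ((v - t) * k) ≡ ((1ℤ + v) - (1ℤ + t)) * (1ℤ * k)
  lemma = solve-∀

Constant : ℕ → (Word n → ℤ) → ℤ → Set
Constant d f c = ∀ T → wt T ≡ d → f T ≡ c

module _ (g : Word n → ℤ) (k : ℕ) (supported : ∀ v → wt v ≢ k → g v ≡ 0ℤ) where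

  -- Double counting of chains T ⊂ S ⊆ v with wt S = wt T + 1 and v weighted by g: the classical (k
  -- - i) λᵢ = (n - i) λᵢ₊₁.
  incl-step : ∀ {c} T → Constant (suc (wt T)) (transform incl g) c →
    (+ k - + wt T) * transform incl g T ≡ (+ n - + wt T) * c
  incl-step {c} T const = begin
    (+ k - + wt T) * transform incl g T
      ≡⟨ sym (∑-*ˡ (+ k - + wt T) (λ v → g v * ker incl T v)) ⟩
    ∑ (λ v → (+ k - + wt T) * (g v * ker incl T v))
      ≡⟨ ∑-cong pointwise ⟩
    ∑ (λ v → ups (λ S → g v * ker incl S v) T)
      ≡⟨ sym (ups-∑ (λ S v → g v * ker incl S v) T) ⟩
    ups (transform incl g) T
      ≡⟨ ups-const (transform incl g) c T const ⟩
    (+ n - + wt T) * c ∎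
    where
    open ≡-Reasoning
    exch : ∀ a b c → a * (b * c) ≡ b * (a * c)
    exch = solve-∀
    0-case : ∀ a b c → a * (0ℤ * b) ≡ 0ℤ * c
    0-case = solve-∀
    pointwise : ∀ v → (+ k - + wt T) * (g v * ker incl T v) ≡
                      ups (λ S → g v * ker incl S v) T
    pointwise v with wt v ℕ.≟ k
    ... | yes refl = begin
      (+ wt v - + wt T) * (g v * ker incl T v)
        ≡⟨ exch (+ wt v - + wt T) (g v) (ker incl T v) ⟩
      g v * ((+ wt v - + wt T) * ker incl T v)
        ≡⟨ cong (g v *_) (sym (ups-incl T v)) ⟩
      g v * ups (λ S → ker incl S v) T
        ≡⟨ sym (ups-*ˡ (g v) (λ S → ker incl S v) T) ⟩
      ups (λ S → g v * ker incl S v) T ∎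
    ... | no v≢k = begin
      (+ k - + wt T) * (g v * ker incl T v)
        ≡⟨ cong (λ z → (+ k - + wt T) * (z * ker incl T v)) (supported v v≢k) ⟩
      (+ k - + wt T) * (0ℤ * ker incl T v)
        ≡⟨ 0-case (+ k - + wt T) (ker incl T v) (ups (λ S → ker incl S v) T) ⟩
      0ℤ * ups (λ S → ker incl S v) T
        ≡⟨ cong (_* ups (λ S → ker incl S v) T) (sym (supported v v≢k)) ⟩
      g v * ups (λ S → ker incl S v) T
        ≡⟨ sym (ups-*ˡ (g v) (λ S → ker incl S v) T) ⟩
      ups (λ S → g v * ker incl S v) T ∎

  -- Descent by `incl-step`: k - i is nonzero for i < t ≤ k, so constancy passes from level i + 1 to
  -- level i.
  incl-invariant : ∀ t {c} → t ≤ k → Constant t (transform incl g) c →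
                   Invariant (suc t) (transform incl g)
  incl-invariant t t≤k const S T S≈T (s≤s S≤t) with ℕ.m≤n⇒m<n∨m≡n S≤t
  ... | inj₂ S≡t = trans (const S S≡t) (sym (const T (trans (sym S≈T) S≡t)))
  incl-invariant (suc t) {c} t≤k const S T S≈T _ | inj₁ S<t =
    incl-invariant t (ℕ.<⇒≤ t≤k) step S T S≈T S<t
    where
    k≢t : + k - + t ≢ 0ℤ
    k≢t eq = ℕ.<⇒≢ t≤k (sym (ℤ.+-injective (x-y≡0⇒x≡y {+ k} {+ t} eq)))

    step : Constant t (transform incl g) (transform incl g (canon n t))
    step U refl = *-cancelˡ k≢t (trans (incl-step U const) (sym
      (subst (λ j → (+ k - + j) * transform incl g (canon n (wt U)) ≡
                    (+ n - + j) * c)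
             (wt-canon-wt U)
             (incl-step (canon n (wt U))
               (λ V eq → const V (trans eq (cong suc (wt-canon-wt U))))))))

-- Layers of a code and their support designs

𝟙 : LinearCode n → Word n → ℤ
𝟙 C v = ind (LinearCode.∈? C v)

layer : LinearCode n → ℕ → Word n → ℤ
layer C w v = 𝟙 C v * ind (wt v ℕ.≟ w)

layer-supported : (C : LinearCode n) → ∀ w v → wt v ≢ w → layer C w v ≡ 0ℤ
layer-supported C w v v≢w =
  trans (cong (𝟙 C v *_) (ind-no (wt v ℕ.≟ w) v≢w)) (ℤ.*-zeroʳ (𝟙 C v))

filter-map : ∀ {A B : Set} {P : Pred B 0ℓ} (P? : Decidable P) (f : A → B) xs →
             length (filter P? (List.map f xs)) ≡ length (filter (P? ∘ f) xs)
filter-map P? f []       = refl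
filter-map P? f (x ∷ xs) with P? (f x)
... | yes _ = cong suc (filter-map P? f xs)
... | no _  = filter-map P? f xs

#subsets-∑ : ∀ n {P : Pred (Word n) 0ℓ} (P? : Decidable P) →
             + (#subsets P?) ≡ ∑ (λ B → ind (P? B))
#subsets-∑ zero P? with P? []
... | yes _ = refl
... | no _  = refl
#subsets-∑ (suc n) P? = begin
  + length (filter P? (List.map (false ∷_) (allSubsets n) List.++
                       List.map (true ∷_) (allSubsets n)))
    ≡⟨ cong (+_ ∘ length) (List.filter-++ P? (List.map (false ∷_) (allSubsets n)) _) ⟩
  + length (filter P? (List.map (false ∷_) (allSubsets n)) List.++
            filter P? (List.map (true ∷_) (allSubsets n)))
    ≡⟨ cong +_ (List.length-++ (filter P? (List.map (false ∷_) (allSubsets n)))) ⟩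
  + (length (filter P? (List.map (false ∷_) (allSubsets n)))) +
  + (length (filter P? (List.map (true ∷_) (allSubsets n))))
    ≡⟨ cong₂ (λ a b → + a + + b) (filter-map P? (false ∷_) (allSubsets n))
                                 (filter-map P? (true ∷_) (allSubsets n)) ⟩
  + #subsets (P? ∘ (false ∷_)) + + #subsets (P? ∘ (true ∷_))
    ≡⟨ cong₂ _+_ (#subsets-∑ n (P? ∘ (false ∷_))) (#subsets-∑ n (P? ∘ (true ∷_))) ⟩
  ∑ (λ B → ind (P? B)) ∎
  where open ≡-Reasoning

ind-×-dec : {P Q : Set} (P? : Dec P) (Q? : Dec Q) →
            ind (P? ×-dec Q?) ≡ ind P? * ind Q?
ind-×-dec (yes _) (yes _) = refl
ind-×-dec (yes _) (no _)  = refl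
ind-×-dec (no _)  Q?      = sym (ℤ.*-zeroˡ (ind Q?))

ind-⇔ : {P Q : Set} (P? : Dec P) (Q? : Dec Q) → (P → Q) → (Q → P) → ind P? ≡ ind Q?
ind-⇔ P? (yes q) _   q⇒p = ind-yes P? (q⇒p q)
ind-⇔ P? (no ¬q) p⇒q _   = ind-no P? (¬q ∘ p⇒q)

ind-⊆ : (T v : Word n) → ind (T Subset.⊆? v) ≡ ker incl T v
ind-⊆ []          []          = refl
ind-⊆ (false ∷ T) (b ∷ v)     = trans
  (ind-⇔ ((false ∷ T) Subset.⊆? (b ∷ v)) (T Subset.⊆? v) Subset.drop-∷-⊆ Subset.out⊆)
  (ind-⊆ T v)
ind-⊆ (true ∷ T)  (false ∷ v) =
  ind-no ((true ∷ T) Subset.⊆? (false ∷ v)) λ T⊆v → case-∈ (T⊆v Vec.here)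
  where
  case-∈ : ¬ (false ∷ v) Vec.[ Fin.zero ]= true
  case-∈ ()
ind-⊆ (true ∷ T)  (true ∷ v)  = trans
  (ind-⇔ ((true ∷ T) Subset.⊆? (true ∷ v)) (T Subset.⊆? v)
         Subset.drop-∷-⊆ Subset.s⊆s)
  (trans (ind-⊆ T v) (sym (ℤ.*-identityˡ (ker incl T v))))

#blocks : (C : LinearCode n) → ∀ w T →
  + #subsets (λ B → supportBlock? C w B ×-dec (T Subset.⊆? B)) ≡
  transform incl (layer C w) T
#blocks {n} C w T = trans
  (#subsets-∑ n (λ B → supportBlock? C w B ×-dec (T Subset.⊆? B)))
  (∑-cong λ B → trans (ind-×-dec (supportBlock? C w B) (T Subset.⊆? B))
    (cong₂ _*_ (ind-block B) (ind-⊆ T B)))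
  where
  ind-block : ∀ B → ind (supportBlock? C w B) ≡ layer C w B
  ind-block B = trans
    (ind-⇔ (supportBlock? C w B) (LinearCode.∈? C B ×-dec (wt B ℕ.≟ w))
      (λ { (_ , B∈ , refl) → B∈ }) (λ B∈ → B , B∈ , refl))
    (ind-×-dec (LinearCode.∈? C B) (wt B ℕ.≟ w))

design⇒invariant : (C : LinearCode n) → ∀ {w t} → SupportDesign C w t →
                   Invariant (suc t) (transform incl (layer C w))
design⇒invariant C {w} {t} (lam , design) =
  incl-invariant (layer C w) w (layer-supported C w) t {+ lam} t≤k λ T T≡t →
    trans (sym (#blocks C w T)) (cong +_ (balanced T T≡t))
  where open IsDesign design

invariant⇒design : (C : LinearCode n) → ∀ {w t} → t ≤ w → t ≤ n →
  Invariant (suc t) (transform incl (layer C w)) → SupportDesign C w t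
invariant⇒design {n} C {w} {t} t≤w t≤n inv =
  #subsets (λ B → supportBlock? C w B ×-dec (canon n t Subset.⊆? B)) , record
  { t≤k      = t≤w
  ; uniform  = λ { _ (_ , (_ , c≡w) , refl) → c≡w }
  ; balanced = λ T T≡t → ℤ.+-injective (trans (#blocks C w T)
      (trans (inv T (canon n t) (trans T≡t (sym (wt-canon n t t≤n)))
                  (s≤s (ℕ.≤-reflexive T≡t)))
             (sym (#blocks C w (canon n t)))))
  }

-- Characters, orthogonality and the size of the dual code

χ : Word n → Word n → ℤ
χ = ker sgn

sgn-xor : ∀ a b → sgn (a xor b) ≡ sgn a * sgn b
sgn-xor false false = refl
sgn-xor false true  = refl
sgn-xor true  false = refl
sgn-xor true  true  = refl

χ-⟨⟩ : (x y : Word n) → χ x y ≡ sgn ⟨ x , y ⟩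
χ-⟨⟩ []          []      = refl
χ-⟨⟩ (false ∷ x) (b ∷ y) = χ-⟨⟩ x y
χ-⟨⟩ (true ∷ x)  (b ∷ y) =
  trans (cong (sgn b *_) (χ-⟨⟩ x y)) (sym (sgn-xor b ⟨ x , y ⟩))

χ-comm : (x y : Word n) → χ x y ≡ χ y x
χ-comm []          []          = refl
χ-comm (false ∷ x) (false ∷ y) = χ-comm x y
χ-comm (false ∷ x) (true ∷ y)  = trans (χ-comm x y) (sym (ℤ.*-identityˡ (χ y x)))
χ-comm (true ∷ x)  (false ∷ y) = trans (ℤ.*-identityˡ (χ x y)) (χ-comm x y)
χ-comm (true ∷ x)  (true ∷ y)  = cong (-1ℤ *_) (χ-comm x y)

χ-⊕ : (x y c : Word n) → χ (x ⊕ y) c ≡ χ x c * χ y c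
χ-⊕ []          []          []      = refl
χ-⊕ (false ∷ x) (false ∷ y) (b ∷ c) = χ-⊕ x y c
χ-⊕ (false ∷ x) (true ∷ y)  (b ∷ c) =
  trans (cong (sgn b *_) (χ-⊕ x y c)) (exch (sgn b) (χ x c) (χ y c))
  where
  exch : ∀ a b c → a * (b * c) ≡ b * (a * c)
  exch = solve-∀
χ-⊕ (true ∷ x)  (false ∷ y) (b ∷ c) =
  trans (cong (sgn b *_) (χ-⊕ x y c)) (sym (ℤ.*-assoc (sgn b) (χ x c) (χ y c)))
χ-⊕ (true ∷ x)  (true ∷ y)  (false ∷ c) =
  trans (χ-⊕ x y c) (lemma (χ x c) (χ y c))
  where
  lemma : ∀ a b → a * b ≡ (1ℤ * a) * (1ℤ * b)
  lemma = solve-∀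
χ-⊕ (true ∷ x)  (true ∷ y)  (true ∷ c) =
  trans (χ-⊕ x y c) (lemma (χ x c) (χ y c))
  where
  lemma : ∀ a b → a * b ≡ (-1ℤ * a) * (-1ℤ * b)
  lemma = solve-∀

χ-weightless : (x y : Word n) → wt y ≡ 0 → χ x y ≡ 1ℤ
χ-weightless x y y≡0 = trans (χ-comm x y) (lemma y x y≡0)
  where
  lemma : ∀ {n} (y x : Word n) → wt y ≡ 0 → χ y x ≡ 1ℤ
  lemma []          []      _   = refl
  lemma (false ∷ y) (_ ∷ x) y≡0 = lemma y x y≡0

χ-full : (x y : Word n) → wt y ≡ n → χ x y ≡ -1ℤ ^ wt x
χ-full []          []          _   = refl
χ-full (false ∷ x) (true ∷ y)  y≡n = χ-full x y (ℕ.suc-injective y≡n)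
χ-full (true ∷ x)  (true ∷ y)  y≡n =
  cong (-1ℤ *_) (χ-full x y (ℕ.suc-injective y≡n))
χ-full (b ∷ x)     (false ∷ y) y≡n =
  ⊥-elim (ℕ.1+n≰n (subst (_≤ _) y≡n (wt≤n y)))

∣χ∣≤1 : (x y : Word n) → χ x y ≡ 1ℤ ⊎ χ x y ≡ -1ℤ
∣χ∣≤1 x y with ⟨ x , y ⟩ | χ-⟨⟩ x y
... | false | eq = inj₁ eq
... | true  | eq = inj₂ eq

δ₀ : ℕ → ℤ
δ₀ zero    = 1ℤ
δ₀ (suc _) = 0ℤ

∑-χ : (x : Word n) → ∑ (χ x) ≡ (+ 2) ^ n * δ₀ (wt x)
∑-χ []                  = refl
∑-χ {suc n} (false ∷ x) =
  trans (cong (λ z → z + z) (∑-χ x)) (lemma ((+ 2) ^ n) (δ₀ (wt x)))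
  where
  lemma : ∀ a b → a * b + a * b ≡ (+ 2 * a) * b
  lemma = solve-∀
∑-χ {suc n} (true ∷ x)  = begin
  ∑ (λ v → 1ℤ * χ x v) + ∑ (λ v → -1ℤ * χ x v)
    ≡⟨ cong₂ _+_ (∑-*ˡ 1ℤ (χ x)) (∑-*ˡ -1ℤ (χ x)) ⟩
  1ℤ * ∑ (χ x) + -1ℤ * ∑ (χ x)
    ≡⟨ lemma (∑ (χ x)) ((+ 2) ^ suc n) ⟩
  (+ 2) ^ suc n * 0ℤ ∎
  where
  open ≡-Reasoning
  lemma : ∀ a b → 1ℤ * a + -1ℤ * a ≡ b * 0ℤ
  lemma = solve-∀

size : LinearCode n → ℤ
size C = ∑ (𝟙 C)

0≤𝟙 : (C : LinearCode n) → ∀ v → 0ℤ ℤ.≤ 𝟙 C v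
0≤𝟙 C v = 0≤ind (LinearCode.∈? C v)

𝟙-∈ : (C : LinearCode n) → ∀ {v} → Codeword C v → 𝟙 C v ≡ 1ℤ
𝟙-∈ C {v} = ind-yes (LinearCode.∈? C v)

𝟙-∉ : (C : LinearCode n) → ∀ {v} → ¬ Codeword C v → 𝟙 C v ≡ 0ℤ
𝟙-∉ C {v} = ind-no (LinearCode.∈? C v)

1≤size : (C : LinearCode n) → 1ℤ ℤ.≤ size C
1≤size C = subst (ℤ._≤ size C) (𝟙-∈ C (LinearCode.0∈ C)) (term≤∑ (0≤𝟙 C) 𝟎)

size≢0 : (C : LinearCode n) → size C ≢ 0ℤ
size≢0 C eq with size C | 1≤size C
size≢0 C refl | _ | ℤ.+≤+ ()

⊕-cancel : (x c : Word n) → (x ⊕ c) ⊕ c ≡ x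
⊕-cancel []      []      = refl
⊕-cancel (a ∷ x) (b ∷ c) = cong₂ _∷_ (xor-cancel a b) (⊕-cancel x c)
  where
  xor-cancel : ∀ a b → (a xor b) xor b ≡ a
  xor-cancel false false = refl
  xor-cancel false true  = refl
  xor-cancel true  false = refl
  xor-cancel true  true  = refl

𝟙-⊕ : (C : LinearCode n) → ∀ {c} → Codeword C c → ∀ v → 𝟙 C (v ⊕ c) ≡ 𝟙 C v
𝟙-⊕ C {c} c∈ v = ind-⇔ (LinearCode.∈? C (v ⊕ c)) (LinearCode.∈? C v)
  (λ v⊕c∈ → subst (Codeword C) (⊕-cancel v c) (LinearCode.⊕-closed C v⊕c∈ c∈))
  (λ v∈ → LinearCode.⊕-closed C v∈ c∈)

-- If some c ∈ C has ⟨ c , x ⟩ = 1, translation by c negates the sum.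

orthogonality : (C : LinearCode n) (x : Word n) →
                transform sgn (𝟙 C) x ≡ size C * 𝟙 (C ^⊥) x
orthogonality C x with LinearCode.∈? (C ^⊥) x
... | yes x∈ = trans (∑-cong term) (sym (ℤ.*-identityʳ (size C)))
  where
  term : ∀ v → 𝟙 C v * χ x v ≡ 𝟙 C v
  term v with LinearCode.∈? C v
  ... | yes v∈ = trans (ℤ.*-identityˡ (χ x v))
                   (trans (χ-comm x v) (trans (χ-⟨⟩ v x) (cong sgn (x∈ v v∈))))
  ... | no _   = refl
... | no x∉ with Subset.anySubset? (λ c → LinearCode.∈? C c ×-dec (⟨ c , x ⟩ Bool.≟ true))
...   | no none = ⊥-elim (x∉ λ c c∈ → Bool.¬-not λ eq → none (c , c∈ , eq))
...   | yes (c , c∈ , eq) = trans (self-neg (transform sgn (𝟙 C) x) negated)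
                                  (sym (ℤ.*-zeroʳ (size C)))
  where
  open ≡-Reasoning
  χc : χ c x ≡ -1ℤ
  χc = trans (χ-⟨⟩ c x) (cong sgn eq)

  neg : ∀ a b → a * (b * -1ℤ) ≡ -1ℤ * (a * b)
  neg = solve-∀

  negated : transform sgn (𝟙 C) x ≡ -1ℤ * transform sgn (𝟙 C) x
  negated = begin
    transform sgn (𝟙 C) x
      ≡⟨ sym (∑-translate c (λ v → 𝟙 C v * χ x v)) ⟩
    ∑ (λ v → 𝟙 C (v ⊕ c) * χ x (v ⊕ c))
      ≡⟨ ∑-cong (λ v → trans
           (cong₂ _*_ (𝟙-⊕ C c∈ v)
             (trans (χ-comm x (v ⊕ c)) (trans (χ-⊕ v c x)
               (cong₂ _*_ (χ-comm v x) χc))))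
           (neg (𝟙 C v) (χ x v))) ⟩
    ∑ (λ v → -1ℤ * (𝟙 C v * χ x v))
      ≡⟨ ∑-*ˡ -1ℤ (λ v → 𝟙 C v * χ x v) ⟩
    -1ℤ * transform sgn (𝟙 C) x ∎

  self-neg : ∀ a → a ≡ -1ℤ * a → a ≡ 0ℤ
  self-neg (+ zero)  _  = refl
  self-neg (+ suc _) ()
  self-neg -[1+ _ ]  ()

wt≡0⇒𝟎 : (v : Word n) → wt v ≡ 0 → v ≡ 𝟎
wt≡0⇒𝟎 []          _   = refl
wt≡0⇒𝟎 (false ∷ v) v≡0 = cong (false ∷_) (wt≡0⇒𝟎 v v≡0)

wt≡n⇒𝟏 : (v : Word n) → wt v ≡ n → v ≡ 𝟏
wt≡n⇒𝟏 []          _   = refl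
wt≡n⇒𝟏 (true ∷ v)  v≡n = cong (true ∷_) (wt≡n⇒𝟏 v (ℕ.suc-injective v≡n))
wt≡n⇒𝟏 (false ∷ v) v≡n = ⊥-elim (ℕ.1+n≰n (subst (_≤ _) v≡n (wt≤n v)))

∑-wt≡0 : ∀ n → ∑ {n} (λ v → ind (wt v ℕ.≟ 0)) ≡ 1ℤ
∑-wt≡0 zero    = refl
∑-wt≡0 (suc n) = cong₂ _+_ (∑-wt≡0 n) (∑-0 n)

∑-wt≡n : ∀ n → ∑ {n} (λ v → ind (wt v ℕ.≟ n)) ≡ 1ℤ
∑-wt≡n zero    = refl
∑-wt≡n (suc n) = cong₂ _+_
  (trans (∑-cong {n} (λ v → ind-no (wt v ℕ.≟ suc n) λ eq →
           ℕ.1+n≰n (subst (_≤ n) eq (wt≤n v)))) (∑-0 n))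
  (∑-wt≡n n)

-- Sum `orthogonality` over all x and exchange the sums: only v = `𝟎` survives, and there the
-- character sum is 2ⁿ.
size-dual : (C : LinearCode n) → size C * size (C ^⊥) ≡ (+ 2) ^ n
size-dual {n} C = begin
  size C * size (C ^⊥)
    ≡⟨ sym (∑-*ˡ (size C) (𝟙 (C ^⊥))) ⟩
  ∑ (λ x → size C * 𝟙 (C ^⊥) x)
    ≡⟨ ∑-cong (λ x → sym (orthogonality C x)) ⟩
  ∑ (λ x → ∑ (λ v → 𝟙 C v * χ x v))
    ≡⟨ ∑-swap (λ x v → 𝟙 C v * χ x v) ⟩
  ∑ (λ v → ∑ (λ x → 𝟙 C v * χ x v))
    ≡⟨ ∑-cong (λ v → ∑-*ˡ (𝟙 C v) (λ x → χ x v)) ⟩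
  ∑ (λ v → 𝟙 C v * ∑ (λ x → χ x v))
    ≡⟨ ∑-cong (λ v → cong (𝟙 C v *_)
         (trans (∑-cong (λ x → χ-comm x v)) (∑-χ v))) ⟩
  ∑ (λ v → 𝟙 C v * ((+ 2) ^ n * δ₀ (wt v)))
    ≡⟨ ∑-cong (only-0 ((+ 2) ^ n)) ⟩
  ∑ {n} (λ v → (+ 2) ^ n * ind (wt v ℕ.≟ 0))
    ≡⟨ ∑-*ˡ {n} ((+ 2) ^ n) (λ v → ind (wt v ℕ.≟ 0)) ⟩
  (+ 2) ^ n * ∑ {n} (λ v → ind (wt v ℕ.≟ 0))
    ≡⟨ cong ((+ 2) ^ n *_) (∑-wt≡0 n) ⟩
  (+ 2) ^ n * 1ℤ
    ≡⟨ ℤ.*-identityʳ ((+ 2) ^ n) ⟩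
  (+ 2) ^ n ∎
  where
  open ≡-Reasoning
  vanish : ∀ a b → a * (b * 0ℤ) ≡ b * 0ℤ
  vanish = solve-∀
  only-0 : ∀ a v → 𝟙 C v * (a * δ₀ (wt v)) ≡ a * ind (wt v ℕ.≟ 0)
  only-0 a v with wt v in eq
  ... | suc _ = vanish (𝟙 C v) a
  ... | zero  = trans (cong (_* (a * 1ℤ)) (trans (cong (𝟙 C) (wt≡0⇒𝟎 v eq))
                  (𝟙-∈ C (LinearCode.0∈ C)))) (ℤ.*-identityˡ (a * 1ℤ))

-- Moments of the balance n - 2 wt

bal : Word n → ℤ
bal []      = 0ℤ
bal (b ∷ v) = sgn b + bal v

bal-wt : (v : Word n) → bal v ≡ + n - (+ 2) * + wt v
bal-wt []                  = refl
bal-wt {suc n} (false ∷ v) = trans (cong (λ z → 1ℤ + z) (bal-wt v)) (lemma (+ n) (+ wt v))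
  where
  lemma : ∀ n w → 1ℤ + (n - (+ 2) * w) ≡ (1ℤ + n) - (+ 2) * w
  lemma = solve-∀
bal-wt {suc n} (true ∷ v)  = trans (cong (λ z → -1ℤ + z) (bal-wt v)) (lemma (+ n) (+ wt v))
  where
  lemma : ∀ n w → -1ℤ + (n - (+ 2) * w) ≡ (1ℤ + n) - (+ 2) * (1ℤ + w)
  lemma = solve-∀

wt-𝟎 : ∀ n → wt (𝟎 {n}) ≡ 0
wt-𝟎 = Subset.∣⊥∣≡0

wt-𝟏 : ∀ n → wt (𝟏 {n}) ≡ n
wt-𝟏 = Subset.∣⊤∣≡n

bal-𝟎 : ∀ n → bal (𝟎 {n}) ≡ + n
bal-𝟎 n = trans (bal-wt (𝟎 {n})) (trans (cong (λ z → + n - (+ 2) * + z) (wt-𝟎 n))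
  (ℤ.+-identityʳ (+ n)))

bal-𝟏 : ∀ n → bal (𝟏 {n}) ≡ - + n
bal-𝟏 n = trans (bal-wt (𝟏 {n})) (trans (cong (λ z → + n - (+ 2) * + z) (wt-𝟏 n))
  (lemma (+ n)))
  where
  lemma : ∀ x → x - (+ 2) * x ≡ - x
  lemma = solve-∀

flips : (Word n → ℤ) → Word n → ℤ
flips f []      = 0ℤ
flips f (b ∷ x) = f (not b ∷ x) + flips (f ∘ (b ∷_)) x

flips-*ˡ : ∀ a (f : Word n → ℤ) x → flips (λ y → a * f y) x ≡ a * flips f x
flips-*ˡ a f []      = sym (ℤ.*-zeroʳ a)
flips-*ˡ a f (b ∷ x) = trans
  (cong (λ z → a * f (not b ∷ x) + z) (flips-*ˡ a (f ∘ (b ∷_)) x))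
  (sym (ℤ.*-distribˡ-+ a (f (not b ∷ x)) (flips (f ∘ (b ∷_)) x)))

flips-∑ : ∀ {m} (F : Word n → Word m → ℤ) x →
          flips (λ y → ∑ (F y)) x ≡ ∑ (λ v → flips (λ y → F y v) x)
flips-∑ {m = m} F []  = sym (∑-0 m)
flips-∑ F (b ∷ x) = trans
  (cong (λ z → ∑ (F (not b ∷ x)) + z) (flips-∑ (F ∘ (b ∷_)) x))
  (sym (∑-+ (F (not b ∷ x)) (λ v → flips (λ y → F (b ∷ y) v) x)))

-- Multiplying `χ x v` by the sign of one bit of v flips that bit of x. So `bal` acts on characters
-- as the adjacency operator of the cube, and each linear factor costs one unit of weight.
bal-χ : (x v : Word n) → bal v * χ x v ≡ flips (λ y → χ y v) x
bal-χ []          []      = refl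
bal-χ (false ∷ x) (b ∷ v) = trans (ℤ.*-distribʳ-+ (χ x v) (sgn b) (bal v))
  (cong (λ z → sgn b * χ x v + z) (bal-χ x v))
bal-χ (true ∷ x)  (b ∷ v) = begin
  (sgn b + bal v) * (sgn b * χ x v)
    ≡⟨ expand (sgn b) (bal v) (χ x v) ⟩
  (sgn b * sgn b) * χ x v + sgn b * (bal v * χ x v)
    ≡⟨ cong₂ (λ y z → y * χ x v + sgn b * z) (sgn² b) (bal-χ x v) ⟩
  1ℤ * χ x v + sgn b * flips (λ y → χ y v) x
    ≡⟨ cong₂ _+_ (ℤ.*-identityˡ (χ x v)) (sym (flips-*ˡ (sgn b) (λ y → χ y v) x)) ⟩
  χ x v + flips (λ y → sgn b * χ y v) x ∎
  where
  open ≡-Reasoning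
  expand : ∀ s b c → (s + b) * (s * c) ≡ (s * s) * c + s * (b * c)
  expand = solve-∀
  sgn² : ∀ b → sgn b * sgn b ≡ 1ℤ
  sgn² false = refl
  sgn² true  = refl

-- A word has wt x neighbours below it and n - wt x above. The default `pred 0` and the value beyond
-- weight n are harmless, since their coefficients are 0.
flips-wt : (f : Word n → ℤ) (h : ℕ → ℤ) (x : Word n) →
  (∀ y → wt y ≤ suc (wt x) → f y ≡ h (wt y)) →
  flips f x ≡ + wt x * h (ℕ.pred (wt x)) + (+ n - + wt x) * h (suc (wt x))
flips-wt f h [] _ = refl
flips-wt {suc n} f h (false ∷ x) f≡h = begin
  f (true ∷ x) + flips (f ∘ (false ∷_)) x
    ≡⟨ cong₂ _+_ (f≡h (true ∷ x) ℕ.≤-refl)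
                 (flips-wt (f ∘ (false ∷_)) h x (f≡h ∘ (false ∷_))) ⟩
  h (suc (wt x)) + (+ wt x * h (ℕ.pred (wt x)) + (+ n - + wt x) * h (suc (wt x)))
    ≡⟨ lemma (h (suc (wt x))) (+ wt x * h (ℕ.pred (wt x))) (+ n) (+ wt x) ⟩
  + wt x * h (ℕ.pred (wt x)) + (1ℤ + + n - + wt x) * h (suc (wt x)) ∎
  where
  open ≡-Reasoning
  lemma : ∀ a b n w → a + (b + (n - w) * a) ≡ b + (1ℤ + n - w) * a
  lemma = solve-∀
flips-wt {suc n} f h (true ∷ x) f≡h = begin
  f (false ∷ x) + flips (f ∘ (true ∷_)) x
    ≡⟨ cong₂ _+_ (f≡h (false ∷ x) (ℕ.m≤n⇒m≤1+n (ℕ.n≤1+n (wt x))))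
         (flips-wt (f ∘ (true ∷_)) (h ∘ suc) x λ y y≤ → f≡h (true ∷ y) (s≤s y≤)) ⟩
  h (wt x) + (+ wt x * h (suc (ℕ.pred (wt x))) + (+ n - + wt x) * h (suc (suc (wt x))))
    ≡⟨ cong (λ z → h (wt x) + (z + (+ n - + wt x) * h (suc (suc (wt x))))) (pred-suc (wt x)) ⟩
  h (wt x) + (+ wt x * h (wt x) + (+ n - + wt x) * h (suc (suc (wt x))))
    ≡⟨ lemma (h (wt x)) (h (suc (suc (wt x)))) (+ n) (+ wt x) ⟩
  (1ℤ + + wt x) * h (wt x) + (1ℤ + + n - (1ℤ + + wt x)) * h (suc (suc (wt x))) ∎
  where
  open ≡-Reasoning
  pred-suc : ∀ w → + w * h (suc (ℕ.pred w)) ≡ + w * h w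
  pred-suc zero    = refl
  pred-suc (suc w) = refl
  lemma : ∀ a b n w → a + (w * a + (n - w) * b) ≡
                      (1ℤ + w) * a + ((1ℤ + n) - (1ℤ + w)) * b
  lemma = solve-∀

roots : List ℤ → ℤ → ℤ
roots []       y = 1ℤ
roots (a ∷ as) y = (y - a) * roots as y

-- The character moment at weight j of the polynomial with roots `as`, per unit of total mass. It
-- mentions no code, so C and the whole cube share it; N is an integer so that closed forms become
-- polynomial identities.
mom : ℤ → List ℤ → ℕ → ℤ
mom N []       j = δ₀ j
mom N (a ∷ as) j = + j * mom N as (ℕ.pred j) + (N - + j) * mom N as (suc j)
                 - a * mom N as j

module _ (g : Word n → ℤ) (N : ℤ) (D : ℕ)
         (base : ∀ x → wt x < D → transform sgn g x ≡ N * δ₀ (wt x)) where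

  -- Each root asks for the remaining moments at weight one higher; this is the budget wt x + length
  -- as < D.
  moments : ∀ as x → wt x ℕ.+ length as < D →
    transform sgn (λ v → g v * roots as (bal v)) x ≡ N * mom (+ n) as (wt x)
  moments [] x x<D = trans
    (∑-cong λ v → cong (_* χ x v) (ℤ.*-identityʳ (g v)))
    (base x (subst (_< D) (ℕ.+-identityʳ (wt x)) x<D))
  moments (a ∷ as) x x<D = begin
    ∑ (λ v → g v * ((bal v - a) * roots as (bal v)) * χ x v)
      ≡⟨ ∑-cong (λ v → trans (expand (g v) (bal v) a (roots as (bal v)) (χ x v))
           (cong (λ z → F v * z + (- a) * (F v * χ x v)) (bal-χ x v))) ⟩
    ∑ (λ v → F v * flips (λ y → χ y v) x + (- a) * (F v * χ x v))
      ≡⟨ ∑-+ (λ v → F v * flips (λ y → χ y v) x) (λ v → (- a) * (F v * χ x v)) ⟩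
    ∑ (λ v → F v * flips (λ y → χ y v) x) + ∑ (λ v → (- a) * (F v * χ x v))
      ≡⟨ cong₂ _+_
           (trans (∑-cong λ v → sym (flips-*ˡ (F v) (λ y → χ y v) x))
                  (sym (flips-∑ (λ y v → F v * χ y v) x)))
           (∑-*ˡ (- a) (λ v → F v * χ x v)) ⟩
    flips (transform sgn F) x + (- a) * transform sgn F x
      ≡⟨ cong₂ (λ y z → y + (- a) * z)
           (flips-wt (transform sgn F) (λ j → N * mom (+ n) as j) x
             λ y y≤ → moments as y (ℕ.≤-<-trans (ℕ.+-monoˡ-≤ (length as) y≤) 1+x<D))
           (moments as x (ℕ.<-trans (ℕ.n<1+n _) 1+x<D)) ⟩
    (+ wt x * (N * mom (+ n) as (ℕ.pred (wt x))) +
     (+ n - + wt x) * (N * mom (+ n) as (suc (wt x)))) + (- a) * (N * mom (+ n) as (wt x))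
      ≡⟨ collect N a (+ wt x) (+ n) (mom (+ n) as (ℕ.pred (wt x)))
           (mom (+ n) as (suc (wt x))) (mom (+ n) as (wt x)) ⟩
    N * mom (+ n) (a ∷ as) (wt x) ∎
    where
    open ≡-Reasoning
    F : Word n → ℤ
    F v = g v * roots as (bal v)

    1+x<D : suc (wt x ℕ.+ length as) < D
    1+x<D = subst (_< D) (ℕ.+-suc (wt x) (length as)) x<D

    expand : ∀ g b a r c → g * ((b - a) * r) * c ≡
                           (g * r) * (b * c) + (- a) * ((g * r) * c)
    expand = solve-∀
    collect : ∀ N a w n x y z → (w * (N * x) + (n - w) * (N * y)) + (- a) * (N * z) ≡
                                N * (w * x + (n - w) * y - a * z)
    collect = solve-∀

  mean : ∀ as → length as < D → ∑ (λ v → g v * roots as (bal v)) ≡ N * mom (+ n) as 0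
  mean as as<D = begin
    ∑ (λ v → g v * roots as (bal v))
      ≡⟨ ∑-cong (λ v → sym (trans
           (cong (g v * roots as (bal v) *_)
                 (trans (χ-comm 𝟎 v) (χ-weightless v 𝟎 𝟎≡0)))
           (ℤ.*-identityʳ (g v * roots as (bal v))))) ⟩
    transform sgn (λ v → g v * roots as (bal v)) 𝟎
      ≡⟨ moments as 𝟎 (subst (λ z → z ℕ.+ length as < D) (sym 𝟎≡0) as<D) ⟩
    N * mom (+ n) as (wt (𝟎 {n}))
      ≡⟨ cong (λ z → N * mom (+ n) as z) 𝟎≡0 ⟩
    N * mom (+ n) as 0 ∎
    where
    open ≡-Reasoning
    𝟎≡0 : wt (𝟎 {n}) ≡ 0
    𝟎≡0 = Subset.∣⊥∣≡0 n

-- Complements, disjointness and inclusion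

wt-compl : (v : Word n) → wt v ℕ.+ wt (v ⊕ 𝟏) ≡ n
wt-compl []          = refl
wt-compl (false ∷ v) = trans (ℕ.+-suc (wt v) (wt (v ⊕ 𝟏))) (cong suc (wt-compl v))
wt-compl (true ∷ v)  = cong suc (wt-compl v)

excl : Bool → ℤ
excl false = 1ℤ
excl true  = 0ℤ

0≤ker-excl : (T v : Word n) → 0ℤ ℤ.≤ ker excl T v
0≤ker-excl []          []          = ℤ.+≤+ z≤n
0≤ker-excl (false ∷ T) (_ ∷ v)     = 0≤ker-excl T v
0≤ker-excl (true ∷ T)  (false ∷ v) =
  subst (0ℤ ℤ.≤_) (sym (ℤ.*-identityˡ (ker excl T v))) (0≤ker-excl T v)
0≤ker-excl (true ∷ T)  (true ∷ v)  = ℤ.≤-refl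

ker-excl-compl : (T : Word n) → ker excl T (T ⊕ 𝟏) ≡ 1ℤ
ker-excl-compl []          = refl
ker-excl-compl (false ∷ T) = ker-excl-compl T
ker-excl-compl (true ∷ T)  = cong (1ℤ *_) (ker-excl-compl T)

ker-excl-overlap : (T v : Word n) → n < wt T ℕ.+ wt v → ker excl T v ≡ 0ℤ
ker-excl-overlap []          []          ()
ker-excl-overlap (false ∷ T) (false ∷ v) n< = ker-excl-overlap T v (ℕ.<-trans (ℕ.n<1+n _) n<)
ker-excl-overlap {suc n} (false ∷ T) (true ∷ v) n< =
  ker-excl-overlap T v (ℕ.s<s⁻¹ (subst (suc n <_) (ℕ.+-suc (wt T) (wt v)) n<))
ker-excl-overlap (true ∷ T)  (false ∷ v) n< =
  trans (ℤ.*-identityˡ (ker excl T v)) (ker-excl-overlap T v (ℕ.s<s⁻¹ n<))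
ker-excl-overlap (true ∷ T)  (true ∷ v)  _  = refl

ker-excl-disjoint : (T v : Word n) → wt T ℕ.+ wt v ≡ n → v ≢ T ⊕ 𝟏 →
                    ker excl T v ≡ 0ℤ
ker-excl-disjoint []          []          _  v≢ = ⊥-elim (v≢ refl)
ker-excl-disjoint (false ∷ T) (false ∷ v) eq v≢ =
  ker-excl-overlap T v (ℕ.≤-reflexive (sym eq))
ker-excl-disjoint (false ∷ T) (true ∷ v)  eq v≢ =
  ker-excl-disjoint T v (ℕ.suc-injective (trans (sym (ℕ.+-suc (wt T) (wt v))) eq))
    (v≢ ∘ cong (true ∷_))
ker-excl-disjoint (true ∷ T)  (false ∷ v) eq v≢ = trans (ℤ.*-identityˡ (ker excl T v))
  (ker-excl-disjoint T v (ℕ.suc-injective eq) (v≢ ∘ cong (false ∷_)))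
ker-excl-disjoint (true ∷ T)  (true ∷ v)  _  v≢ = refl

ker-incl-< : (T v : Word n) → wt v < wt T → ker incl T v ≡ 0ℤ
ker-incl-< (false ∷ T) (false ∷ v) v<T = ker-incl-< T v v<T
ker-incl-< (false ∷ T) (true ∷ v)  v<T = ker-incl-< T v (ℕ.<-trans (ℕ.n<1+n _) v<T)
ker-incl-< (true ∷ T)  (false ∷ v) v<T = refl
ker-incl-< (true ∷ T)  (true ∷ v)  v<T =
  trans (ℤ.*-identityˡ (ker incl T v)) (ker-incl-< T v (ℕ.s<s⁻¹ v<T))

ker-incl-full : (T v : Word n) → wt v ≡ n → ker incl T v ≡ 1ℤ
ker-incl-full []          []          _   = refl
ker-incl-full (b ∷ T)     (false ∷ v) v≡n =
  ⊥-elim (ℕ.1+n≰n (subst (_≤ _) v≡n (wt≤n v)))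
ker-incl-full (false ∷ T) (true ∷ v)  v≡n = ker-incl-full T v (ℕ.suc-injective v≡n)
ker-incl-full (true ∷ T)  (true ∷ v)  v≡n =
  cong (1ℤ *_) (ker-incl-full T v (ℕ.suc-injective v≡n))

-- Takes p positions inside y and q outside it; only the former affect the sign.
choose : ∀ p q (y : Word n) → p ≤ wt y → q ℕ.+ wt y ≤ n →
         ∃ λ x → wt x ≡ p ℕ.+ q × χ x y ≡ -1ℤ ^ p
choose zero zero [] _ _ = [] , refl , refl
choose p zero (false ∷ y) p≤ q≤ =
  let x , x≡ , χx = choose p zero y p≤ (wt≤n y) in false ∷ x , x≡ , χx
choose p (suc q) (false ∷ y) p≤ (s≤s q≤) =
  let x , x≡ , χx = choose p q y p≤ q≤
  in true ∷ x , trans (cong suc x≡) (sym (ℕ.+-suc p q)) ,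
     trans (ℤ.*-identityˡ (χ x y)) χx
choose {suc n} zero q (true ∷ y) p≤ q≤ =
  let x , x≡ , χx = choose zero q y z≤n (ℕ.s≤s⁻¹ (subst (_≤ suc n) (ℕ.+-suc q (wt y)) q≤))
  in false ∷ x , x≡ , χx
choose {suc n} (suc p) q (true ∷ y) (s≤s p≤) q≤ =
  let x , x≡ , χx = choose p q y p≤ (ℕ.s≤s⁻¹ (subst (_≤ suc n) (ℕ.+-suc q (wt y)) q≤))
  in true ∷ x , cong suc x≡ , cong (-1ℤ *_) χx

-- Of the words of weight w, some meet y in p and some in p + 1 positions,
-- where p = w ∸ (n ∸ wt y).

orthogonal-layer : (y : Word n) → ∀ {w} → 0 < w → w < n →
  (∀ x → wt x ≡ w → χ x y ≡ 1ℤ) → wt y ≡ 0 ⊎ wt y ≡ n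
orthogonal-layer {n} y {w} 0<w w<n orth with wt y ℕ.≟ 0 | wt y ℕ.≟ n
... | yes y≡0 | _       = inj₁ y≡0
... | no  _   | yes y≡n = inj₂ y≡n
... | no  y≢0 | no y≢n  = ⊥-elim (absurd (-1ℤ ^ p) sgn₀ sgn₁)
  where
  z p q : ℕ
  z = n ℕ.∸ wt y
  p = w ℕ.∸ z
  q = w ℕ.∸ p

  y<n : wt y < n
  y<n = ℕ.≤∧≢⇒< (wt≤n y) y≢n
  0<z : 0 < z
  0<z = ℕ.m<n⇒0<n∸m y<n
  0<y : 0 < wt y
  0<y = ℕ.n≢0⇒n>0 y≢0
  z+y≡n : z ℕ.+ wt y ≡ n
  z+y≡n = ℕ.m∸n+n≡m (wt≤n y)
  p<w : p < w
  p<w = ℕ.m<n+o⇒m∸n<o w z {{ℕ.>-nonZero 0<w}} (ℕ.m<n+m w 0<z)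
  p<y : p < wt y
  p<y = ℕ.m<n+o⇒m∸n<o w z {{ℕ.>-nonZero 0<y}} (subst (w <_) (sym z+y≡n) w<n)
  p+q≡w : p ℕ.+ q ≡ w
  p+q≡w = ℕ.m+[n∸m]≡n (ℕ.m∸n≤m w z)
  q≤z : q ≤ z
  q≤z = ℕ.m≤n+o⇒m∸n≤o w p (subst (w ≤_) (ℕ.+-comm z p) (ℕ.m≤n+m∸n w z))
  -- Trades one position outside y for one inside: p < w gives q > 0, and p < wt y leaves room in y.
  1+p+pred-q≡w : suc p ℕ.+ ℕ.pred q ≡ w
  1+p+pred-q≡w = trans (sym (ℕ.+-suc p (ℕ.pred q)))
    (trans (cong (p ℕ.+_) (ℕ.suc-pred q {{ℕ.>-nonZero (ℕ.m<n⇒0<n∸m p<w)}})) p+q≡w)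
  sgn₀ : -1ℤ ^ p ≡ 1ℤ
  sgn₀ = let x , x≡ , χx = choose p q y (ℕ.<⇒≤ p<y)
                             (subst (q ℕ.+ wt y ≤_) z+y≡n (ℕ.+-monoˡ-≤ (wt y) q≤z))
         in trans (sym χx) (orth x (trans x≡ p+q≡w))
  sgn₁ : -1ℤ ^ suc p ≡ 1ℤ
  sgn₁ = let x , x≡ , χx = choose (suc p) (ℕ.pred q) y p<y
                             (subst (ℕ.pred q ℕ.+ wt y ≤_) z+y≡n
                               (ℕ.+-monoˡ-≤ (wt y) (ℕ.≤-trans ℕ.pred[n]≤n q≤z)))
         in trans (sym χx) (orth x (trans x≡ 1+p+pred-q≡w))
  absurd : ∀ a → a ≡ 1ℤ → -1ℤ * a ≡ 1ℤ → ⊥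
  absurd _ refl ()

-- Roots of a product, and a pigeonhole count

roots-∈ : ∀ {as y} → y ∈ as → roots as y ≡ 0ℤ
roots-∈ {a ∷ as} {y} (here refl) =
  trans (cong (_* roots as y) (ℤ.+-inverseʳ y)) (ℤ.*-zeroˡ (roots as y))
roots-∈ {a ∷ as} {y} (there y∈)  =
  trans (cong ((y - a) *_) (roots-∈ y∈)) (ℤ.*-zeroʳ (y - a))

roots-∈⁻ : ∀ as {y} → roots as y ≡ 0ℤ → y ∈ as
roots-∈⁻ (a ∷ as) {y} eq with ℤ.i*j≡0⇒i≡0∨j≡0 (y - a) eq
... | inj₁ y-a≡0 = here (x-y≡0⇒x≡y y-a≡0)
... | inj₂ rest  = there (roots-∈⁻ as rest)

roots-++ : ∀ as bs y → roots (as List.++ bs) y ≡ roots as y * roots bs y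
roots-++ []       bs y = sym (ℤ.*-identityˡ (roots bs y))
roots-++ (a ∷ as) bs y = trans (cong ((y - a) *_) (roots-++ as bs y))
  (sym (ℤ.*-assoc (y - a) (roots as y) (roots bs y)))

pigeonhole : ∀ (us : List ℕ) k → Unique us → (∀ {u} → u ∈ us → u < k) → length us ≤ k
pigeonhole us k unique us<k =
  Fin.injective⇒≤ {f = index} (lookup-injective unique ∘ index-injective)
  where
  index : Fin (length us) → Fin k
  index i = Fin.fromℕ< (us<k (∈-lookup {xs = us} i))

  index-injective : ∀ {i j} → index i ≡ index j → List.lookup us i ≡ List.lookup us j
  index-injective eq = trans (sym (Fin.toℕ-fromℕ< _)) (trans (cong Fin.toℕ eq) (Fin.toℕ-fromℕ< _))

  lookup-injective : ∀ {us : List ℕ} → Unique us → ∀ {i j} →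
                     List.lookup us i ≡ List.lookup us j → i ≡ j
  lookup-injective (_ ∷ _)   {Fin.zero}  {Fin.zero}  _  = refl
  lookup-injective (u≢ ∷ _)  {Fin.zero}  {Fin.suc j} eq =
    ⊥-elim (All.lookup u≢ (∈-lookup j) eq)
  lookup-injective (u≢ ∷ _)  {Fin.suc i} {Fin.zero}  eq =
    ⊥-elim (All.lookup u≢ (∈-lookup i) (sym eq))
  lookup-injective (_ ∷ us!) {Fin.suc i} {Fin.suc j} eq =
    cong Fin.suc (lookup-injective us! eq)

-- Codes of given dual distance

module Strength {n} (C : LinearCode n) (𝟏∈ : Codeword C 𝟏) {D : ℕ}
                (dual : HasMinDistance (C ^⊥) D) where

  -- Below the dual distance `𝟎` is the only dual word, so up to total mass the character sums of C
  -- are those of the cube.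
  base : ∀ x → wt x < D → transform sgn (𝟙 C) x ≡ size C * δ₀ (wt x)
  base x x<D = trans (orthogonality C x) (cong (size C *_) lemma)
    where
    lemma : 𝟙 (C ^⊥) x ≡ δ₀ (wt x)
    lemma with wt x in eq
    ... | zero  = 𝟙-∈ (C ^⊥) (subst (Codeword (C ^⊥)) (sym (wt≡0⇒𝟎 x eq))
                    (LinearCode.0∈ (C ^⊥)))
    ... | suc j = 𝟙-∉ (C ^⊥) λ x∈ → ℕ.<⇒≱ x<D (subst (D ≤_) eq (proj₂ dual x x∈ λ x≡𝟎 →
                    ℕ.1+n≢0 (trans (sym eq) (trans (cong wt x≡𝟎) (Subset.∣⊥∣≡0 n)))))

  -- In degree below D the sum over C is size C times a moment that does not know C, so vanishing on
  -- C becomes a fact about the cube.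
  mom-vanishes : ∀ as → length as < D →
    (∀ v → Codeword C v → roots as (bal v) ≡ 0ℤ) → mom (+ n) as 0 ≡ 0ℤ
  mom-vanishes as as<D vanish = *-cancelˡ (size≢0 C) (begin
    size C * mom (+ n) as 0
      ≡⟨ sym (mean (𝟙 C) (size C) D base as as<D) ⟩
    ∑ (λ v → 𝟙 C v * roots as (bal v))
      ≡⟨ ∑-cong term ⟩
    ∑ {n} (λ _ → 0ℤ)
      ≡⟨ ∑-0 n ⟩
    0ℤ
      ≡⟨ sym (ℤ.*-zeroʳ (size C)) ⟩
    size C * 0ℤ ∎)
    where
    open ≡-Reasoning
    term : ∀ v → 𝟙 C v * roots as (bal v) ≡ 0ℤ
    term v with LinearCode.∈? C v
    ... | yes v∈ = trans (ℤ.*-identityˡ (roots as (bal v))) (vanish v v∈)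
    ... | no _   = refl

  compl∈ : ∀ {v} → Codeword C v → Codeword C (v ⊕ 𝟏)
  compl∈ v∈ = LinearCode.⊕-closed C v∈ 𝟏∈

-- The counting hypothesis and the designs at complementary weights

record FewWeights (n : ℕ) : Set₁ where
  field
    C        : LinearCode n
    𝟏∈       : Codeword C 𝟏
    D t      : ℕ
    dual     : HasMinDistance (C ^⊥) D
    0<t      : 0 < t
    ws       : List ℕ
    unique   : Unique ws
    D≡       : D ≡ t ℕ.+ length ws
    sound    : ∀ {u} → u ∈ ws → Occurs C u × 0 < u × u ℕ.+ t ≤ n
    complete : ∀ {u} → Occurs C u → 0 < u → u ℕ.+ t ≤ n → u ∈ ws
    nonempty : ∃ λ w → w ∈ ws

module CoDesign {n} (F : FewWeights n) where
  open FewWeights F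
  open Strength C 𝟏∈ dual public

  -- The balance of the complement of a word of weight u.
  covalue : ℕ → ℤ
  covalue u = (+ 2) * + u - + n

  bal-covalue : ∀ v {u} → wt v ℕ.+ u ≡ n → bal v ≡ covalue u
  bal-covalue v {u} eq = trans (bal-wt v) (trans
    (cong (λ z → + z - (+ 2) * + wt v) (sym eq))
    (trans (lemma (+ wt v) (+ u)) (cong (λ z → (+ 2) * + u - + z) eq)))
    where
    lemma : ∀ w u → (w + u) - (+ 2) * w ≡ (+ 2) * u - (w + u)
    lemma = solve-∀

  covalue-injective : ∀ {u w} → covalue u ≡ covalue w → u ≡ w
  covalue-injective {u} {w} eq = ℤ.+-injective (*-cancelˡ {+ 2} (λ ())
    (trans (lemma (+ u) (+ n)) (trans (cong (λ z → z + + n) eq) (sym (lemma (+ w) (+ n))))))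
    where
    lemma : ∀ u n → (+ 2) * u ≡ ((+ 2) * u - n) + n
    lemma = solve-∀

  module _ {w : ℕ} (w∈ : w ∈ ws) where
    private
      0<w : 0 < w
      0<w = proj₁ (proj₂ (sound w∈))
      w+t≤n : w ℕ.+ t ≤ n
      w+t≤n = proj₂ (proj₂ (sound w∈))
      w≤n : w ≤ n
      w≤n = ℕ.≤-trans (ℕ.m≤m+n w t) w+t≤n
      t≤n : t ≤ n
      t≤n = ℕ.≤-trans (ℕ.m≤n+m t w) w+t≤n

    others : List ℕ
    others = filter (λ u → ¬? (u ℕ.≟ w)) ws

    as : List ℤ
    as = List.map covalue others

    -- Dropping w saves one degree, which is what lets `g-invariant` reach weight t.
    as<ws : length as < length ws
    as<ws = subst (_< length ws) (sym (List.length-map covalue others))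
      (List.filter-notAll (λ u → ¬? (u ℕ.≟ w)) ws
        (Any.map (λ w≡u u≢w → u≢w (sym w≡u)) w∈))

    g : Word n → ℤ
    g v = 𝟙 C v * roots as (bal v)

    q : ℤ
    q = roots as (covalue w)

    q≢0 : q ≢ 0ℤ
    q≢0 q≡0 with ∈-map⁻ covalue (roots-∈⁻ as q≡0)
    ... | u , u∈ , eq =
      proj₂ (∈-filter⁻ (λ u → ¬? (u ℕ.≟ w)) {xs = ws} u∈) (sym (covalue-injective eq))

    g-invariant : Invariant (suc t) (transform incl g)
    g-invariant = transform-invariant sgn incl g sgn≢ inv
      where
      value : ∀ S → wt S < suc t → transform sgn g S ≡ size C * mom (+ n) as (wt S)
      value S (s≤s S≤t) = moments (𝟙 C) (size C) D base as S
        (subst (wt S ℕ.+ length as <_) (sym D≡) (ℕ.+-mono-≤-< S≤t as<ws))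
      inv : Invariant (suc t) (transform sgn g)
      inv S T S≈T S<t = trans (value S S<t)
        (trans (cong (λ z → size C * mom (+ n) as z) S≈T)
               (sym (value T (subst (_< suc t) S≈T S<t))))

    -- The term of `𝟏`. Its complement has weight 0, which is not counted, so no root is provided to
    -- kill it; but `𝟏` contains every T, so the term is the same for all T.
    rest : Word n → ℤ
    rest v = g v * ind (wt v ℕ.≟ n)

    private
      Split : (a r k i j : ℤ) → Set
      Split a r k i j = a * r * k ≡ q * (a * i * k) + a * r * j

      outside : ∀ {a} r k i j → a ≡ 0ℤ → Split a r k i j
      outside r k i j refl = lemma q r k i j
        where
        lemma : ∀ q r k i j → 0ℤ * r * k ≡ q * (0ℤ * i * k) + 0ℤ * r * j
        lemma = solve-∀

      light : ∀ a r {k} i {j} → k ≡ 0ℤ → j ≡ 0ℤ → Split a r k i j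
      light a r i refl refl = lemma q a r i
        where
        lemma : ∀ q a r i → a * r * 0ℤ ≡ q * (a * i * 0ℤ) + a * r * 0ℤ
        lemma = solve-∀

      full : ∀ a r {k i j} → k ≡ 1ℤ → i ≡ 0ℤ → j ≡ 1ℤ → Split a r k i j
      full a r refl refl refl = lemma q a r
        where
        lemma : ∀ q a r → a * r * 1ℤ ≡ q * (a * 0ℤ * 1ℤ) + a * r * 1ℤ
        lemma = solve-∀

      chosen : ∀ a {r} k {i j} → r ≡ q → i ≡ 1ℤ → j ≡ 0ℤ → Split a r k i j
      chosen a k refl refl refl = lemma q a k
        where
        lemma : ∀ q a k → a * q * k ≡ q * (a * 1ℤ * k) + a * q * 0ℤ
        lemma = solve-∀

      killed : ∀ a {r} k {i} j → r ≡ 0ℤ → i ≡ 0ℤ → Split a r k i j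
      killed a k j refl refl = lemma q a k j
        where
        lemma : ∀ q a k j → a * 0ℤ * k ≡ q * (a * 0ℤ * k) + a * 0ℤ * j
        lemma = solve-∀

    -- A codeword of weight at least t has a complement of weight at most n - t, namely 0, w, or a
    -- weight whose root kills the term. Lighter words cannot contain T.
    pointwise : ∀ T → wt T ≡ t → ∀ v →
      g v * ker incl T v ≡ q * (layer C (n ℕ.∸ w) v * ker incl T v) + rest v
    pointwise T refl v
      with LinearCode.∈? C v | wt v ℕ.<? wt T | wt v ℕ.≟ n | n ℕ.∸ wt v ℕ.≟ w
    ... | no v∉ | _ | _ | _ =
      outside (roots as (bal v)) (ker incl T v) (ind (wt v ℕ.≟ n ℕ.∸ w)) (ind (wt v ℕ.≟ n))
        refl
    ... | yes v∈ | yes v<t | _ | _ =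
      light 1ℤ (roots as (bal v)) (ind (wt v ℕ.≟ n ℕ.∸ w)) (ker-incl-< T v v<t)
        (ind-no (wt v ℕ.≟ n) λ v≡n → ℕ.<⇒≱ v<t (subst (wt T ≤_) (sym v≡n) t≤n))
    ... | yes v∈ | no v≮t | yes v≡n | _ =
      full 1ℤ (roots as (bal v)) (ker-incl-full T v v≡n)
        (ind-no (wt v ℕ.≟ n ℕ.∸ w) λ v≡n∸w →
          ℕ.<⇒≢ (ℕ.∸-monoʳ-< 0<w w≤n) (trans (sym v≡n∸w) v≡n))
        (ind-yes (wt v ℕ.≟ n) v≡n)
    ... | yes v∈ | no v≮t | no v≢n | yes u≡w =
      chosen 1ℤ (ker incl T v)
        (cong (roots as) (bal-covalue v
          (trans (cong (wt v ℕ.+_) (sym u≡w)) (ℕ.m+[n∸m]≡n (wt≤n v)))))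
        (ind-yes (wt v ℕ.≟ n ℕ.∸ w)
          (trans (sym (ℕ.m∸[m∸n]≡n (wt≤n v))) (cong (n ℕ.∸_) u≡w)))
        (ind-no (wt v ℕ.≟ n) v≢n)
    ... | yes v∈ | no v≮t | no v≢n | no u≢w =
      killed 1ℤ (ker incl T v) (ind (wt v ℕ.≟ n)) root
        (ind-no (wt v ℕ.≟ n ℕ.∸ w) λ v≡ → u≢w
          (trans (cong (n ℕ.∸_) v≡) (ℕ.m∸[m∸n]≡n w≤n)))
      where
      u : ℕ
      u = n ℕ.∸ wt v
      v+u≡n : wt v ℕ.+ u ≡ n
      v+u≡n = ℕ.m+[n∸m]≡n (wt≤n v)
      u∈ : u ∈ ws
      u∈ = complete
        (v ⊕ 𝟏 , compl∈ v∈ , ℕ.+-cancelˡ-≡ (wt v) _ _ (trans (wt-compl v) (sym v+u≡n)))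
        (ℕ.m<n⇒0<n∸m (ℕ.≤∧≢⇒< (wt≤n v) v≢n))
        (subst (u ℕ.+ wt T ≤_) (trans (ℕ.+-comm u (wt v)) v+u≡n)
          (ℕ.+-monoʳ-≤ u (ℕ.≮⇒≥ v≮t)))
      root : roots as (bal v) ≡ 0ℤ
      root = trans (cong (roots as) (bal-covalue v v+u≡n))
        (roots-∈ (∈-map⁺ covalue (∈-filter⁺ (λ u → ¬? (u ℕ.≟ w)) u∈ u≢w)))

    co-constant : Constant t (transform incl (layer C (n ℕ.∸ w)))
                             (transform incl (layer C (n ℕ.∸ w)) (canon n t))
    co-constant T T≡t = *-cancelˡ q≢0 (+-cancelʳ (∑ rest) (begin
      q * M T + ∑ rest                  ≡⟨ sym (total T T≡t) ⟩
      transform incl g T                ≡⟨ g-invariant T (canon n t)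
                                             (trans T≡t (sym c≡t)) (s≤s (ℕ.≤-reflexive T≡t)) ⟩
      transform incl g (canon n t)      ≡⟨ total (canon n t) c≡t ⟩
      q * M (canon n t) + ∑ rest        ∎))
      where
      open ≡-Reasoning
      M : Word n → ℤ
      M = transform incl (layer C (n ℕ.∸ w))
      c≡t : wt (canon n t) ≡ t
      c≡t = wt-canon n t t≤n
      total : ∀ T → wt T ≡ t → transform incl g T ≡ q * M T + ∑ rest
      total T T≡t = trans (∑-cong (pointwise T T≡t))
        (trans (∑-+ (λ v → q * (layer C (n ℕ.∸ w) v * ker incl T v)) rest)
          (cong (λ z → z + ∑ rest) (∑-*ˡ q (λ v → layer C (n ℕ.∸ w) v * ker incl T v))))

-- Range of the inner weights, and the bound on t

layer-≡ : (C : LinearCode n) → ∀ w v →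
          layer C w v ≡ ind (LinearCode.∈? C v ×-dec (wt v ℕ.≟ w))
layer-≡ C w v = sym (ind-×-dec (LinearCode.∈? C v) (wt v ℕ.≟ w))

0≤layer : (C : LinearCode n) → ∀ w v → 0ℤ ℤ.≤ layer C w v
0≤layer C w v = subst (0ℤ ℤ.≤_) (sym (layer-≡ C w v))
                      (0≤ind (LinearCode.∈? C v ×-dec (wt v ℕ.≟ w)))

layer-∈ : (C : LinearCode n) → ∀ {w v} → Codeword C v → wt v ≡ w → layer C w v ≡ 1ℤ
layer-∈ C {w} {v} v∈ v≡w =
  trans (layer-≡ C w v) (ind-yes (LinearCode.∈? C v ×-dec (wt v ℕ.≟ w)) (v∈ , v≡w))

layer-∉ : (C : LinearCode n) → ∀ {w v} → ¬ (Codeword C v × wt v ≡ w) → layer C w v ≡ 0ℤ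
layer-∉ C {w} {v} v∉ =
  trans (layer-≡ C w v) (ind-no (LinearCode.∈? C v ×-dec (wt v ℕ.≟ w)) v∉)

*-nonneg : ∀ {a b} → 0ℤ ℤ.≤ a → 0ℤ ℤ.≤ b → 0ℤ ℤ.≤ a * b
*-nonneg {+ a} {+ b} _ _ = subst (0ℤ ℤ.≤_) (ℤ.pos-* a b) (ℤ.+≤+ z≤n)

χ-dual : (C : LinearCode n) → ∀ {x y} → Codeword C x → Codeword (C ^⊥) y → χ x y ≡ 1ℤ
χ-dual C {x} {y} x∈ y∈ = trans (χ-⟨⟩ x y) (cong sgn (y∈ x x∈))

module Range {n} (F : FewWeights n) where
  open FewWeights F
  open CoDesign F using (base; mom-vanishes; compl∈; co-constant) public

  t≤w : ∀ {w} → w ∈ ws → t ≤ w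
  t≤w {w} w∈ with w ℕ.<? t
  ... | no w≮t  = ℕ.≮⇒≥ w≮t
  ... | yes w<t = ⊥-elim contra
    where
    k : ℕ
    k = n ℕ.∸ w
    w+t≤n : w ℕ.+ t ≤ n
    w+t≤n = proj₂ (proj₂ (sound w∈))
    w≤n : w ≤ n
    w≤n = ℕ.≤-trans (ℕ.m≤m+n w t) w+t≤n
    w<n : w < n
    w<n = ℕ.<-≤-trans (ℕ.m<m+n w 0<t) w+t≤n
    w+k≡n : w ℕ.+ k ≡ n
    w+k≡n = ℕ.m+[n∸m]≡n w≤n

    -- `A T` counts the codewords of weight n - w disjoint from T. If wt T = w, such a word must be
    -- the complement of T, so `A T` tells whether T is in C; yet up to weight t it depends only on
    -- the weight.
    A : Word n → ℤ
    A = transform excl (layer C k)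

    A-invariant : Invariant (suc t) A
    A-invariant = transform-invariant incl excl (layer C k) incl≢
      (incl-invariant (layer C k) k (layer-supported C k) t
        (ℕ.m+n≤o⇒m≤o∸n t (subst (_≤ n) (ℕ.+-comm w t) w+t≤n)) (co-constant w∈))

    1≤A : ∀ c → Codeword C c → wt c ≡ w → 1ℤ ℤ.≤ A c
    1≤A c c∈ c≡w = subst (ℤ._≤ A c)
      (cong₂ _*_ (layer-∈ C (compl∈ c∈) (ℕ.+-cancelˡ-≡ w (wt (c ⊕ 𝟏)) k
                   (trans (cong (ℕ._+ wt (c ⊕ 𝟏)) (sym c≡w)) (trans (wt-compl c) (sym w+k≡n)))))
                 (ker-excl-compl c))
      (term≤∑ (λ v → *-nonneg (0≤layer C k v) (0≤ker-excl c v)) (c ⊕ 𝟏))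

    A-outside : ∀ T → wt T ≡ w → ¬ Codeword C T → A T ≡ 0ℤ
    A-outside T T≡w T∉ = trans (∑-cong term) (∑-0 n)
      where
      term : ∀ v → layer C k v * ker excl T v ≡ 0ℤ
      term v with LinearCode.∈? C v ×-dec (wt v ℕ.≟ k)
      ... | no v∉ = trans (cong (_* ker excl T v) (layer-∉ C v∉)) (ℤ.*-zeroˡ (ker excl T v))
      ... | yes (v∈ , v≡k) = trans
        (cong (layer C k v *_) (ker-excl-disjoint T v (trans (cong₂ ℕ._+_ T≡w v≡k) w+k≡n)
          λ v≡T⊕𝟏 → T∉ (subst (Codeword C) (trans (cong (_⊕ 𝟏) v≡T⊕𝟏) (⊕-cancel T 𝟏))
                              (compl∈ v∈))))
        (ℤ.*-zeroʳ (layer C k v))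

    all∈ : ∀ T → wt T ≡ w → Codeword C T
    all∈ T T≡w with LinearCode.∈? C T | proj₁ (sound w∈)
    ... | yes T∈ | _ = T∈
    ... | no T∉  | c , c∈ , c≡w = ⊥-elim (1≰0 (subst (1ℤ ℤ.≤_)
      (trans (A-invariant c T (trans c≡w (sym T≡w))
               (subst (_< suc t) (sym c≡w) (ℕ.m<n⇒m<1+n w<t)))
             (A-outside T T≡w T∉))
      (1≤A c c∈ c≡w)))
      where
      1≰0 : ¬ 1ℤ ℤ.≤ 0ℤ
      1≰0 (ℤ.+≤+ ())

    contra : ⊥
    contra with proj₁ dual
    ... | y , y∈ , y≢𝟎 , y≡D with orthogonal-layer y (proj₁ (proj₂ (sound w∈))) w<n
                                   (λ x x≡w → χ-dual C (all∈ x x≡w) y∈)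
    ...   | inj₁ y≡0 = y≢𝟎 (wt≡0⇒𝟎 y y≡0)
    -- Now n = D = t + s, so the s counted weights lie in 1, ..., s; but a codeword of weight 1 is
    -- not orthogonal to y = `𝟏`, so only s - 1 values are left.
    ...   | inj₂ y≡n = ℕ.1+n≰n
      (pigeonhole (0 ∷ 1 ∷ ws) (suc (length ws)) distinct bound)
      where
      1∉ws : ¬ 1 ∈ ws
      1∉ws 1∈ with proj₁ (sound 1∈)
      ... | c , c∈ , c≡1 with trans (sym (χ-dual C c∈ y∈))
                                    (trans (χ-full c y y≡n) (cong (-1ℤ ^_) c≡1))
      ...   | ()

      distinct : Unique (0 ∷ 1 ∷ ws)
      distinct = ((λ ()) All.∷ All.tabulate λ { u∈ refl → ℕ.<⇒≢ (proj₁ (proj₂ (sound u∈))) refl })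
               ∷ All.tabulate (λ { u∈ refl → 1∉ws u∈ }) ∷ unique

      bound : ∀ {u} → u ∈ 0 ∷ 1 ∷ ws → u < suc (length ws)
      bound (here refl) = s≤s z≤n
      bound (there (here refl)) = s≤s (0<len w∈)
        where
        0<len : ∀ {us} {u : ℕ} → u ∈ us → 0 < length us
        0<len (here _)  = s≤s z≤n
        0<len (there _) = s≤s z≤n
      bound (there (there u∈)) = s≤s (ℕ.+-cancelʳ-≤ t _ _
        (subst (_ ≤_) (trans (trans (sym y≡n) (trans y≡D D≡)) (ℕ.+-comm t (length ws)))
          (proj₂ (proj₂ (sound u∈)))))

  2t≤n : t ℕ.+ t ≤ n
  2t≤n = let w , w∈ = nonempty
         in ℕ.≤-trans (ℕ.+-monoˡ-≤ t (t≤w w∈)) (proj₂ (proj₂ (sound w∈)))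

  0<n : 0 < n
  0<n = ℕ.<-≤-trans 0<t (ℕ.≤-trans (ℕ.m≤m+n t t) 2t≤n)

  compl-occurs : ∀ {u} → Occurs C u → Occurs C (n ℕ.∸ u)
  compl-occurs (c , c∈ , refl) =
    c ⊕ 𝟏 , compl∈ c∈ , ℕ.+-cancelˡ-≡ (wt c) _ _
      (trans (wt-compl c) (sym (ℕ.m+[n∸m]≡n (wt≤n c))))

  -- A weight above n - t would have a complementary weight below t, itself counted because 2t ≤ n,
  -- against `t≤w`.
  inner∈ws : ∀ {u} → Occurs C u → 0 < u → u < n → u ∈ ws
  inner∈ws {u} occ 0<u u<n with u ℕ.+ t ℕ.≤? n
  ... | yes u+t≤n = complete occ 0<u u+t≤n
  ... | no u+t≰n  = ⊥-elim (ℕ.<⇒≱ n-u<t (t≤w (complete (compl-occurs occ)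
          (ℕ.m<n⇒0<n∸m u<n) (ℕ.≤-trans (ℕ.+-monoˡ-≤ t (ℕ.<⇒≤ n-u<t)) 2t≤n))))
    where
    n-u<t : n ℕ.∸ u < t
    n-u<t = ℕ.m<n+o⇒m∸n<o n u {{ℕ.>-nonZero 0<t}} (ℕ.≰⇒> u+t≰n)

  trichotomy : ∀ {v} → Codeword C v → wt v ≡ 0 ⊎ wt v ≡ n ⊎ wt v ∈ ws
  trichotomy {v} v∈ with wt v ℕ.≟ 0 | wt v ℕ.≟ n
  ... | yes v≡0 | _       = inj₁ v≡0
  ... | no _    | yes v≡n = inj₂ (inj₁ v≡n)
  ... | no v≢0  | no v≢n  = inj₂ (inj₂
    (inner∈ws (v , v∈ , refl) (ℕ.n≢0⇒n>0 v≢0) (ℕ.≤∧≢⇒< (wt≤n v) v≢n)))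

  inner<n : ∀ {u} → u ∈ ws → u < n
  inner<n {u} u∈ = ℕ.<-≤-trans (ℕ.m<m+n u 0<t) (proj₂ (proj₂ (sound u∈)))

  compl∈ws : ∀ {u} → u ∈ ws → n ℕ.∸ u ∈ ws
  compl∈ws u∈ = inner∈ws (compl-occurs (proj₁ (sound u∈)))
    (ℕ.m<n⇒0<n∸m (inner<n u∈)) (ℕ.∸-monoʳ-< (proj₁ (proj₂ (sound u∈))) (ℕ.<⇒≤ (inner<n u∈)))

  value : ℕ → ℤ
  value u = + n - (+ 2) * + u

  -- The mean of (y² - n²) ∏ (y - yᵢ)² over the code, hence over the whole space,
  -- would be zero, although this is nonpositive and nonzero at weight 1.

  t≤2+ws : t ≤ 2 ℕ.+ length ws
  t≤2+ws with t ℕ.≤? 2 ℕ.+ length ws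
  ... | yes t≤ = t≤
  ... | no t≰  = ⊥-elim (1∉ws (∈-map⁻ value (roots-∈⁻ ys r≡0)))
    where
    ys as : List ℤ
    ys = List.map value ws
    as = + n ∷ - + n ∷ ys List.++ ys

    -- 2 + 2s < t + s is exactly the negation of t ≤ s + 2.
    as<D : length as < D
    as<D = subst₂ _<_ (sym len) (sym D≡) (ℕ.+-monoˡ-< (length ws) (ℕ.≰⇒> t≰))
      where
      len : length as ≡ 2 ℕ.+ length ws ℕ.+ length ws
      len = cong (2 ℕ.+_) (trans (List.length-++ ys)
        (cong₂ ℕ._+_ (List.length-map value ws) (List.length-map value ws)))

    vanish : ∀ v → Codeword C v → roots as (bal v) ≡ 0ℤ
    vanish v v∈ with trichotomy v∈
    ... | inj₁ v≡0        = roots-∈ {as} (here (trans (cong bal (wt≡0⇒𝟎 v v≡0)) (bal-𝟎 n)))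
    ... | inj₂ (inj₁ v≡n) = roots-∈ {as} (there (here
      (trans (cong bal (wt≡n⇒𝟏 v v≡n)) (bal-𝟏 n))))
    ... | inj₂ (inj₂ v∈w) = roots-∈ {as} (there (there (∈-++⁺ˡ {xs = ys}
      (subst (_∈ ys) (sym (bal-wt v)) (∈-map⁺ value v∈w)))))

    f : Word n → ℤ
    f v = -1ℤ * roots as (bal v)

    -- On the whole cube every nontrivial character sums to 0, so any bound may stand for D; the
    -- least sufficient one is taken.
    cube : ∀ x → wt x < suc (length as) →
           transform sgn (λ _ → 1ℤ) x ≡ (+ 2) ^ n * δ₀ (wt x)
    cube x _ = trans (∑-cong λ v → ℤ.*-identityˡ (χ x v)) (∑-χ x)

    f-sum : ∑ f ≡ 0ℤ
    f-sum = begin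
      ∑ f
        ≡⟨ ∑-*ˡ -1ℤ R ⟩
      -1ℤ * ∑ R
        ≡⟨ cong (-1ℤ *_) (∑-cong λ v → sym (ℤ.*-identityˡ (R v))) ⟩
      -1ℤ * ∑ 1R
        ≡⟨ cong (-1ℤ *_) (mean {n} (λ _ → 1ℤ) ((+ 2) ^ n) (suc (length as)) cube as ℕ.≤-refl) ⟩
      -1ℤ * ((+ 2) ^ n * mom (+ n) as 0)
        ≡⟨ cong (λ z → -1ℤ * ((+ 2) ^ n * z)) (mom-vanishes as as<D vanish) ⟩
      -1ℤ * ((+ 2) ^ n * 0ℤ)
        ≡⟨ cong (-1ℤ *_) (ℤ.*-zeroʳ ((+ 2) ^ n)) ⟩
      0ℤ ∎
      where
      open ≡-Reasoning
      R 1R : Word n → ℤ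
      R v  = roots as (bal v)
      1R v = 1ℤ * R v

    r : Word n → ℤ
    r v = roots ys (bal v)

    -- With y = `bal v`, n - y = 2 wt v and n + y = 2 (n - wt v), which makes the sign visible.
    f-value : ∀ v → f v ≡ (+ 4) * (+ wt v * + (n ℕ.∸ wt v)) * (r v * r v)
    f-value v = begin
      -1ℤ * ((bal v - + n) * ((bal v - - + n) * roots (ys List.++ ys) (bal v)))
        ≡⟨ cong₂ (λ y z → -1ℤ * ((y - + n) * ((y - - + n) * z)))
             (bal-wt v) (roots-++ ys ys (bal v)) ⟩
      -1ℤ * ((+ n - (+ 2) * + wt v - + n) *
             ((+ n - (+ 2) * + wt v - - + n) * (r v * r v)))
        ≡⟨ cong (λ z → -1ℤ * ((z - (+ 2) * + wt v - z) *
                              ((z - (+ 2) * + wt v - - z) * (r v * r v))))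
             (cong +_ (sym (ℕ.m+[n∸m]≡n (wt≤n v)))) ⟩
      _ ≡⟨ lemma (+ wt v) (+ (n ℕ.∸ wt v)) (r v * r v) ⟩
      (+ 4) * (+ wt v * + (n ℕ.∸ wt v)) * (r v * r v) ∎
      where
      open ≡-Reasoning
      lemma : ∀ w m r → -1ℤ * (((w + m) - (+ 2) * w - (w + m)) *
                               (((w + m) - (+ 2) * w - - (w + m)) * r)) ≡
                        (+ 4) * (w * m) * r
      lemma = solve-∀

    0≤f : ∀ v → 0ℤ ℤ.≤ f v
    0≤f v = subst (0ℤ ℤ.≤_) (sym (f-value v))
      (*-nonneg (*-nonneg (ℤ.+≤+ {0} {4} z≤n)
                          (*-nonneg (ℤ.+≤+ {0} {wt v} z≤n) (ℤ.+≤+ {0} {n ℕ.∸ wt v} z≤n)))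
                (square-nonneg (r v)))
      where
      square-nonneg : ∀ a → 0ℤ ℤ.≤ a * a
      square-nonneg (+ a)    = *-nonneg {+ a} (ℤ.+≤+ z≤n) (ℤ.+≤+ z≤n)
      square-nonneg -[1+ a ] = ℤ.+≤+ z≤n

    1<n : 1 < n
    1<n = ℕ.≤-trans (ℕ.+-mono-≤ 0<t 0<t) 2t≤n

    -- Weight 1 lies strictly between 0 and n, so the factor 4 wt e (n - wt e) is nonzero; and it is
    -- below t, so it cannot be a counted weight.
    e : Word n
    e = canon n 1
    e≡1 : wt e ≡ 1
    e≡1 = wt-canon n 1 0<n

    r≡0 : roots ys (+ n - + 2) ≡ 0ℤ
    r≡0 = subst (λ z → roots ys z ≡ 0ℤ)
      (trans (bal-wt e) (cong (λ z → + n - (+ 2) * + z) e≡1))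
      ([ id , id ]′ (ℤ.i*j≡0⇒i≡0∨j≡0 (r e) (*-cancelˡ 4wm≢0
        (trans (sym (f-value e)) (trans (∑≡0⇒0 0≤f f-sum e) (sym (ℤ.*-zeroʳ 4wm)))))))
      where
      4wm : ℤ
      4wm = (+ 4) * (+ wt e * + (n ℕ.∸ wt e))
      4wm≢0 : 4wm ≢ 0ℤ
      4wm≢0 = *-≢0 {+ 4} (λ ()) (*-≢0
        (λ eq → ℕ.1+n≢0 (trans (sym e≡1) (ℤ.+-injective eq)))
        (λ eq → ℕ.m>n⇒m∸n≢0 (subst (_< n) (sym e≡1) 1<n) (ℤ.+-injective eq)))

    1∉ws : ¬ ∃ λ u → u ∈ ws × + n - + 2 ≡ value u
    1∉ws (u , u∈ , eq) = t≰ (ℕ.≤-trans (t≤w u∈)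
      (subst (_≤ 2 ℕ.+ length ws) (value-injective {1} {u} eq) (s≤s z≤n)))
      where
      value-injective : ∀ {u w} → value u ≡ value w → u ≡ w
      value-injective {u} {w} eq = ℤ.+-injective (*-cancelˡ {+ 2} (λ ())
        (trans (lemma (+ u) (+ n)) (trans (cong (λ z → + n - z) eq) (sym (lemma (+ w) (+ n))))))
        where
        lemma : ∀ u n → (+ 2) * u ≡ n - (n - (+ 2) * u)
        lemma = solve-∀

-- Parity and powers of two

-1^≡1⇒even : ∀ k → -1ℤ ^ k ≡ 1ℤ → ∃ λ q → k ≡ q ℕ.+ q
-1^≡1⇒even zero          _  = 0 , refl
-1^≡1⇒even (suc zero)    ()
-1^≡1⇒even (suc (suc k)) eq =
  let q , k≡ = -1^≡1⇒even k (trans (sym (double-neg (-1ℤ ^ k))) eq)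
  in suc q , cong suc (trans (cong suc k≡) (sym (ℕ.+-suc q q)))
  where
  double-neg : ∀ a → -1ℤ * (-1ℤ * a) ≡ a
  double-neg = solve-∀

2^-divisor : ∀ k a b → a ℕ.* b ≡ 2 ℕ.^ k → ∃ λ j → a ≡ 2 ℕ.^ j
2^-divisor zero    a b ab≡ = 0 , ℕ.m*n≡1⇒m≡1 a b ab≡
2^-divisor (suc k) a b ab≡
  with euclidsLemma a b prime[2] (divides (2 ℕ.^ k) (trans ab≡ (ℕ.*-comm 2 (2 ℕ.^ k))))
... | inj₁ (divides a′ refl) =
  let j , a′≡ = 2^-divisor k a′ b (ℕ.*-cancelˡ-≡ (a′ ℕ.* b) (2 ℕ.^ k) 2
                  (trans (trans (sym (ℕ.*-assoc 2 a′ b)) (cong (ℕ._* b) (ℕ.*-comm 2 a′))) ab≡))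
  in suc j , trans (ℕ.*-comm a′ 2) (cong (2 ℕ.*_) a′≡)
... | inj₂ (divides b′ refl) =
  2^-divisor k a b′ (ℕ.*-cancelʳ-≡ (a ℕ.* b′) (2 ℕ.^ k) 2
    (trans (trans (ℕ.*-assoc a b′ 2) ab≡) (ℕ.*-comm 2 (2 ℕ.^ k))))

2^-∣ : ∀ j k → 2 ℕ.^ j < 2 ℕ.^ suc k → 2 ℕ.^ j ∣ 2 ℕ.^ k
2^-∣ j k lt = ℕ.divides (2 ℕ.^ (k ℕ.∸ j))
  (trans (cong (2 ℕ.^_) (sym (ℕ.m∸n+n≡m j≤k))) (ℕ.^-distribˡ-+-* 2 (k ℕ.∸ j) j))
  where
  j≤k : j ≤ k
  j≤k = ℕ.≮⇒≥ λ k<j → ℕ.<⇒≱ lt (ℕ.^-monoʳ-≤ 2 k<j)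

∣2^∣ : ∀ k → ℤ.∣ (+ 2) ^ k ∣ ≡ 2 ℕ.^ k
∣2^∣ zero    = refl
∣2^∣ (suc k) = trans (ℤ.abs-* (+ 2) ((+ 2) ^ k)) (cong (2 ℕ.*_) (∣2^∣ k))

-- By `size-dual` the size of C divides 2ⁿ, and so does each of its factors.
size-divisor : (C : LinearCode n) → ∀ a b → size C ≡ + (a ℕ.* b) → ∃ λ j → a ≡ 2 ℕ.^ j
size-divisor {n} C a b eq = 2^-divisor n a (b ℕ.* ℤ.∣ size (C ^⊥) ∣) (begin
  a ℕ.* (b ℕ.* ℤ.∣ size (C ^⊥) ∣)  ≡⟨ sym (ℕ.*-assoc a b _) ⟩
  a ℕ.* b ℕ.* ℤ.∣ size (C ^⊥) ∣    ≡⟨ cong (λ z → ℤ.∣ z ∣ ℕ.* ℤ.∣ size (C ^⊥) ∣) (sym eq) ⟩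
  ℤ.∣ size C ∣ ℕ.* ℤ.∣ size (C ^⊥) ∣ ≡⟨ sym (ℤ.abs-* (size C) (size (C ^⊥))) ⟩
  ℤ.∣ size C * size (C ^⊥) ∣        ≡⟨ cong ℤ.∣_∣ (size-dual C) ⟩
  ℤ.∣ (+ 2) ^ n ∣                   ≡⟨ ∣2^∣ n ⟩
  2 ℕ.^ n                           ∎)
  where open ≡-Reasoning

-- y⁴ + 3y² + 4 = (y² + y + 2)(y² - y + 2) is not a power of two for y ≥ 3: both
-- factors would be divisible by 8, hence 4 ∣ y and y² + y + 2 ≡ 2 (mod 4).

¬powers : ∀ y → 2 ≤ y → ∀ i j →
  suc y ℕ.* suc y ℕ.+ suc y ℕ.+ 2 ≡ 2 ℕ.^ i → suc y ℕ.* y ℕ.+ 2 ≡ 2 ℕ.^ j → ⊥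
¬powers y 2≤y i j A≡ B≡ = ℕ.<⇒≱ {2} {4} (s≤s (s≤s (s≤s z≤n))) (ℕ.∣⇒≤ 4∣2)
  where
  A B : ℕ
  A = suc y ℕ.* suc y ℕ.+ suc y ℕ.+ 2
  B = suc y ℕ.* y ℕ.+ 2
  A≡B+2y : A ≡ B ℕ.+ 2 ℕ.* suc y
  A≡B+2y = solve 1 (λ y → (con 1 :+ y) :* (con 1 :+ y) :+ (con 1 :+ y) :+ con 2 :=
    (con 1 :+ y) :* y :+ con 2 :+ con 2 :* (con 1 :+ y)) refl y
    where open Data.Nat.Solver.+-*-Solver
  8≤B : 8 ≤ B
  8≤B = ℕ.+-monoˡ-≤ 2 (ℕ.*-mono-≤ (s≤s 2≤y) 2≤y)
  8≤A : 8 ≤ A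
  8≤A = ℕ.≤-trans 8≤B (subst (B ≤_) (sym A≡B+2y) (ℕ.m≤m+n B (2 ℕ.* suc y)))
  8∣A : 8 ∣ A
  8∣A = subst (8 ∣_) (sym A≡) (2^-∣ 3 i (ℕ.≤-<-trans 8≤A
    (subst (_< 2 ℕ.^ suc i) (sym A≡) (ℕ.^-monoʳ-< 2 (s≤s (s≤s z≤n)) (ℕ.n<1+n i)))))
  8∣B : 8 ∣ B
  8∣B = subst (8 ∣_) (sym B≡) (2^-∣ 3 j (ℕ.≤-<-trans 8≤B
    (subst (_< 2 ℕ.^ suc j) (sym B≡) (ℕ.^-monoʳ-< 2 (s≤s (s≤s z≤n)) (ℕ.n<1+n j)))))
  4∣y : 4 ∣ suc y
  4∣y = ℕ.*-cancelˡ-∣ 2 (ℕ.∣m+n∣m⇒∣n (subst (8 ∣_) A≡B+2y 8∣A) 8∣B)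
  4∣2 : 4 ∣ 2
  4∣2 = ℕ.∣m+n∣m⇒∣n (ℕ.∣-trans (divides 2 refl) 8∣A)
    (ℕ.∣m∣n⇒∣m+n (ℕ.∣m⇒∣m*n (suc y) 4∣y) 4∣y)

-- Parity of the dual weights, and sums that see only the words of weight 0 and n

module Ends {n} (F : FewWeights n) where
  open FewWeights F
  open Range F public

  -- Dual words are orthogonal to `𝟏`, and pairing with `𝟏` gives the parity of the weight.
  dual-even : ∀ {y} → Codeword (C ^⊥) y → ∃ λ q → wt y ≡ q ℕ.+ q
  dual-even {y} y∈ = -1^≡1⇒even (wt y) (trans (sym (χ-full y 𝟏 (wt-𝟏 n)))
    (trans (χ-comm y 𝟏) (χ-dual C 𝟏∈ y∈)))

  D-even : ∃ λ q → D ≡ q ℕ.+ q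
  D-even = let y , y∈ , _ , y≡D = proj₁ dual
               q , y≡ = dual-even y∈
           in q , trans (sym y≡D) y≡

  ends : (f : Word n → ℤ) → (∀ v → Codeword C v → wt v ∈ ws → f v ≡ 0ℤ) →
         ∑ (λ v → 𝟙 C v * f v) ≡ f 𝟎 + f 𝟏
  ends f f-inner = begin
    ∑ (λ v → 𝟙 C v * f v)
      ≡⟨ ∑-cong term ⟩
    ∑ {n} (λ v → f 𝟎 * ind (wt v ℕ.≟ 0) + f 𝟏 * ind (wt v ℕ.≟ n))
      ≡⟨ ∑-+ {n} (λ v → f 𝟎 * ind (wt v ℕ.≟ 0)) (λ v → f 𝟏 * ind (wt v ℕ.≟ n)) ⟩
    ∑ {n} (λ v → f 𝟎 * ind (wt v ℕ.≟ 0)) + ∑ {n} (λ v → f 𝟏 * ind (wt v ℕ.≟ n))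
      ≡⟨ cong₂ _+_
           (trans (∑-*ˡ {n} (f 𝟎) (λ v → ind (wt v ℕ.≟ 0)))
             (trans (cong (f 𝟎 *_) (∑-wt≡0 n)) (ℤ.*-identityʳ (f 𝟎))))
           (trans (∑-*ˡ {n} (f 𝟏) (λ v → ind (wt v ℕ.≟ n)))
             (trans (cong (f 𝟏 *_) (∑-wt≡n n)) (ℤ.*-identityʳ (f 𝟏)))) ⟩
    f 𝟎 + f 𝟏 ∎
    where
    open ≡-Reasoning
    neither : ∀ {x i j} y z → x ≡ 0ℤ → i ≡ 0ℤ → j ≡ 0ℤ → x ≡ y * i + z * j
    neither y z refl refl refl = lemma y z
      where
      lemma : ∀ y z → 0ℤ ≡ y * 0ℤ + z * 0ℤ
      lemma = solve-∀

    first : ∀ {a x i j y} z → a ≡ 1ℤ → x ≡ y → i ≡ 1ℤ → j ≡ 0ℤ → a * x ≡ y * i + z * j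
    first {x = x} z refl refl refl refl = lemma x z
      where
      lemma : ∀ x z → 1ℤ * x ≡ x * 1ℤ + z * 0ℤ
      lemma = solve-∀

    last : ∀ {a x i j z} y → a ≡ 1ℤ → x ≡ z → i ≡ 0ℤ → j ≡ 1ℤ → a * x ≡ y * i + z * j
    last {x = x} y refl refl refl refl = lemma x y
      where
      lemma : ∀ x y → 1ℤ * x ≡ y * 0ℤ + x * 1ℤ
      lemma = solve-∀

    0≢n : 0 ≢ n
    0≢n = ℕ.<⇒≢ 0<n

    term : ∀ v → 𝟙 C v * f v ≡ f 𝟎 * ind (wt v ℕ.≟ 0) + f 𝟏 * ind (wt v ℕ.≟ n)
    term v with wt v ℕ.≟ 0 | wt v ℕ.≟ n
    ... | yes v≡0 | _ = first {i = ind (wt v ℕ.≟ 0)} {j = ind (wt v ℕ.≟ n)} (f 𝟏)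
      (𝟙-∈ C (subst (Codeword C) (sym (wt≡0⇒𝟎 v v≡0)) (LinearCode.0∈ C)))
      (cong f (wt≡0⇒𝟎 v v≡0)) (ind-yes (wt v ℕ.≟ 0) v≡0)
      (ind-no (wt v ℕ.≟ n) λ v≡n → 0≢n (trans (sym v≡0) v≡n))
    ... | no v≢0 | yes v≡n = last {i = ind (wt v ℕ.≟ 0)} {j = ind (wt v ℕ.≟ n)} (f 𝟎)
      (𝟙-∈ C (subst (Codeword C) (sym (wt≡n⇒𝟏 v v≡n)) 𝟏∈))
      (cong f (wt≡n⇒𝟏 v v≡n)) (ind-no (wt v ℕ.≟ 0) v≢0) (ind-yes (wt v ℕ.≟ n) v≡n)
    ... | no v≢0 | no v≢n = neither {i = ind (wt v ℕ.≟ 0)} {j = ind (wt v ℕ.≟ n)} (f 𝟎) (f 𝟏)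
      inner (ind-no (wt v ℕ.≟ 0) v≢0) (ind-no (wt v ℕ.≟ n) v≢n)
      where
      inner : 𝟙 C v * f v ≡ 0ℤ
      inner with LinearCode.∈? C v
      ... | no _   = refl
      ... | yes v∈ = trans (ℤ.*-identityˡ (f v)) (f-inner v v∈ (∈ws (trichotomy v∈)))
        where
        ∈ws : wt v ≡ 0 ⊎ wt v ≡ n ⊎ wt v ∈ ws → wt v ∈ ws
        ∈ws (inj₁ v≡0)        = ⊥-elim (v≢0 v≡0)
        ∈ws (inj₂ (inj₁ v≡n)) = ⊥-elim (v≢n v≡n)
        ∈ws (inj₂ (inj₂ v∈w)) = v∈w

-- Two inner weights

module _ where
  open +-*-Solver

  private
    -- Mirrors `mom` in the syntax of the ring solver, so that the closed forms can be checked as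
    -- polynomial identities.
    momᴾ : ∀ {k} → Polynomial k → List (Polynomial k) → ℕ → Polynomial k
    momᴾ N []       zero    = con 1ℤ
    momᴾ N []       (suc _) = con 0ℤ
    momᴾ N (a ∷ as) j       = con (+ j) :* momᴾ N as (ℕ.pred j)
                           :+ (N :- con (+ j)) :* momᴾ N as (suc j)
                           :- a :* momᴾ N as j

  mom-2 : ∀ N y → mom N (y ∷ - y ∷ []) 0 ≡ N - y * y
  mom-2 = solve 2 (λ N y → momᴾ N (y ∷ :- y ∷ []) 0 := N :- y :* y) refl

  -- On the cube the balance has second moment N and fourth moment 3N² - 2N. The roots ±N kill `𝟎`
  -- and `𝟏`, the roots ±y the two inner weights, so for the code this vanishes and y² = N - 2
  -- follows.
  mom-4 : ∀ N y → mom N (y ∷ - y ∷ N ∷ - N ∷ []) 0 ≡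
                  N * (N - 1ℤ) * (y * y - (N - + 2))
  mom-4 = solve 2 (λ N y → momᴾ N (y ∷ :- y ∷ N ∷ :- N ∷ []) 0 :=
                           N :* (N :- con 1ℤ) :* (y :* y :- (N :- con (+ 2)))) refl

module TwoWeights {n} (F : FewWeights n) where
  open FewWeights F
  open Ends F

  ¬t≡4 : ∀ {w₁ w₂} → ws ≡ w₁ ∷ w₂ ∷ [] → t ≢ 4
  ¬t≡4 {w₁} {w₂} refl refl with unique
  ... | (w₁≢w₂ All.∷ _) ∷ _ = impossible
    where
    w₁∈ : w₁ ∈ ws
    w₁∈ = here refl
    w₂∈ : w₂ ∈ ws
    w₂∈ = there (here refl)
    w₁≤n : w₁ ≤ n
    w₁≤n = ℕ.<⇒≤ (inner<n w₁∈)
    w₂≤n : w₂ ≤ n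
    w₂≤n = ℕ.<⇒≤ (inner<n w₂∈)

    half-unique : ∀ {u w} → u ≤ n → w ≤ n → n ℕ.∸ u ≡ u → n ℕ.∸ w ≡ w → u ≡ w
    half-unique {u} {w} u≤n w≤n n-u≡u n-w≡w = ℕ.*-cancelˡ-≡ u w 2 (trans (double u≤n n-u≡u)
      (sym (double w≤n n-w≡w)))
      where
      double : ∀ {u} → u ≤ n → n ℕ.∸ u ≡ u → 2 ℕ.* u ≡ n
      double {u} u≤n eq = trans (cong (u ℕ.+_) (trans (ℕ.+-identityʳ u) (sym eq)))
                                (ℕ.m+[n∸m]≡n u≤n)

    -- Complementation permutes the two weights and cannot fix both, since both would then be n / 2.
    w₁+w₂≡n : w₁ ℕ.+ w₂ ≡ n
    w₁+w₂≡n with compl∈ws w₁∈ | compl∈ws w₂∈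
    ... | there (here n-w₁≡w₂) | _ = trans (cong (w₁ ℕ.+_) (sym n-w₁≡w₂)) (ℕ.m+[n∸m]≡n w₁≤n)
    ... | here _ | here n-w₂≡w₁ = trans (ℕ.+-comm w₁ w₂)
      (trans (cong (w₂ ℕ.+_) (sym n-w₂≡w₁)) (ℕ.m+[n∸m]≡n w₂≤n))
    ... | here n-w₁≡w₁ | there (here n-w₂≡w₂) =
      ⊥-elim (w₁≢w₂ (half-unique w₁≤n w₂≤n n-w₁≡w₁ n-w₂≡w₂))

    y : ℤ
    y = value w₁

    value-w₂ : value w₂ ≡ - y
    value-w₂ = trans (cong (λ z → + z - (+ 2) * + w₂) (sym w₁+w₂≡n))
      (trans (lemma (+ w₁) (+ w₂)) (cong (λ z → - (+ z - (+ 2) * + w₁)) w₁+w₂≡n))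
      where
      lemma : ∀ a b → (a + b) - (+ 2) * b ≡ - ((a + b) - (+ 2) * a)
      lemma = solve-∀

    inner-bal : ∀ v → wt v ∈ ws → bal v ∈ y ∷ - y ∷ []
    inner-bal v (here eq)         = here (trans (bal-wt v) (cong value eq))
    inner-bal v (there (here eq)) =
      there (here (trans (bal-wt v) (trans (cong value eq) value-w₂)))

    8≤n : 8 ≤ n
    8≤n = 2t≤n

    vanish : ∀ v → Codeword C v → roots (y ∷ - y ∷ + n ∷ - + n ∷ []) (bal v) ≡ 0ℤ
    vanish v v∈ = roots-∈ {y ∷ - y ∷ + n ∷ - + n ∷ []} (position (trichotomy v∈))
      where
      position : wt v ≡ 0 ⊎ wt v ≡ n ⊎ wt v ∈ ws → bal v ∈ y ∷ - y ∷ + n ∷ - + n ∷ []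
      position (inj₁ v≡0) = there (there (here (trans (cong bal (wt≡0⇒𝟎 v v≡0)) (bal-𝟎 n))))
      position (inj₂ (inj₁ v≡n)) =
        there (there (there (here (trans (cong bal (wt≡n⇒𝟏 v v≡n)) (bal-𝟏 n)))))
      position (inj₂ (inj₂ v∈w)) = ∈-++⁺ˡ {xs = y ∷ - y ∷ []} (inner-bal v v∈w)

    4<D : 4 < D
    4<D = subst (4 <_) (sym D≡) (s≤s (s≤s (s≤s (s≤s (s≤s z≤n)))))

    y² : y * y ≡ + n - + 2
    y² = x-y≡0⇒x≡y (*-cancelˡ {+ n * (+ n - 1ℤ)} (*-≢0 n≢0 n-1≢0)
      (trans (sym (mom-4 (+ n) y))
        (trans (mom-vanishes (y ∷ - y ∷ + n ∷ - + n ∷ []) 4<D vanish)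
               (sym (ℤ.*-zeroʳ (+ n * (+ n - 1ℤ)))))))
      where
      n≢0 : + n ≢ 0ℤ
      n≢0 eq = ℕ.<⇒≢ 0<n (sym (ℤ.+-injective eq))
      n-1≢0 : + n - 1ℤ ≢ 0ℤ
      n-1≢0 eq = ℕ.<⇒≢ {1} (ℕ.<-≤-trans (s≤s (s≤s z≤n)) 8≤n)
                   (sym (ℤ.+-injective (x-y≡0⇒x≡y {+ n} {1ℤ} eq)))

    -- The inner weights drop out of the second moment, so ∣C∣ (n - y²) = 2 (n² - y²), where n - y²
    -- = 2.
    size≡ : size C ≡ + n * + n - + n + + 2
    size≡ = *-cancelˡ {+ 2} (λ ()) (begin
      (+ 2) * size C
        ≡⟨ mult (size C) (+ n) ⟩
      size C * (+ n - (+ n - + 2))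
        ≡⟨ cong (λ z → size C * (+ n - z)) (sym y²) ⟩
      size C * (+ n - y * y)
        ≡⟨ cong (size C *_) (sym (mom-2 (+ n) y)) ⟩
      size C * mom (+ n) (y ∷ - y ∷ []) 0
        ≡⟨ sym (mean (𝟙 C) (size C) D base (y ∷ - y ∷ []) (ℕ.<-trans (s≤s (s≤s (s≤s z≤n))) 4<D)) ⟩
      ∑ (λ v → 𝟙 C v * roots (y ∷ - y ∷ []) (bal v))
        ≡⟨ ends (λ v → roots (y ∷ - y ∷ []) (bal v))
             (λ v _ v∈w → roots-∈ {y ∷ - y ∷ []} (inner-bal v v∈w)) ⟩
      roots (y ∷ - y ∷ []) (bal (𝟎 {n})) + roots (y ∷ - y ∷ []) (bal (𝟏 {n}))
        ≡⟨ cong₂ (λ a b → roots (y ∷ - y ∷ []) a + roots (y ∷ - y ∷ []) b)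
             (bal-𝟎 n) (bal-𝟏 n) ⟩
      roots (y ∷ - y ∷ []) (+ n) + roots (y ∷ - y ∷ []) (- + n)
        ≡⟨ expand (+ n) y ⟩
      (+ 2) * (+ n * + n - y * y)
        ≡⟨ cong (λ z → (+ 2) * (+ n * + n - z)) y² ⟩
      (+ 2) * (+ n * + n - (+ n - + 2))
        ≡⟨ assoc (+ n) ⟩
      (+ 2) * (+ n * + n - + n + + 2) ∎)
      where
      open ≡-Reasoning
      mult : ∀ a n → (+ 2) * a ≡ a * (n - (n - + 2))
      mult = solve-∀
      expand : ∀ n y → (n - y) * ((n - - y) * 1ℤ) + (- n - y) * ((- n - - y) * 1ℤ) ≡
                       (+ 2) * (n * n - y * y)
      expand = solve-∀
      assoc : ∀ n → (+ 2) * (n * n - (n - + 2)) ≡ (+ 2) * (n * n - n + + 2)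
      assoc = solve-∀

    Y : ℕ
    Y = ℤ.∣ y ∣

    n≡ : n ≡ Y ℕ.* Y ℕ.+ 2
    n≡ = ℤ.+-injective (trans (lemma (+ n))
      (cong (λ z → z + + 2) (trans (sym y²) (square y))))
      where
      lemma : ∀ n → n ≡ (n - + 2) + + 2
      lemma = solve-∀
      square : ∀ y → y * y ≡ + (ℤ.∣ y ∣ ℕ.* ℤ.∣ y ∣)
      square (+ a)    = sym (ℤ.pos-* a a)
      square -[1+ a ] = refl

    -- n² - n + 2 for n = z² + 2, split as (z² + 2)² - z².

    split : ∀ z → n ≡ suc z ℕ.* suc z ℕ.+ 2 →
            size C ≡ + ((suc z ℕ.* suc z ℕ.+ suc z ℕ.+ 2) ℕ.* (suc z ℕ.* z ℕ.+ 2))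
    split z eq = begin
      size C
        ≡⟨ size≡ ⟩
      + n * + n - + n + + 2
        ≡⟨ cong (λ m → m * m - m + + 2) (trans (cong +_ eq)
             (cong (λ m → m + + 2) (ℤ.pos-* (suc z) (suc z)))) ⟩
      (x * x + + 2) * (x * x + + 2) - (x * x + + 2) + + 2
        ≡⟨ factor (+ z) ⟩
      (x * x + x + + 2) * (x * + z + + 2)
        ≡⟨ sym (cong₂ (λ a b → (a + x + + 2) * (b + + 2))
             (ℤ.pos-* (suc z) (suc z)) (ℤ.pos-* (suc z) z)) ⟩
      + (suc z ℕ.* suc z ℕ.+ suc z ℕ.+ 2) * + (suc z ℕ.* z ℕ.+ 2)
        ≡⟨ sym (ℤ.pos-* (suc z ℕ.* suc z ℕ.+ suc z ℕ.+ 2) (suc z ℕ.* z ℕ.+ 2)) ⟩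
      + ((suc z ℕ.* suc z ℕ.+ suc z ℕ.+ 2) ℕ.* (suc z ℕ.* z ℕ.+ 2)) ∎
      where
      open ≡-Reasoning
      x : ℤ
      x = + suc z
      factor : ∀ z → let x = 1ℤ + z in
        (x * x + + 2) * (x * x + + 2) - (x * x + + 2) + + 2 ≡
        (x * x + x + + 2) * (x * z + + 2)
      factor = solve 1 (λ z → let x = con 1ℤ :+ z in
        (x :* x :+ con (+ 2)) :* (x :* x :+ con (+ 2)) :- (x :* x :+ con (+ 2)) :+ con (+ 2) :=
        (x :* x :+ x :+ con (+ 2)) :* (x :* z :+ con (+ 2))) refl
        where open +-*-Solver

    large : ∀ z → 2 ≤ z → n ≡ suc z ℕ.* suc z ℕ.+ 2 → ⊥
    large z 2≤z eq =
      let A = suc z ℕ.* suc z ℕ.+ suc z ℕ.+ 2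
          B = suc z ℕ.* z ℕ.+ 2
          i , A≡ = size-divisor C A B (split z eq)
          j , B≡ = size-divisor C B A (trans (split z eq) (cong +_ (ℕ.*-comm A B)))
      in ¬powers z 2≤z i j A≡ B≡

    small : ∀ {a} → a < 8 → n ≢ a
    small a<8 refl = ℕ.<⇒≱ a<8 8≤n

    -- n = Y² + 2 is at least 2t = 8, which leaves Y ≥ 3.
    conclude : ∀ Y → n ≡ Y ℕ.* Y ℕ.+ 2 → ⊥
    conclude zero                = small (ℕ.m≤m+n 3 5)
    conclude (suc zero)          = small (ℕ.m≤m+n 4 4)
    conclude (suc (suc zero))    = small (ℕ.m≤m+n 7 1)
    conclude (suc (suc (suc y))) = large (suc (suc y)) (s≤s (s≤s z≤n))

    impossible : ⊥
    impossible = conclude Y n≡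

-- Krawtchouk coefficients

-- kr a b p is the coefficient of zᵖ in (1 - z)ᵃ (1 + z)ᵇ.

kr : ℕ → ℕ → ℕ → ℤ
kr zero    zero    p       = δ₀ p
kr zero    (suc b) zero    = kr zero b zero
kr zero    (suc b) (suc p) = kr zero b (suc p) + kr zero b p
kr (suc a) b       zero    = kr a b zero
kr (suc a) b       (suc p) = kr a b (suc p) - kr a b p

kr-suc-zero : ∀ a b → kr a (suc b) zero ≡ kr a b zero
kr-suc-zero zero    b = refl
kr-suc-zero (suc a) b = kr-suc-zero a b

kr-suc-suc : ∀ a b p → kr a (suc b) (suc p) ≡ kr a b (suc p) + kr a b p
kr-suc-suc zero    b p       = refl
kr-suc-suc (suc a) b zero    =
  trans (cong₂ _-_ (kr-suc-suc a b zero) (kr-suc-zero a b)) (lemma (kr a b 1) (kr a b 0))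
  where
  lemma : ∀ x y → (x + y) - y ≡ (x - y) + y
  lemma = solve-∀
kr-suc-suc (suc a) b (suc p) =
  trans (cong₂ _-_ (kr-suc-suc a b (suc p)) (kr-suc-suc a b p))
        (lemma (kr a b (suc (suc p))) (kr a b (suc p)) (kr a b p))
  where
  lemma : ∀ x y z → (x + y) - (y + z) ≡ (x - y) + (y - z)
  lemma = solve-∀

-- (1 + z)² - (1 - z)² = 4z

kr-Δ : ∀ a b p → kr a (2 ℕ.+ b) (suc p) - kr (2 ℕ.+ a) b (suc p) ≡ (+ 4) * kr a b p
kr-Δ a b zero    = trans
  (cong (_- kr (2 ℕ.+ a) b 1) (trans (kr-suc-suc a (suc b) 0)
    (cong₂ _+_ (kr-suc-suc a b 0) (kr-suc-zero a b))))
  (lemma (kr a b 1) (kr a b 0))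
  where
  lemma : ∀ x y → ((x + y) + y) - ((x - y) - y) ≡ (+ 4) * y
  lemma = solve-∀
kr-Δ a b (suc p) = trans
  (cong (_- kr (2 ℕ.+ a) b (suc (suc p))) (trans (kr-suc-suc a (suc b) (suc p))
    (cong₂ _+_ (kr-suc-suc a b (suc p)) (kr-suc-suc a b p))))
  (lemma (kr a b (suc (suc p))) (kr a b (suc p)) (kr a b p))
  where
  lemma : ∀ x y z → ((x + y) + (y + z)) - ((x - y) - (y - z)) ≡ (+ 4) * y
  lemma = solve-∀

Δ^-cong : ∀ d {ψ₁ ψ₂} → (∀ i k → ψ₁ i k ≡ ψ₂ i k) → Δ^ d at0 ψ₁ ≡ Δ^ d at0 ψ₂
Δ^-cong zero    eq = eq 0 0
Δ^-cong (suc d) eq = Δ^-cong d λ i k → cong₂ _-_ (eq i (suc k)) (eq (suc i) k)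

-- The coefficient of zᵖ in (1 - z²)^e (1 - z)^(2i) (1 + z)^(2k). With e = w - wt x it is the term
-- of a codeword of weight w = n / 2 that misses i points of x and contains k.
krψ : ℕ → ℕ → ℕ → ℕ → ℤ
krψ e p i k = kr (i ℕ.* 2 ℕ.+ e) (k ℕ.* 2 ℕ.+ e) p

-- Each difference replaces (1 + z)² and (1 - z)² by 4z, so the coefficient of z^(d + p) in (4z)^d
-- (1 - z²)^e remains. The scalar c carries the powers of 4 through the induction.
Δ^-kr : ∀ d c e p →
  Δ^ d at0 (λ i k → c * krψ e (d ℕ.+ p) i k) ≡ c * (+ 4) ^ d * kr e e p
Δ^-kr zero    c e p = cong (_* kr e e p) (sym (ℤ.*-identityʳ c))
Δ^-kr (suc d) c e p = begin
  Δ^ d at0 (Δ (λ i k → c * krψ e (suc d ℕ.+ p) i k))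
    ≡⟨ Δ^-cong d (λ i k → trans
         (factor c (krψ e (suc d ℕ.+ p) i (suc k)) (krψ e (suc d ℕ.+ p) (suc i) k))
         (trans (cong (c *_) (kr-Δ (i ℕ.* 2 ℕ.+ e) (k ℕ.* 2 ℕ.+ e) (d ℕ.+ p)))
                (sym (ℤ.*-assoc c (+ 4) (krψ e (d ℕ.+ p) i k))))) ⟩
  Δ^ d at0 (λ i k → c * + 4 * krψ e (d ℕ.+ p) i k)
    ≡⟨ Δ^-kr d (c * + 4) e p ⟩
  c * + 4 * (+ 4) ^ d * kr e e p
    ≡⟨ cong (_* kr e e p) (ℤ.*-assoc c (+ 4) ((+ 4) ^ d)) ⟩
  c * (+ 4) ^ suc d * kr e e p ∎
  where
  open ≡-Reasoning
  factor : ∀ c x y → c * x - c * y ≡ c * (x - y)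
  factor = solve-∀

-- (1 - z)^e (1 + z)^e = (1 - z²)^e, so b is the binomial coefficient of e over q; the induction
-- peels off one factor 1 - z².
kr-diagonal : ∀ e q → ∃ λ b → kr e e (q ℕ.* 2) ≡ -1ℤ ^ q * + b × (q ≤ e → 0 < b)
kr-diagonal zero    zero    = 1 , refl , λ _ → s≤s z≤n
kr-diagonal zero    (suc q) = 0 , sym (ℤ.*-zeroʳ (-1ℤ ^ suc q)) , λ ()
kr-diagonal (suc e) zero    =
  let b , eq , pos = kr-diagonal e zero
  in b , trans (kr-suc-zero e e) eq , λ _ → pos z≤n
kr-diagonal (suc e) (suc q) =
  let b₁ , eq₁ , _ = kr-diagonal e (suc q)
      b₂ , eq₂ , pos = kr-diagonal e q
  in b₁ ℕ.+ b₂ , trans (step (q ℕ.* 2)) (trans (cong₂ _-_ eq₁ eq₂)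
       (lemma (-1ℤ ^ q) (+ b₁) (+ b₂))) ,
     λ { (s≤s q≤e) → ℕ.<-≤-trans (pos q≤e) (ℕ.m≤n+m b₂ b₁) }
  where
  lemma : ∀ s x y → -1ℤ * s * x - s * y ≡ -1ℤ * s * (x + y)
  lemma = solve-∀
  cross : ∀ x y z → (x + y) - (y + z) ≡ x - z
  cross = solve-∀
  step : ∀ p → kr (suc e) (suc e) (suc (suc p)) ≡ kr e e (suc (suc p)) - kr e e p
  step p = trans (cong₂ _-_ (kr-suc-suc e e (suc p)) (kr-suc-suc e e p))
                 (cross (kr e e (suc (suc p))) (kr e e (suc p)) (kr e e p))

kr-diagonal-≢0 : ∀ e q → q ≤ e → kr e e (q ℕ.* 2) ≢ 0ℤ
kr-diagonal-≢0 e q q≤e eq =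
  let b , kr≡ , pos = kr-diagonal e q
  in *-≢0 (^-≢0 { -1ℤ } (λ ()) q) (λ b≡0 → ℕ.<⇒≢ (pos q≤e) (sym (ℤ.+-injective b≡0)))
          (trans (sym kr≡) eq)

-- In the generating function over p, each coordinate contributes 1 + z where x is 0 and 1 - z where
-- x is 1.
∑-shell : ∀ p (x : Word n) →
  ∑ (λ v → ind (wt v ℕ.≟ p) * χ x v) ≡ kr (wt x) (wt (x ⊕ 𝟏)) p
∑-shell zero    [] = refl
∑-shell (suc p) [] = refl
∑-shell {suc n} zero (false ∷ x) = trans
  (cong₂ _+_ (∑-shell zero x) (∑-0 n))
  (trans (ℤ.+-identityʳ (kr (wt x) (wt (x ⊕ 𝟏)) 0)) (sym (kr-suc-zero (wt x) (wt (x ⊕ 𝟏)))))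
∑-shell {suc n} zero (true ∷ x) = trans
  (cong₂ _+_ (trans (∑-cong λ v → cong (ind (wt v ℕ.≟ 0) *_) (ℤ.*-identityˡ (χ x v)))
                    (∑-shell zero x))
             (∑-0 n))
  (ℤ.+-identityʳ (kr (wt x) (wt (x ⊕ 𝟏)) 0))
∑-shell (suc p) (false ∷ x) = trans
  (cong₂ _+_ (∑-shell (suc p) x) (∑-shell p x))
  (sym (kr-suc-suc (wt x) (wt (x ⊕ 𝟏)) p))
∑-shell (suc p) (true ∷ x) = cong₂ _+_
  (trans (∑-cong λ v → cong (ind (wt v ℕ.≟ suc p) *_) (ℤ.*-identityˡ (χ x v)))
         (∑-shell (suc p) x))
  (trans (∑-cong λ v → neg (ind (wt v ℕ.≟ p)) (χ x v))
    (trans (∑-*ˡ -1ℤ (λ v → ind (wt v ℕ.≟ p) * χ x v))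
      (trans (cong (-1ℤ *_) (∑-shell p x)) (ℤ.-1*i≡-i (kr (wt x) (wt (x ⊕ 𝟏)) p)))))
  where
  neg : ∀ a b → a * (-1ℤ * b) ≡ -1ℤ * (a * b)
  neg = solve-∀

-- Overlap of two words, and Poisson summation

record Overlap (x c : Word n) : Set where
  field
    -- The sizes of x∖c, x∩c, c∖x and the complement of the union.
    i k l m  : ℕ
    wt-x     : wt x ≡ i ℕ.+ k
    wt-c     : wt c ≡ k ℕ.+ l
    wt-c′    : wt (c ⊕ 𝟏) ≡ i ℕ.+ m
    wt-⊕     : wt (x ⊕ c) ≡ i ℕ.+ l
    wt-⊕′    : wt ((x ⊕ c) ⊕ 𝟏) ≡ k ℕ.+ m
    prof-val : ∀ ψ → prof ψ x c ≡ ψ i k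

overlapOf : (x c : Word n) → Overlap x c
overlapOf []          []          = record
  { i = 0 ; k = 0 ; l = 0 ; m = 0 ; wt-x = refl ; wt-c = refl ; wt-c′ = refl
  ; wt-⊕ = refl ; wt-⊕′ = refl ; prof-val = λ _ → refl }
overlapOf (false ∷ x) (false ∷ c) = record
  { i = i ; k = k ; l = l ; m = suc m ; wt-x = wt-x ; wt-c = wt-c
  ; wt-c′ = trans (cong suc wt-c′) (sym (ℕ.+-suc i m)) ; wt-⊕ = wt-⊕
  ; wt-⊕′ = trans (cong suc wt-⊕′) (sym (ℕ.+-suc k m)) ; prof-val = prof-val }
  where open Overlap (overlapOf x c)
overlapOf (false ∷ x) (true ∷ c)  = record
  { i = i ; k = k ; l = suc l ; m = m ; wt-x = wt-x
  ; wt-c = trans (cong suc wt-c) (sym (ℕ.+-suc k l)) ; wt-c′ = wt-c′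
  ; wt-⊕ = trans (cong suc wt-⊕) (sym (ℕ.+-suc i l)) ; wt-⊕′ = wt-⊕′
  ; prof-val = prof-val }
  where open Overlap (overlapOf x c)
overlapOf (true ∷ x)  (false ∷ c) = record
  { i = suc i ; k = k ; l = l ; m = m ; wt-x = cong suc wt-x ; wt-c = wt-c
  ; wt-c′ = cong suc wt-c′ ; wt-⊕ = cong suc wt-⊕ ; wt-⊕′ = wt-⊕′
  ; prof-val = λ ψ → prof-val (λ i k → ψ (suc i) k) }
  where open Overlap (overlapOf x c)
overlapOf (true ∷ x)  (true ∷ c)  = record
  { i = i ; k = suc k ; l = l ; m = m ; wt-x = trans (cong suc wt-x) (sym (ℕ.+-suc i k))
  ; wt-c = cong suc wt-c ; wt-c′ = wt-c′ ; wt-⊕ = wt-⊕ ; wt-⊕′ = cong suc wt-⊕′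
  ; prof-val = λ ψ → prof-val (λ i k → ψ i (suc k)) }
  where open Overlap (overlapOf x c)

-- Poisson summation for the shell of weight p.

dual-layer : (C : LinearCode n) → ∀ p x →
  size C * transform sgn (layer (C ^⊥) p) x ≡
  ∑ (λ c → 𝟙 C c * kr (wt (x ⊕ c)) (wt ((x ⊕ c) ⊕ 𝟏)) p)
dual-layer {n} C p x = begin
  size C * transform sgn (layer (C ^⊥) p) x
    ≡⟨ sym (∑-*ˡ (size C) (λ v → layer (C ^⊥) p v * χ x v)) ⟩
  ∑ (λ v → size C * (layer (C ^⊥) p v * χ x v))
    ≡⟨ ∑-cong (λ v → trans (regroup (size C) (𝟙 (C ^⊥) v) (I v) (χ x v))
         (cong (I v * χ x v *_) (sym (orthogonality C v)))) ⟩
  ∑ (λ v → I v * χ x v * transform sgn (𝟙 C) v)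
    ≡⟨ ∑-cong (λ v → trans (sym (∑-*ˡ (I v * χ x v) (λ c → 𝟙 C c * χ v c)))
         (∑-cong λ c → trans (exch (I v) (χ x v) (𝟙 C c) (χ v c))
           (cong (λ z → 𝟙 C c * (I v * z))
             (trans (cong (χ x v *_) (χ-comm v c)) (sym (χ-⊕ x c v)))))) ⟩
  ∑ (λ v → ∑ (λ c → 𝟙 C c * (I v * χ (x ⊕ c) v)))
    ≡⟨ ∑-swap (λ v c → 𝟙 C c * (I v * χ (x ⊕ c) v)) ⟩
  ∑ (λ c → ∑ (λ v → 𝟙 C c * (I v * χ (x ⊕ c) v)))
    ≡⟨ ∑-cong (λ c → trans (∑-*ˡ (𝟙 C c) (λ v → I v * χ (x ⊕ c) v))
         (cong (𝟙 C c *_) (∑-shell p (x ⊕ c)))) ⟩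
  ∑ (λ c → 𝟙 C c * kr (wt (x ⊕ c)) (wt ((x ⊕ c) ⊕ 𝟏)) p) ∎
  where
  open ≡-Reasoning
  I : Word n → ℤ
  I v = ind (wt v ℕ.≟ p)
  regroup : ∀ s a i x → s * (a * i * x) ≡ i * x * (s * a)
  regroup = solve-∀
  exch : ∀ i x a y → i * x * (a * y) ≡ a * (i * (x * y))
  exch = solve-∀

-- One inner weight: the strengths of C and of its dual

odd≢even : ∀ k q → suc (k ℕ.+ k) ≢ q ℕ.+ q
odd≢even zero    (suc q) eq =
  ℕ.1+n≢0 (sym (trans (ℕ.suc-injective eq) (ℕ.+-suc q q)))
odd≢even (suc k) (suc q) eq = odd≢even k q (ℕ.suc-injective
  (trans (trans (cong suc (sym (ℕ.+-suc k k))) (ℕ.suc-injective eq)) (ℕ.+-suc q q)))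

module OneWeight {n} (F : FewWeights n) {w : ℕ} (ws≡ : FewWeights.ws F ≡ w ∷ []) where
  open FewWeights F
  open Ends F

  D≡1+t : D ≡ suc t
  D≡1+t = trans D≡ (trans (cong (λ us → t ℕ.+ length us) ws≡) (ℕ.+-comm t 1))

  w∈ : w ∈ ws
  w∈ = subst (w ∈_) (sym ws≡) (here refl)

  only-w : ∀ {u} → u ∈ ws → u ≡ w
  only-w u∈ with subst (_ ∈_) ws≡ u∈
  ... | here eq = eq

  0<w : 0 < w
  0<w = proj₁ (proj₂ (sound w∈))

  w<n : w < n
  w<n = inner<n w∈

  w+w≡n : w ℕ.+ w ≡ n
  w+w≡n = trans (cong (w ℕ.+_) (sym (only-w (compl∈ws w∈)))) (ℕ.m+[n∸m]≡n (ℕ.<⇒≤ w<n))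

  t≤n : t ≤ n
  t≤n = ℕ.≤-trans (ℕ.m≤m+n t t) 2t≤n

  t≤3 : t ≤ 3
  t≤3 = subst (λ us → t ≤ 2 ℕ.+ length us) ws≡ t≤2+ws

  t-cases : t ≡ 1 ⊎ t ≡ 3
  t-cases = odd t 0<t t≤3 (proj₁ D-even) (trans (sym D≡1+t) (proj₂ D-even))
    where
    odd : ∀ t → 0 < t → t ≤ 3 → ∀ q → suc t ≡ q ℕ.+ q → t ≡ 1 ⊎ t ≡ 3
    odd 1 _ _ _ _ = inj₁ refl
    odd 3 _ _ _ _ = inj₂ refl
    odd 2 _ _ q eq = ⊥-elim (odd≢even 1 q eq)
    odd (suc (suc (suc (suc _)))) _ (s≤s (s≤s (s≤s ())))

  L : Word n → ℤ
  L = layer C w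

  ends-and-layer : (f : Word n → ℤ) →
    ∑ (λ v → 𝟙 C v * f v) ≡ (f 𝟎 + f 𝟏) + ∑ (λ v → L v * f v)
  ends-and-layer f = begin
    ∑ (λ v → 𝟙 C v * f v)
      ≡⟨ ∑-cong (λ v → split (𝟙 C v) (f v) (ind (wt v ℕ.≟ w))) ⟩
    ∑ (λ v → 𝟙 C v * f′ v + L v * f v)
      ≡⟨ ∑-+ (λ v → 𝟙 C v * f′ v) (λ v → L v * f v) ⟩
    ∑ (λ v → 𝟙 C v * f′ v) + ∑ (λ v → L v * f v)
      ≡⟨ cong (λ z → z + ∑ (λ v → L v * f v)) (trans (ends f′ inner)
           (cong₂ _+_ (end 𝟎 λ eq → ℕ.<⇒≢ 0<w (trans (sym (wt-𝟎 n)) eq))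
                      (end 𝟏 λ eq → ℕ.<⇒≢ w<n (trans (sym eq) (wt-𝟏 n))))) ⟩
    (f 𝟎 + f 𝟏) + ∑ (λ v → L v * f v) ∎
    where
    open ≡-Reasoning
    f′ : Word n → ℤ
    f′ v = f v * (1ℤ - ind (wt v ℕ.≟ w))
    split : ∀ a x i → a * x ≡ a * (x * (1ℤ - i)) + a * i * x
    split = solve-∀
    inner : ∀ v → Codeword C v → wt v ∈ ws → f′ v ≡ 0ℤ
    inner v _ v∈ = trans (cong (λ z → f v * (1ℤ - z)) (ind-yes (wt v ℕ.≟ w) (only-w v∈)))
      (ℤ.*-zeroʳ (f v))
    end : ∀ v → wt v ≢ w → f′ v ≡ f v
    end v v≢w = trans (cong (λ z → f v * (1ℤ - z)) (ind-no (wt v ℕ.≟ w) v≢w))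
      (ℤ.*-identityʳ (f v))

  -- By `base` the whole of C gives size C at weight 0 and nothing elsewhere; taking away `𝟎` and
  -- `𝟏` leaves the layer.
  transform-L : ∀ x → wt x < D →
    transform sgn L x ≡ size C * δ₀ (wt x) - (1ℤ + -1ℤ ^ wt x)
  transform-L x x<D = trans (solve-for (transform sgn L x) (χ x 𝟎 + χ x 𝟏))
    (cong₂ _-_ (trans (sym (ends-and-layer (χ x))) (base x x<D))
      (cong₂ _+_ (χ-weightless x 𝟎 (wt-𝟎 n)) (χ-full x 𝟏 (wt-𝟏 n))))
    where
    solve-for : ∀ a b → a ≡ (b + a) - b
    solve-for = solve-∀

  L-sgn : Invariant D (transform sgn L)
  L-sgn S T S≈T S<D = trans (transform-L S S<D)
    (trans (cong (λ j → size C * δ₀ j - (1ℤ + -1ℤ ^ j)) S≈T)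
           (sym (transform-L T (subst (_< D) S≈T S<D))))

  design : SupportDesign C w t
  design = invariant⇒design C (t≤w w∈) t≤n
    (subst (λ d → Invariant d (transform incl L)) D≡1+t
      (transform-invariant sgn incl L sgn≢ L-sgn))

  codeword-w : Occurs C w
  codeword-w = proj₁ (sound w∈)

  dual-word : ∃ λ y → Codeword (C ^⊥) y × y ≢ 𝟎 × wt y ≡ D
  dual-word = proj₁ dual

  -- If D = n, the minimal dual word is `𝟏`. Then n = t + 1 and 2t ≤ n force w = 1, and a word of
  -- weight 1 is not orthogonal to `𝟏`.
  D<n : D < n
  D<n = ℕ.≤∧≢⇒< (subst (_≤ n) (proj₂ (proj₂ (proj₂ dual-word))) (wt≤n (proj₁ dual-word))) λ D≡n →
    contra D≡n
    where
    contra : D ≡ n → ⊥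
    contra D≡n with dual-word | codeword-w
    ... | y , y∈ , _ , y≡D | c , c∈ , c≡w =
      1≢-1 (trans (sym (χ-dual C c∈ y∈))
        (trans (χ-full c y (trans y≡D D≡n)) (cong (-1ℤ ^_) (trans c≡w w≡1))))
      where
      1≢-1 : 1ℤ ≢ -1ℤ
      1≢-1 ()
      t≤1 : t ≤ 1
      t≤1 = ℕ.+-cancelʳ-≤ t t 1 (subst (t ℕ.+ t ≤_) (trans (sym D≡n) D≡1+t) 2t≤n)
      n≤2 : w ℕ.+ w ≤ 2
      n≤2 = subst (_≤ 2) (trans (sym D≡1+t) (trans D≡n (sym w+w≡n))) (s≤s t≤1)
      w≡1 : w ≡ 1
      w≡1 = ℕ.≤-antisym (ℕ.≮⇒≥ λ 1<w → ℕ.<⇒≱ (ℕ.+-mono-<-≤ 1<w 0<w) n≤2) 0<w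

  -- A word of weight D in the dual code is orthogonal to the whole layer, so if
  -- transform sgn L were constant at level D, then every word of weight D would be.

  ¬constant : ¬ (∀ S T → wt S ≡ D → wt T ≡ D → transform sgn L S ≡ transform sgn L T)
  ¬constant const with dual-word | codeword-w
  ... | y , y∈ , _ , y≡D | c , c∈ , c≡w =
    case (orthogonal-layer c (subst (0 <_) (sym D≡1+t) (s≤s z≤n)) D<n orth)
    where
    case : wt c ≡ 0 ⊎ wt c ≡ n → ⊥
    case (inj₁ c≡0) = ℕ.<⇒≢ 0<w (trans (sym c≡0) c≡w)
    case (inj₂ c≡n) = ℕ.<⇒≢ w<n (trans (sym c≡w) c≡n)

    at-y : transform sgn L y ≡ ∑ L
    at-y = ∑-cong term
      where
      term : ∀ v → L v * χ y v ≡ L v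
      term v with LinearCode.∈? C v
      ... | no _   = refl
      ... | yes v∈ = trans (cong (1ℤ * ind (wt v ℕ.≟ w) *_)
        (trans (χ-comm y v) (χ-dual C v∈ y∈))) (ℤ.*-identityʳ (1ℤ * ind (wt v ℕ.≟ w)))

    orth : ∀ x → wt x ≡ D → χ x c ≡ 1ℤ
    orth x x≡D = sym (x-y≡0⇒x≡y (trans (sym (trans (cong (_* (1ℤ - χ x c)) (layer-∈ C c∈ c≡w))
        (ℤ.*-identityˡ (1ℤ - χ x c))))
      (∑≡0⇒0 {f = h} (λ v → *-nonneg (0≤layer C w v) (0≤1-χ v)) sum≡0 c)))
      where
      h : Word n → ℤ
      h v = L v * (1ℤ - χ x v)
      0≤1-χ : ∀ v → 0ℤ ℤ.≤ 1ℤ - χ x v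
      0≤1-χ v with χ x v | ∣χ∣≤1 x v
      ... | _ | inj₁ refl = ℤ.+≤+ z≤n
      ... | _ | inj₂ refl = ℤ.+≤+ z≤n
      expand : ∀ a b → a * (1ℤ - b) ≡ a + -1ℤ * (a * b)
      expand = solve-∀
      cancel : ∀ a → a + -1ℤ * a ≡ 0ℤ
      cancel = solve-∀
      sum≡0 : ∑ h ≡ 0ℤ
      sum≡0 = begin
        ∑ h
          ≡⟨ ∑-cong (λ v → expand (L v) (χ x v)) ⟩
        ∑ (λ v → L v + -1ℤ * (L v * χ x v))
          ≡⟨ ∑-+ L (λ v → -1ℤ * (L v * χ x v)) ⟩
        ∑ L + ∑ (λ v → -1ℤ * (L v * χ x v))
          ≡⟨ cong (λ z → ∑ L + z) (∑-*ˡ -1ℤ (λ v → L v * χ x v)) ⟩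
        ∑ L + -1ℤ * transform sgn L x
          ≡⟨ cong (λ z → ∑ L + -1ℤ * z) (trans (const x y x≡D y≡D) at-y) ⟩
        ∑ L + -1ℤ * ∑ L
          ≡⟨ cancel (∑ L) ⟩
        0ℤ ∎
        where open ≡-Reasoning

  -- Strength above t would make the transform of the layer constant at level D = t + 1.
  design-max : ∀ t′ → SupportDesign C w t′ → t′ ≤ t
  design-max t′ des = ℕ.≮⇒≥ λ t<t′ → ¬constant λ S T S≡D T≡D →
    transform-invariant incl sgn L incl≢ (design⇒invariant C des) S T (trans S≡D (sym T≡D))
      (subst (_< suc t′) (sym (trans S≡D D≡1+t)) (s≤s t<t′))

  δC : δ C ≐ t
  δC = (λ w′ 0<w′ w′<n occ →
         subst (λ u → SupportDesign C u t) (sym (only-w (inner∈ws occ 0<w′ w′<n))) design) ,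
       (λ t′ des → design-max t′ (des w 0<w w<n codeword-w))

  sC : s C ≐ t
  sC = (w , 0<w , w<n , codeword-w , design) ,
       λ { t′ (w′ , 0<w′ , w′<n , occ , des) → design-max t′
         (subst (λ u → SupportDesign C u t′) (only-w (inner∈ws occ 0<w′ w′<n)) des) }

  -- If wt c = w = n / 2, then x ⊕ c has 2i + e ones and 2k + e zeros, so its Krawtchouk term is a
  -- profile of x and c. The terms of `𝟎` and `𝟏` depend on wt x alone.
  dual-layer-formula : ∀ e p x → e ℕ.+ wt x ≡ w →
    size C * transform sgn (layer (C ^⊥) p) x ≡
    (kr (wt x) (n ℕ.∸ wt x) p + kr (n ℕ.∸ wt x) (wt x) p) +
    ∑ (λ c → L c * prof (krψ e p) x c)
  dual-layer-formula e p x e+x≡w = begin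
    size C * transform sgn (layer (C ^⊥) p) x
      ≡⟨ dual-layer C p x ⟩
    ∑ (λ c → 𝟙 C c * K c)
      ≡⟨ ends-and-layer K ⟩
    (K 𝟎 + K 𝟏) + ∑ (λ c → L c * K c)
      ≡⟨ cong₂ _+_ (cong₂ _+_ K𝟎 K𝟏) (∑-cong layer-term) ⟩
    (kr (wt x) (n ℕ.∸ wt x) p + kr (n ℕ.∸ wt x) (wt x) p) +
    ∑ (λ c → L c * prof (krψ e p) x c) ∎
    where
    open ≡-Reasoning
    K : Word n → ℤ
    K c = kr (wt (x ⊕ c)) (wt ((x ⊕ c) ⊕ 𝟏)) p

    ⊕-𝟎 : ∀ {n} (x : Word n) → x ⊕ 𝟎 ≡ x
    ⊕-𝟎 []          = refl
    ⊕-𝟎 (false ∷ x) = cong (false ∷_) (⊕-𝟎 x)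
    ⊕-𝟎 (true ∷ x)  = cong (true ∷_) (⊕-𝟎 x)

    wt-x⊕𝟏 : wt (x ⊕ 𝟏) ≡ n ℕ.∸ wt x
    wt-x⊕𝟏 = ℕ.+-cancelˡ-≡ (wt x) _ _ (trans (wt-compl x) (sym (ℕ.m+[n∸m]≡n (wt≤n x))))

    K𝟎 : K 𝟎 ≡ kr (wt x) (n ℕ.∸ wt x) p
    K𝟎 = trans (cong (λ z → kr (wt z) (wt (z ⊕ 𝟏)) p) (⊕-𝟎 x))
               (cong (λ b → kr (wt x) b p) wt-x⊕𝟏)
    K𝟏 : K 𝟏 ≡ kr (n ℕ.∸ wt x) (wt x) p
    K𝟏 = cong₂ (λ a b → kr a b p) wt-x⊕𝟏 (cong wt (⊕-cancel x 𝟏))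

    layer-term : ∀ c → L c * K c ≡ L c * prof (krψ e p) x c
    layer-term c with wt c ℕ.≟ w
    ... | no c≢w  = trans (cong (_* K c) (layer-supported C w c c≢w))
      (sym (cong (_* prof (krψ e p) x c) (layer-supported C w c c≢w)))
    ... | yes c≡w = cong (L c *_) (trans
      (cong₂ (λ a b → kr a b p)
        (trans wt-⊕ (trans (cong (i ℕ.+_) l≡e+i) (twice i)))
        (trans wt-⊕′ (trans (cong (k ℕ.+_) m≡e+k) (twice k))))
      (sym (prof-val (krψ e p))))
      where
      open Overlap (overlapOf x c)
      w≡ : w ≡ e ℕ.+ (i ℕ.+ k)
      w≡ = trans (sym e+x≡w) (cong (e ℕ.+_) wt-x)
      l≡e+i : l ≡ e ℕ.+ i
      l≡e+i = ℕ.+-cancelˡ-≡ k l (e ℕ.+ i) (trans (sym wt-c) (trans c≡w (trans w≡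
        (trans (sym (ℕ.+-assoc e i k)) (ℕ.+-comm (e ℕ.+ i) k)))))
      c′≡w : wt (c ⊕ 𝟏) ≡ w
      c′≡w = ℕ.+-cancelˡ-≡ (wt c) (wt (c ⊕ 𝟏)) w
        (trans (wt-compl c) (trans (sym w+w≡n) (cong (ℕ._+ w) (sym c≡w))))
      m≡e+k : m ≡ e ℕ.+ k
      m≡e+k = ℕ.+-cancelˡ-≡ i m (e ℕ.+ k) (trans (sym wt-c′) (trans c′≡w (trans w≡
        (trans (sym (ℕ.+-assoc e i k))
        (trans (cong (ℕ._+ k) (ℕ.+-comm e i)) (ℕ.+-assoc i e k))))))
      twice : ∀ i → i ℕ.+ (e ℕ.+ i) ≡ i ℕ.* 2 ℕ.+ e
      twice i = solve 2 (λ i e → i :+ (e :+ i) := i :* con 2 :+ e) refl i e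
        where open Data.Nat.Solver.+-*-Solver

  dual-sgn : ∀ p → Invariant D (transform sgn (layer (C ^⊥) p))
  dual-sgn p S T S≈T S<D = *-cancelˡ (size≢0 C) (trans
    (dual-layer-formula e p S e+S≡w)
    (trans (cong₂ _+_ (cong (λ j → kr j (n ℕ.∸ j) p + kr (n ℕ.∸ j) j p) S≈T)
                      (prof-invariant sgn L sgn≢ L-sgn (krψ e p) S T S≈T S<D))
           (sym (dual-layer-formula e p T (trans (cong (e ℕ.+_) (sym S≈T)) e+S≡w)))))
    where
    e : ℕ
    e = w ℕ.∸ wt S
    e+S≡w : e ℕ.+ wt S ≡ w
    e+S≡w = ℕ.m∸n+n≡m (ℕ.≤-trans (ℕ.s≤s⁻¹ (subst (wt S <_) D≡1+t S<D)) (t≤w w∈))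

  dual-min : ∀ {p} → 0 < p → Occurs (C ^⊥) p → D ≤ p
  dual-min 0<p (v , v∈ , refl) = proj₂ dual v v∈ λ v≡𝟎 →
    ℕ.<⇒≢ 0<p (sym (trans (cong wt v≡𝟎) (wt-𝟎 n)))

  dual-design : ∀ p → 0 < p → p < n → Occurs (C ^⊥) p → SupportDesign (C ^⊥) p t
  dual-design p 0<p p<n occ = invariant⇒design (C ^⊥)
    (ℕ.≤-trans (ℕ.n≤1+n t) (subst (_≤ p) D≡1+t (dual-min 0<p occ))) t≤n
    (subst (λ d → Invariant d (transform incl (layer (C ^⊥) p))) D≡1+t
      (transform-invariant sgn incl (layer (C ^⊥) p) sgn≢ (dual-sgn p)))

  -- Constancy of the dual layer at level D equates the profile sums over L, and
  -- `transfer-difference` turns this into constancy of the transform of L. The top coefficient is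
  -- 4^D times that of z^(2q) in (1 - z²)^e, nonzero for q ≤ e; the bound on D + 2q + D gives this,
  -- as n = 2 (e + D).
  dual-design-max′ : D ≤ w → ∀ q → D ℕ.+ q ℕ.* 2 ℕ.+ D ≤ n →
    ∀ t′ → SupportDesign (C ^⊥) (D ℕ.+ q ℕ.* 2) t′ → t′ ≤ t
  dual-design-max′ D≤w q p+D≤n t′ des = ℕ.≮⇒≥ λ t<t′ → ¬constant λ S T S≡D T≡D →
    let S≈T = trans S≡D (sym T≡D)
        e+S = trans (cong (e ℕ.+_) S≡D) e+D≡w
        e+T = trans (cong (e ℕ.+_) T≡D) e+D≡w
        equal = transform-invariant incl sgn (layer (C ^⊥) p) incl≢
                  (design⇒invariant (C ^⊥) des) S T S≈T
                  (subst (_< suc t′) (sym (trans S≡D D≡1+t)) (s≤s t<t′))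
        sums = same-sum S T S≈T (trans (sym (dual-layer-formula e p S e+S))
                 (trans (cong (size C *_) equal) (dual-layer-formula e p T e+T)))
    in x-y≡0⇒x≡y (*-cancelˡ (Δ≢0 (wt S) S≡D)
         (trans (sym (transfer-difference sgn L (krψ e p) S T S≈T
                   (subst (λ d → Invariant d (transform sgn L)) (sym S≡D) L-sgn)))
           (trans (cong ((sgn true - sgn false) ^ wt S *_) (ℤ.i≡j⇒i-j≡0 sums))
             (trans (ℤ.*-zeroʳ ((sgn true - sgn false) ^ wt S))
                    (sym (ℤ.*-zeroʳ (Δ^ wt S at0 (krψ e p))))))))
    where
    p e : ℕ
    p = D ℕ.+ q ℕ.* 2
    e = w ℕ.∸ D
    e+D≡w : e ℕ.+ D ≡ w
    e+D≡w = ℕ.m∸n+n≡m D≤w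

    +-cancelˡ : ∀ a {x y} → a + x ≡ a + y → x ≡ y
    +-cancelˡ a {x} {y} eq = +-cancelʳ a (trans (ℤ.+-comm x a) (trans eq (ℤ.+-comm a y)))

    same-sum : ∀ S T → wt S ≡ wt T →
      (kr (wt S) (n ℕ.∸ wt S) p + kr (n ℕ.∸ wt S) (wt S) p) +
        ∑ (λ c → L c * prof (krψ e p) S c) ≡
      (kr (wt T) (n ℕ.∸ wt T) p + kr (n ℕ.∸ wt T) (wt T) p) +
        ∑ (λ c → L c * prof (krψ e p) T c) →
      ∑ (λ c → L c * prof (krψ e p) S c) ≡ ∑ (λ c → L c * prof (krψ e p) T c)
    same-sum S T S≈T eq = +-cancelˡ (E (wt S))
      (trans eq (cong (λ j → E j + ∑ (λ c → L c * prof (krψ e p) T c)) (sym S≈T)))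
      where
      E : ℕ → ℤ
      E j = kr j (n ℕ.∸ j) p + kr (n ℕ.∸ j) j p

    q≤e : q ≤ e
    q≤e = ℕ.*-cancelʳ-≤ q e 2 (ℕ.+-cancelˡ-≤ (D ℕ.+ D) (q ℕ.* 2) (e ℕ.* 2)
      (subst₂ _≤_ (rearrange₁ D q) (trans
        (trans (sym w+w≡n) (cong₂ ℕ._+_ (sym e+D≡w) (sym e+D≡w)))
                                      (rearrange₂ D e)) p+D≤n))
      where
      open Data.Nat.Solver.+-*-Solver
      rearrange₁ : ∀ D q → D ℕ.+ q ℕ.* 2 ℕ.+ D ≡ D ℕ.+ D ℕ.+ q ℕ.* 2
      rearrange₁ = solve 2 (λ D q → D :+ q :* con 2 :+ D := D :+ D :+ q :* con 2) refl
      rearrange₂ : ∀ D e → (e ℕ.+ D) ℕ.+ (e ℕ.+ D) ≡ D ℕ.+ D ℕ.+ e ℕ.* 2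
      rearrange₂ = solve 2 (λ D e → (e :+ D) :+ (e :+ D) := D :+ D :+ e :* con 2) refl

    Δ≢0 : ∀ d → d ≡ D → Δ^ d at0 (krψ e p) ≢ 0ℤ
    Δ≢0 d refl eq = *-≢0 {1ℤ * (+ 4) ^ D} (*-≢0 {1ℤ} (λ ()) (^-≢0 {+ 4} (λ ()) D))
      (kr-diagonal-≢0 e q q≤e)
      (trans (sym (Δ^-kr D 1ℤ e (q ℕ.* 2)))
        (trans (Δ^-cong D λ i k → ℤ.*-identityˡ (krψ e p i k)) eq))

  even-sgn : ∀ r → -1ℤ ^ (r ℕ.+ r) ≡ 1ℤ
  even-sgn zero    = refl
  even-sgn (suc r) = trans (cong (λ k → -1ℤ ^ suc k) (ℕ.+-suc r r))
    (trans (double-neg (-1ℤ ^ (r ℕ.+ r))) (even-sgn r))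
    where
    double-neg : ∀ a → -1ℤ * (-1ℤ * a) ≡ a
    double-neg = solve-∀

  -- The second moment with both roots 0: inner words have balance 0, so ∣C∣ n = 2n².
  size≡4w : 2 < D → size C ≡ + (w ℕ.* 4)
  size≡4w 2<D = *-cancelˡ {+ n} (λ eq → ℕ.<⇒≢ 0<n (sym (ℤ.+-injective eq))) (begin
    + n * size C
      ≡⟨ swap (+ n) (size C) ⟩
    size C * (+ n - 0ℤ * 0ℤ)
      ≡⟨ cong (size C *_) (sym (mom-2 (+ n) 0ℤ)) ⟩
    size C * mom (+ n) (0ℤ ∷ - 0ℤ ∷ []) 0
      ≡⟨ sym (mean (𝟙 C) (size C) D base (0ℤ ∷ - 0ℤ ∷ []) 2<D) ⟩
    ∑ (λ v → 𝟙 C v * f v)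
      ≡⟨ ends f (λ v _ v∈ → roots-∈ {0ℤ ∷ - 0ℤ ∷ []} (here (bal≡0 v (only-w v∈)))) ⟩
    f 𝟎 + f 𝟏
      ≡⟨ cong₂ (λ a b → roots (0ℤ ∷ - 0ℤ ∷ []) a + roots (0ℤ ∷ - 0ℤ ∷ []) b)
           (bal-𝟎 n) (bal-𝟏 n) ⟩
    roots (0ℤ ∷ - 0ℤ ∷ []) (+ n) + roots (0ℤ ∷ - 0ℤ ∷ []) (- + n)
      ≡⟨ expand (+ n) ⟩
    + n * (+ n + + n)
      ≡⟨ cong (λ m → + n * (+ m + + m)) (sym w+w≡n) ⟩
    + n * + ((w ℕ.+ w) ℕ.+ (w ℕ.+ w))
      ≡⟨ cong (λ m → + n * + m) (quadruple w) ⟩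
    + n * + (w ℕ.* 4) ∎)
    where
    open ≡-Reasoning
    f : Word n → ℤ
    f v = roots (0ℤ ∷ - 0ℤ ∷ []) (bal v)
    swap : ∀ n a → n * a ≡ a * (n - 0ℤ * 0ℤ)
    swap = solve-∀
    expand : ∀ n → (n - 0ℤ) * ((n - - 0ℤ) * 1ℤ) + (- n - 0ℤ) * ((- n - - 0ℤ) * 1ℤ) ≡
                   n * (n + n)
    expand = solve-∀
    quadruple : ∀ w → (w ℕ.+ w) ℕ.+ (w ℕ.+ w) ≡ w ℕ.* 4
    quadruple = solve 1 (λ w → (w :+ w) :+ (w :+ w) := w :* con 4) refl
      where open Data.Nat.Solver.+-*-Solver
    bal≡0 : ∀ v → wt v ≡ w → bal v ≡ 0ℤ
    bal≡0 v v≡w = trans (bal-wt v) (trans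
      (cong₂ (λ a b → + a - (+ 2) * + b) (sym w+w≡n) v≡w) (lemma (+ w)))
      where
      lemma : ∀ w → (w + w) - (+ 2) * w ≡ 0ℤ
      lemma = solve-∀

  -- For t = 3 the weight w is a power of two, since ∣C∣ = 4w.

  w-large : t ≡ 3 → 4 ≤ w × ∃ λ r → w ≡ r ℕ.+ r
  w-large t≡3 =
    let k , w≡ = size-divisor C w 4 (size≡4w (subst (2 <_) (sym D≡4) (s≤s (s≤s (s≤s z≤n)))))
        4≤2^k , r , eq = power k (subst (3 ≤_) w≡ (subst (_≤ w) t≡3 (t≤w w∈)))
    in subst (4 ≤_) (sym w≡) 4≤2^k , r , trans w≡ eq
    where
    D≡4 : D ≡ 4
    D≡4 = trans D≡1+t (cong suc t≡3)
    power : ∀ k → 3 ≤ 2 ℕ.^ k → 4 ≤ 2 ℕ.^ k × ∃ λ r → 2 ℕ.^ k ≡ r ℕ.+ r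
    power zero          (s≤s ())
    power (suc zero)    (s≤s (s≤s ()))
    power (suc (suc k)) _ = ℕ.^-monoʳ-≤ 2 {2} {2 ℕ.+ k} (s≤s (s≤s z≤n)) ,
      2 ℕ.^ suc k , cong (2 ℕ.^ suc k ℕ.+_) (ℕ.+-identityʳ (2 ℕ.^ suc k))

  -- Allows `dual-layer-formula` to be applied to words of weight D, with e = w - D.
  D≤w : D ≤ w
  D≤w with t-cases
  ... | inj₂ t≡3 = subst (_≤ w) (sym (trans D≡1+t (cong suc t≡3))) (proj₁ (w-large t≡3))
  ... | inj₁ t≡1 = subst (_≤ w) (sym D≡2) (ℕ.≰⇒> λ w≤1 →
    ℕ.<⇒≱ (subst₂ _<_ D≡2 (sym w+w≡n) D<n) (ℕ.+-mono-≤ w≤1 w≤1))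
    where
    D≡2 : D ≡ 2
    D≡2 = trans D≡1+t (cong suc t≡1)

  𝟏∈dual : t ≡ 3 → Codeword (C ^⊥) 𝟏
  𝟏∈dual t≡3 c c∈ = bit ⟨ c , 𝟏 ⟩ (trans (sym (χ-⟨⟩ c 𝟏))
    (trans (χ-full c 𝟏 (wt-𝟏 n)) (even (trichotomy c∈))))
    where
    bit : ∀ b → sgn b ≡ 1ℤ → b ≡ false
    bit false _ = refl
    even : wt c ≡ 0 ⊎ wt c ≡ n ⊎ wt c ∈ ws → -1ℤ ^ wt c ≡ 1ℤ
    even (inj₁ c≡0)        = cong (-1ℤ ^_) c≡0
    even (inj₂ (inj₁ c≡n)) = trans (cong (-1ℤ ^_) (trans c≡n (sym w+w≡n))) (even-sgn w)
    even (inj₂ (inj₂ c∈w)) = let r , w≡ = proj₂ (w-large t≡3)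
      in trans (cong (-1ℤ ^_) (trans (only-w c∈w) w≡)) (even-sgn r)

  -- For t = 1, p and n = 2w are even, so p ≤ n - 2. For t = 3 all weights of C are even, so the
  -- complement stays in the dual code and has weight at least D.
  dual-upper : ∀ {p} → p < n → Occurs (C ^⊥) p → p ℕ.+ D ≤ n
  dual-upper {p} p<n (v , v∈ , v≡p) with t-cases
  ... | inj₁ t≡1 = subst₂ _≤_ (cong (p ℕ.+_) (sym (trans D≡1+t (cong suc t≡1)))) w+w≡n
    (bound (dual-even v∈))
    where
    bound : (∃ λ a → wt v ≡ a ℕ.+ a) → p ℕ.+ 2 ≤ w ℕ.+ w
    bound (a , v≡) = subst (_≤ w ℕ.+ w)
      (trans (double a) (cong (ℕ._+ 2) (sym p≡)))
      (ℕ.+-mono-≤ a<w a<w)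
      where
      p≡ : p ≡ a ℕ.+ a
      p≡ = trans (sym v≡p) v≡
      a<w : a < w
      a<w = ℕ.≰⇒> λ w≤a → ℕ.<⇒≱ p<n (subst₂ _≤_ w+w≡n (sym p≡) (ℕ.+-mono-≤ w≤a w≤a))
      double : ∀ a → suc a ℕ.+ suc a ≡ a ℕ.+ a ℕ.+ 2
      double = solve 1 (λ a → (con 1 :+ a) :+ (con 1 :+ a) := a :+ a :+ con 2) refl
        where open Data.Nat.Solver.+-*-Solver
  ... | inj₂ t≡3 = subst (p ℕ.+ D ≤_) (ℕ.m+[n∸m]≡n (ℕ.<⇒≤ p<n))
    (ℕ.+-monoʳ-≤ p (dual-min (ℕ.m<n⇒0<n∸m p<n)
      (v ⊕ 𝟏 , LinearCode.⊕-closed (C ^⊥) v∈ (𝟏∈dual t≡3) ,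
       ℕ.+-cancelˡ-≡ p (wt (v ⊕ 𝟏)) (n ℕ.∸ p)
         (trans (cong (ℕ._+ wt (v ⊕ 𝟏)) (sym v≡p))
           (trans (wt-compl v) (sym (ℕ.m+[n∸m]≡n (ℕ.<⇒≤ p<n))))))))

  dual-design-max : ∀ p → 0 < p → p < n → Occurs (C ^⊥) p →
    ∀ t′ → SupportDesign (C ^⊥) p t′ → t′ ≤ t
  dual-design-max p 0<p p<n occ@(v , v∈ , v≡p) t′ des =
    -- Both p and D are even, so p = D + 2q.
    dual-design-max′ D≤w q (subst (λ m → m ℕ.+ D ≤ n) p≡ (dual-upper p<n occ)) t′
      (subst (λ m → SupportDesign (C ^⊥) m t′) p≡ des)
    where
    a b q : ℕ
    a = proj₁ (dual-even v∈)
    b = proj₁ D-even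
    q = a ℕ.∸ b
    p≡a+a : p ≡ a ℕ.+ a
    p≡a+a = trans (sym v≡p) (proj₂ (dual-even v∈))
    D≡b+b : D ≡ b ℕ.+ b
    D≡b+b = proj₂ D-even
    b≤a : b ≤ a
    b≤a = ℕ.≮⇒≥ λ a<b → ℕ.<⇒≱ (ℕ.+-mono-< a<b a<b)
      (subst₂ _≤_ D≡b+b p≡a+a (dual-min 0<p occ))
    rearrange : ∀ b q → (q ℕ.+ b) ℕ.+ (q ℕ.+ b) ≡ b ℕ.+ b ℕ.+ q ℕ.* 2
    rearrange = solve 2 (λ b q → (q :+ b) :+ (q :+ b) := b :+ b :+ q :* con 2) refl
      where open Data.Nat.Solver.+-*-Solver
    p≡ : p ≡ D ℕ.+ q ℕ.* 2
    p≡ = trans p≡a+a (trans (cong₂ ℕ._+_ (sym (ℕ.m∸n+n≡m b≤a)) (sym (ℕ.m∸n+n≡m b≤a)))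
      (trans (rearrange b q) (cong (ℕ._+ q ℕ.* 2) (sym D≡b+b))))

  0<D : 0 < D
  0<D = subst (0 <_) (sym D≡1+t) (s≤s z≤n)

  D-occurs : Occurs (C ^⊥) D
  D-occurs = let y , y∈ , _ , y≡D = dual-word in y , y∈ , y≡D

  δC⊥ : δ (C ^⊥) ≐ t
  δC⊥ = dual-design , λ t′ des → dual-design-max D 0<D D<n D-occurs t′ (des D 0<D D<n D-occurs)

  sC⊥ : s (C ^⊥) ≐ t
  sC⊥ = (D , 0<D , D<n , D-occurs , dual-design D 0<D D<n D-occurs) ,
        λ { t′ (p , 0<p , p<n , occ , des) → dual-design-max p 0<p p<n occ t′ des }

-- From the counting hypothesis to the three cases

fewWeights : ∀ {n d⊥ t} (C : LinearCode n) → Codeword C 𝟏 → HasMinDistance (C ^⊥) d⊥ →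
  0 < t → d⊥ ≡ t ℕ.+ #weights C t → 0 < #weights C t → FewWeights n
fewWeights {n} {d⊥} {t} C 𝟏∈ dual 0<t d⊥≡ 0<# = record
  { C        = C
  ; 𝟏∈       = 𝟏∈
  ; D        = d⊥
  ; t        = t
  ; dual     = dual
  ; 0<t      = 0<t
  ; ws       = ws
  ; unique   = Unique.filter⁺ counted? (Unique.upTo⁺ (suc n))
  ; D≡       = d⊥≡
  ; sound    = λ u∈ → let occ , 0<u , u≤ = proj₂ (∈-filter⁻ counted? {xs = List.upTo (suc n)} u∈)
                      in occ , 0<u , below 0<u u≤
  ; complete = λ {u} occ 0<u u+t≤n → ∈-filter⁺ counted?
      (∈-upTo⁺ (s≤s (ℕ.≤-trans (ℕ.m≤m+n u t) u+t≤n)))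
      (occ , 0<u , ℕ.m+n≤o⇒m≤o∸n u u+t≤n)
  ; nonempty = member ws 0<#
  }
  where
  counted? : Decidable (λ u → Occurs C u × 0 < u × u ≤ n ℕ.∸ t)
  counted? u = occurs? C u ×-dec (0 ℕ.<? u ×-dec u ℕ.≤? n ℕ.∸ t)

  ws : List ℕ
  ws = filter counted? (List.upTo (suc n))

  -- A positive u ≤ n ∸ t forces t < n, so the subtraction is not truncated.
  below : ∀ {u} → 0 < u → u ≤ n ℕ.∸ t → u ℕ.+ t ≤ n
  below {u} 0<u u≤ = ℕ.m≤o∸n⇒m+n≤o u
    (ℕ.<⇒≤ (ℕ.m∸n≢0⇒n<m λ n∸t≡0 → ℕ.<⇒≱ 0<u (subst (u ≤_) n∸t≡0 u≤))) u≤

  member : ∀ us → 0 < length us → ∃ λ u → u ∈ us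
  member (u ∷ _) _ = u , here refl

theorem1p1 : ∀ {n k d d⊥ t : ℕ} (C : LinearCode n) →
    HasDimension C k →
    HasMinDistance C d →
    Codeword C 𝟏 →
    HasMinDistance (C ^⊥) d⊥ →
    0 < t →
    + d⊥ - + t ≡ + (#weights C t) →
    (+ d⊥ - + t ≡ + 1 →
    ((d⊥ , t) ≡ (2 , 1) ⊎ (d⊥ , t) ≡ (4 , 3)) ×
    (∃ λ m → δ C ≐ m × s C ≐ m × δ (C ^⊥) ≐ m × s (C ^⊥) ≐ m ×
    (m ≡ 1 ⊎ m ≡ 3))) ×
    (+ d⊥ - + t ≡ + 2 → (d⊥ , t) ≡ (4 , 2)) ×
    (+ d⊥ - + t ≡ + 3 →
    (d⊥ , t) ≡ (4 , 1) ⊎ (d⊥ , t) ≡ (6 , 3) ⊎ (d⊥ , t) ≡ (8 , 5))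
theorem1p1 {n} {d⊥ = d⊥} {t} C _ _ 𝟏∈ dual 0<t d⊥-t≡ = one , two , three
  where
  -- `FewWeights` asks for a counted weight, which is there once the difference is positive; so F is
  -- built under the hypothesis of each case.
  module _ {j} (d⊥-t≡1+j : + d⊥ - + t ≡ + suc j) where
    #≡ : #weights C t ≡ suc j
    #≡ = ℤ.+-injective (trans (sym d⊥-t≡) d⊥-t≡1+j)

    F : FewWeights n
    F = fewWeights C 𝟏∈ dual 0<t
      (ℤ.+-injective (trans (lemma (+ d⊥) (+ t)) (cong (λ z → + t + z) d⊥-t≡)))
      (subst (0 <_) (sym #≡) (s≤s z≤n))
      where
      lemma : ∀ d t → d ≡ t + (d - t)
      lemma = solve-∀

    t≤ : t ≤ 3 ℕ.+ j
    t≤ = subst (λ m → t ≤ 2 ℕ.+ m) #≡ (Range.t≤2+ws F)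

    d⊥≡ : d⊥ ≡ t ℕ.+ suc j
    d⊥≡ = trans (FewWeights.D≡ F) (cong (t ℕ.+_) #≡)

    half : ℕ
    half = proj₁ (Ends.D-even F)

    even : t ℕ.+ suc j ≡ half ℕ.+ half
    even = trans (sym d⊥≡) (proj₂ (Ends.D-even F))

  One : Set
  One = ((d⊥ , t) ≡ (2 , 1) ⊎ (d⊥ , t) ≡ (4 , 3)) ×
    (∃ λ m → δ C ≐ m × s C ≐ m × δ (C ^⊥) ≐ m × s (C ^⊥) ≐ m × (m ≡ 1 ⊎ m ≡ 3))

  one : + d⊥ - + t ≡ + 1 → One
  one eq = with-ws (FewWeights.ws (F eq)) refl (#≡ eq)
    where
    pair : t ≡ 1 ⊎ t ≡ 3 → (d⊥ , t) ≡ (2 , 1) ⊎ (d⊥ , t) ≡ (4 , 3)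
    pair (inj₁ t≡1) = inj₁ (cong₂ _,_ (trans (d⊥≡ eq) (cong (ℕ._+ 1) t≡1)) t≡1)
    pair (inj₂ t≡3) = inj₂ (cong₂ _,_ (trans (d⊥≡ eq) (cong (ℕ._+ 1) t≡3)) t≡3)

    -- The weights become a variable list, so that its length can determine its shape.
    with-ws : ∀ ws → FewWeights.ws (F eq) ≡ ws → length ws ≡ 1 → One
    with-ws (w ∷ []) ws≡ _ = pair t-cases , t , δC , sC , δC⊥ , sC⊥ , t-cases
      where open OneWeight (F eq) ws≡

  two : + d⊥ - + t ≡ + 2 → (d⊥ , t) ≡ (4 , 2)
  two eq = cases t refl 0<t (t≤ eq) (even eq)
    where
    with-ws : t ≡ 4 → ∀ ws → FewWeights.ws (F eq) ≡ ws → length ws ≡ 2 → ⊥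
    with-ws t≡4 (w₁ ∷ w₂ ∷ []) ws≡ _ = TwoWeights.¬t≡4 (F eq) ws≡ t≡4

    -- Parity of d⊥ removes t = 1 and t = 3; the size of the code removes t = 4.
    cases : ∀ t′ → t ≡ t′ → 0 < t′ → t′ ≤ 4 → t′ ℕ.+ 2 ≡ half eq ℕ.+ half eq →
            (d⊥ , t) ≡ (4 , 2)
    cases 1 _   _ _ ev = ⊥-elim (odd≢even 1 (half eq) ev)
    cases 2 t≡2 _ _ _  = cong₂ _,_ (trans (d⊥≡ eq) (cong (ℕ._+ 2) t≡2)) t≡2
    cases 3 _   _ _ ev = ⊥-elim (odd≢even 2 (half eq) ev)
    cases 4 t≡4 _ _ _  = ⊥-elim (with-ws t≡4 (FewWeights.ws (F eq)) refl (#≡ eq))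
    cases (suc (suc (suc (suc (suc _))))) _ _ (s≤s (s≤s (s≤s (s≤s ())))) _

  three : + d⊥ - + t ≡ + 3 →
    (d⊥ , t) ≡ (4 , 1) ⊎ (d⊥ , t) ≡ (6 , 3) ⊎ (d⊥ , t) ≡ (8 , 5)
  three eq = cases t refl 0<t (t≤ eq) (even eq)
    where
    pair : ∀ {t′} → t ≡ t′ → (d⊥ , t) ≡ (t′ ℕ.+ 3 , t′)
    pair t≡t′ = cong₂ _,_ (trans (d⊥≡ eq) (cong (ℕ._+ 3) t≡t′)) t≡t′

    cases : ∀ t′ → t ≡ t′ → 0 < t′ → t′ ≤ 5 → t′ ℕ.+ 3 ≡ half eq ℕ.+ half eq →
            (d⊥ , t) ≡ (4 , 1) ⊎ (d⊥ , t) ≡ (6 , 3) ⊎ (d⊥ , t) ≡ (8 , 5)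
    cases 1 t≡1 _ _ _  = inj₁ (pair t≡1)
    cases 2 _   _ _ ev = ⊥-elim (odd≢even 2 (half eq) ev)
    cases 3 t≡3 _ _ _  = inj₂ (inj₁ (pair t≡3))
    cases 4 _   _ _ ev = ⊥-elim (odd≢even 3 (half eq) ev)
    cases 5 t≡5 _ _ _  = inj₂ (inj₂ (pair t≡5))
    cases (suc (suc (suc (suc (suc (suc _)))))) _ _ (s≤s (s≤s (s≤s (s≤s (s≤s ()))))) _
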